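{- Let $\ell\ge 1$ and $0\le m\le \ell$ be integers, let $\Lambda_\ell=(3\ell-2,3\ell-5,\dots,7,4,1)$, and let $\mathcal F_1^m(\Lambda_\ell)$ be the set of strict partitions obtained from $\Lambda_\ell$ by adding $m$ nodes labelled $1$ (defined in the context). Then $$\sum_{\mu\in\mathcal F_1^m(\Lambda_\ell)}\bar\delta_3(\mu)\,S_{\mu^b[1]}(\boldsymbol x)=\varepsilon(\ell,m)\,\big(p_2\circ S_{\square(\ell-m,m)}\big)(\boldsymbol x),$$ where $$\varepsilon(\ell,m)=\begin{cases}(-1)^{\binom m2}, & 0\le m\le \ell/2,\\ (-1)^{\binom{\ell-m+1}{2}+(\ell-m)m}, & \ell/2\le m\le \ell.\end{cases}$$
   Context: $S_\lambda(\boldsymbol x)$ denotes the Schur function in variables $\boldsymbol x=(x_1,x_2,\dots)$; $\square(n,m)$ denotes the rectangular partition $(m^n)=(m,\dots,m)$ ($n$ parts). For a symmetric function $F$, the plethysm is $(p_2\circ F)(\boldsymbol x)=F(x_1^2,x_2^2,\dots)$. Nodes of $\Lambda_\ell$: in each row of a Young diagram of a strict partition, fill the cells from the left with the repeating pattern $0,1,0,0,1,0,\dots$ (i.e. the cell in column $j$ gets label $1$ iff $j\equiv 2 \pmod 3$). Row $i$ ($1\le i\le \ell$) of $\Lambda_\ell$ has length $3(\ell-i)+1$, and the cell that can be added at the end of row $i$ has label $1$. Thus $\mathcal F_1^m(\Lambda_\ell)$ is the set of the $\binom{\ell}{m}$ partitions $\Lambda_\ell+\sum_{i\in I}e_i$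 with $I\subseteq\{1,\dots,\ell\}$, $|I|=m$ ($e_i$ the $i$-th unit vector), i.e. adding one box at the end of each row $i\in I$. $r$-quotient: for a partition $\lambda=(\lambda_1,\dots,\lambda_N)$ padded with zeros so that $N$ is a multiple of $r$, put $\delta_N=(N-1,\dots,1,0)$, $\xi=\lambda+\delta_N$, and for $k=0,\dots,r-1$ let $\xi^{(k)}=(\xi^{(k)}_1>\dots>\xi^{(k)}_{N_k})$ be the elements of $\{(\xi_i-k)/r:\xi_i\equiv k \pmod r\}$ in decreasing order; then $\lambda[k]=\xi^{(k)}-\delta_{N_k}$, and $(\lambda[0],\dots,\lambda[r-1])$ is the $r$-quotient. Double: for a strict partition $\lambda=(\lambda_1>\dots>\lambda_l>0)$, $D(\lambda)$ is the partition with Frobenius notation $(\lambda_1,\dots,\lambda_l\mid \lambda_1-1,\dots,\lambda_l-1)$. The 3-bar quotient component $\lambda^b[1]$ is defined as $D(\lambda)[1]$, the component with index $1$ of the $3$-quotient of $D(\lambda)$. 3-bar sign $\bar\delta_3(\lambda)$ of a strict partition $\lambda$ with $l$ parts: place beads at the positions $\lambda_1,\dots,\lambda_l$ among the nonnegative integers, arranged in three runners (runner $k$ = positions $\equiv k\pmod 3$). Natural numbering: number the beads $1,\dots,l$ in increasing order of position. 3-bar numbering: first number the beads of runner $0$ in increasing order; next, pairing the $j$-th smallest bead of runner $1$ with the $j$-th smallest bead of runner $2$ ($j=1,\dots,$ the smaller of the two bead counts), go through the pairs for increasing $j$, numbering within each pair the runner-$2$ bead before the runner-$1$ bead; finally number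 the remaining beads in increasing order of position. Let $\bar\sigma_3(\lambda)$ be the permutation sending the natural number of each bead to its 3-bar number; $\bar\delta_3(\lambda)=\operatorname{sgn}\bar\sigma_3(\lambda)$. -}

module Defs where

open import Data.Nat using (ℕ; zero; suc; _+_; _*_; _∸_; _≤ᵇ_; _≡ᵇ_; _<ᵇ_; NonZero)
open import Data.Nat.DivMod using (_/_; _%_)
open import Data.Nat.Combinatorics using (_C_)
open import Data.Bool using (Bool; true; false; if_then_else_; _∧_; not)
open import Data.List using (List; []; _∷_; map; length; filterᵇ; upTo; downFrom;
  zipWith; replicate; reverse; concat; concatMap; _++_; foldr)
open import Data.Bool.ListAction using (and)
open import Data.Integer as ℤ using (ℤ; 1ℤ; -1ℤ; +_)

nth : ℕ → List ℕ → ℕ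
nth _       []       = 0
nth zero    (x ∷ _)  = x
nth (suc i) (_ ∷ xs) = nth i xs

count : {A : Set} → (A → Bool) → List A → ℕ
count p xs = length (filterᵇ p xs)

even : ℕ → Bool
even k = k % 2 ≡ᵇ 0

signℤ : ℕ → ℤ
signℤ k = if even k then 1ℤ else -1ℤ

sumℤ : List ℤ → ℤ
sumℤ = foldr ℤ._+_ (+ 0)

-- Partitions are lists of weakly decreasing naturals (largest part first);
-- trailing zeros are allowed and harmless.

Λ : ℕ → List ℕ
Λ ℓ = map (λ i → 3 * (ℓ ∸ suc i) + 1) (upTo ℓ)

choose : ℕ → ℕ → List (List Bool)
choose zero    zero    = [] ∷ []
choose zero    (suc k) = []
choose (suc n) zero    = map (false ∷_) (choose n zero)
choose (suc n) (suc k) = map (false ∷_) (choose n (suc k)) ++ map (true ∷_) (choose n k)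

addNodes : List ℕ → List Bool → List ℕ
addNodes = zipWith (λ a b → if b then suc a else a)

F1 : ℕ → ℕ → List (List ℕ)
F1 m ℓ = map (addNodes (Λ ℓ)) (choose ℓ m)

rect : ℕ → ℕ → List ℕ
rect n m = replicate n m

-- Double D(λ) of a strict partition λ = (λ_1 > … > λ_d):
-- Frobenius notation (a_1,…,a_d | b_1,…,b_d) with a_i = λ_i, b_i = λ_i - 1.
-- Converted to rows: row i (1-indexed) has length a_i + i for i ≤ d, and for
-- i > d it has length #{ j ≤ d : b_j + j ≥ i } (column j has length b_j + j).
-- The number of rows is b_1 + 1 = λ_1.

double : List ℕ → List ℕ
double λs = map row (map suc (upTo (nth 0 λs)))
  where
  d = length λs
  row : ℕ → ℕ
  row i = if i ≤ᵇ d
          then nth (i ∸ 1) λs + i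
          else count (λ j → i ≤ᵇ (nth (j ∸ 1) λs ∸ 1) + j) (map suc (upTo d))

-- r-quotient component λ[k] (pad λ with zeros to length N, a multiple of r)

quotient : (r : ℕ) → .{{NonZero r}} → ℕ → List ℕ → List ℕ
quotient r k λs = zipWith _∸_ sel (downFrom (length sel))
  where
  len = length λs
  N   = len + ((r ∸ len % r) % r)
  ξ   = zipWith _+_ (λs ++ replicate (N ∸ len) 0) (downFrom N)
  sel = map (λ x → (x ∸ k) / r) (filterᵇ (λ x → x % r ≡ᵇ k) ξ)

barQuot1 : List ℕ → List ℕ
barQuot1 λs = quotient 3 1 (double λs)

-- 3-bar sign δ̄_3(λ) of a strict partition λ (parts in decreasing order).
-- Beads at positions λ_1,…,λ_l; 'barOrder' lists the bead positions in the
-- order of their 3-bar numbering; the permutation σ̄_3 (natural number ↦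
-- 3-bar number) has sign (-1)^(number of inversions of this list).

runner : ℕ → List ℕ → List ℕ
runner k λs = filterᵇ (λ p → p % 3 ≡ᵇ k) (reverse λs)

pairUp : List ℕ → List ℕ → List ℕ
pairUp (a ∷ as) (b ∷ bs) = b ∷ a ∷ pairUp as bs
pairUp as       []       = as
pairUp []       bs       = bs

barOrder : List ℕ → List ℕ
barOrder λs = runner 0 λs ++ pairUp (runner 1 λs) (runner 2 λs)

inversions : List ℕ → ℕ
inversions []       = 0
inversions (x ∷ xs) = count (λ y → y <ᵇ x) xs + inversions xs

barSign : List ℕ → ℤ
barSign λs = signℤ (inversions (barOrder λs))

-- Schur functions via semistandard Young tableaux.
-- A symmetric function in x = (x_1,x_2,…) is determined by the coefficients
-- of all monomials x_1^{α_1}⋯x_n^{α_n}; an exponent vector is a List ℕ α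
-- (n = length α).  The coefficient of x^α in S_λ(x) is the number of
-- SSYT of shape λ with entries in {1,…,n} (encoded as 0,…,n-1) and
-- content α.

words : ℕ → ℕ → List (List ℕ)
words n zero    = [] ∷ []
words n (suc k) = concatMap (λ a → map (a ∷_) (words n k)) (upTo n)

fillings : ℕ → List ℕ → List (List (List ℕ))
fillings n []       = [] ∷ []
fillings n (r ∷ rs) = concatMap (λ w → map (w ∷_) (fillings n rs)) (words n r)

weakInc : List ℕ → Bool
weakInc (a ∷ b ∷ xs) = (a ≤ᵇ b) ∧ weakInc (b ∷ xs)
weakInc _            = true

colStrict : List (List ℕ) → Bool
colStrict (r ∷ r' ∷ rs) = and (zipWith (λ below above → above <ᵇ below) r' r)
                          ∧ colStrict (r' ∷ rs)
colStrict _             = true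

semistandard : List (List ℕ) → Bool
semistandard T = and (map weakInc T) ∧ colStrict T

hasContent : List ℕ → List (List ℕ) → Bool
hasContent α T = and (map (λ i → count (λ e → e ≡ᵇ i) (concat T) ≡ᵇ nth i α)
                          (upTo (length α)))

schurCoeff : List ℕ → List ℕ → ℕ
schurCoeff λs α =
  count (λ T → semistandard T ∧ hasContent α T) (fillings (length α) λs)

-- coefficient of x^α in (p_2 ∘ F)(x) = F(x_1^2, x_2^2, …), given the
-- coefficient function of F
p2∘ : (List ℕ → ℕ) → List ℕ → ℕ
p2∘ F α = if and (map even α) then F (map (λ a → a / 2) α) else 0

ε : ℕ → ℕ → ℤ
ε ℓ m = if 2 * m ≤ᵇ ℓ
        then signℤ (m C 2)
        else signℤ (((ℓ ∸ m + 1) C 2) + (ℓ ∸ m) * m)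

lhsCoeff : ℕ → ℕ → List ℕ → ℤ
lhsCoeff ℓ m α = sumℤ (map (λ μ → barSign μ ℤ.* + schurCoeff (barQuot1 μ) α) (F1 m ℓ))

rhsCoeff : ℕ → ℕ → List ℕ → ℤ
rhsCoeff ℓ m α = ε ℓ m ℤ.* + p2∘ (schurCoeff (rect (ℓ ∸ m) m)) α

{-# OPTIONS --safe #-}

-- In beta-number (bead) coordinates the coefficient of x^α in a Schur function is obtained by applying
-- h_k^⊥, for the parts k of α, to an alternating function of the beads: h_k^⊥ lowers the beads by k in
-- total in all possible ways, and the terms that violate interlacing cancel in pairs.  The 3-bar quotient
-- of Λ ℓ + Σ_{i∈I} e_i has the beads ℓ + j and ℓ - 1 - j, where j runs over the n = ℓ - m rows not in I,
-- counted from the bottom.  These pairs have the constant odd sum 2ℓ - 1, so up to signs the left-hand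
-- side is ω^n / n! with ω = Σ_{a+b=ℓ-1} v_{2a} ∧ v_{2b+1}.  Applying Σ_k x^k h_k^⊥ to ω gives
-- Σ_c x^{2c} ω_c, with ω_c the same sum over a + b = ℓ - 1 - c; hence only even k survive, and h_k^⊥ acts
-- as h_{k/2}^⊥ on the even beads 2a alone.  At the end the odd beads must be 1, 3, …, 2n - 1, which
-- forces a to be a permutation of m, …, m + n - 1: these are the beads of the rectangle (m^n).
-- Working with all ordered n-tuples of pairs instead of n-subsets costs a factor n!, cancelled at the end.
module Submission where

open import Defs
open import Data.Nat using (ℕ; zero; suc; _+_; _*_; _∸_; _≤_; _<_; z≤n; s≤s; _≤ᵇ_; _<ᵇ_; _≡ᵇ_; _!)
import Data.Nat.Properties as ℕ
open import Data.Nat.DivMod using (_/_; _%_; m*n/n≡m; m/n≡1+[m∸n]/n; [m+kn]%n≡m%n)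
open import Data.Nat.Combinatorics using (_C_; nC1≡n; nCk+nC[k+1]≡[n+1]C[k+1])
open import Data.Integer using (ℤ; 0ℤ; 1ℤ; -1ℤ; -_; -[1+_]) renaming (+_ to pos; _+_ to _⊕_; _*_ to _⊗_)
import Data.Integer.Properties as ℤ
open import Data.Integer.Tactic.RingSolver using (solve-∀)
open import Data.Bool using (Bool; true; false; if_then_else_; _∧_; T)
open import Data.Bool.Properties using (∧-assoc; ∧-comm; ∧-identityʳ)
open import Data.Bool.ListAction using (and)
open import Data.Vec using (Vec; []; _∷_; _∷ʳ_; toList; replicate; sum) renaming (map to vmap)
open import Data.List as L using (List; []; _∷_; length; reverse; _++_; concat; upTo; downFrom)
import Data.List.Properties as L
open import Data.List.Relation.Unary.All as All using (All; []; _∷_)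
open import Data.List.Relation.Unary.All.Properties using () renaming (++⁺ to All-++)
open import Data.Product using (_×_; _,_; proj₁; proj₂)
open import Data.Sum using (_⊎_; inj₁; inj₂)
open import Data.Unit using (⊤; tt)
open import Data.Empty using (⊥; ⊥-elim)
open import Function using (_∘_; id)
open import Relation.Binary.Definitions using (tri<; tri≈; tri>)
open import Relation.Binary.PropositionalEquality
open ≡-Reasoning

-- Everything hinges on the signs. Among the sets I with n rows outside I, the 3-bar sign varies
-- only through (-1) to the power Σ j; its other factors depend on n and m alone. This is exactly
-- the orientation that the pairs need: (-1)^j is (-1)^(ℓ+j) up to the constant (-1)^ℓ, and
-- exchanging the two beads of a pair of odd sum flips both this parity sign and the alternating
-- function, so every signed pair may be written with its even bead first. The remaining exponents
-- are nℓ from these constants, C(n,2) from the bar sign and C(n,2) from listing the beads of the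
-- rectangle in ascending order, which cancel, n from putting even beads before odd ones at the end,
-- and the interleaving of the two runners; together they give ε. Skewing has to make sense for bead
-- vectors in any order, since regrouping into even and odd beads leaves the decreasing vectors of
-- partitions at once. Hence the sums over full boxes; horizontal strips reappear only where a box
-- is compared with tableaux.

-- Finite sums and linear functionals

∑ : ℕ → (ℕ → ℤ) → ℤ
∑ zero    f = 0ℤ
∑ (suc n) f = ∑ n f ⊕ f n

guard : Bool → ℤ → ℤ
guard b x = if b then x else 0ℤ

-- All iterated sums below are treated as linear functionals, so that interchange, negation and
-- conditions are handled once for all of them. `ext` belongs to the notion because summands are
-- only known to agree pointwise.
record Lin {A : Set} (S : (A → ℤ) → ℤ) : Set where
  field
    ext   : ∀ {f g} → (∀ x → f x ≡ g x) → S f ≡ S g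
    add   : ∀ f g → S (λ x → f x ⊕ g x) ≡ S f ⊕ S g
    scale : ∀ c f → S (λ x → c ⊗ f x) ≡ c ⊗ S f

  null : ∀ {f} → (∀ x → f x ≡ 0ℤ) → S f ≡ 0ℤ
  null {f} p = begin
    S f                  ≡⟨ ext (λ x → trans (p x) (sym (ℤ.*-zeroˡ (f x)))) ⟩
    S (λ x → 0ℤ ⊗ f x)   ≡⟨ scale 0ℤ f ⟩
    0ℤ ⊗ S f             ≡⟨ ℤ.*-zeroˡ (S f) ⟩
    0ℤ                   ∎

  neg : ∀ f → S (λ x → - f x) ≡ - S f
  neg f = begin
    S (λ x → - f x)       ≡⟨ ext (λ x → sym (ℤ.-1*i≡-i (f x))) ⟩
    S (λ x → -1ℤ ⊗ f x)   ≡⟨ scale -1ℤ f ⟩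
    -1ℤ ⊗ S f             ≡⟨ ℤ.-1*i≡-i (S f) ⟩
    - S f                 ∎

  pull-guard : ∀ b f → S (λ x → guard b (f x)) ≡ guard b (S f)
  pull-guard true  f = refl
  pull-guard false f = null (λ _ → refl)

open Lin

lin-eval : ∀ {A : Set} (x : A) → Lin (λ f → f x)
lin-eval x = record { ext = λ p → p x ; add = λ _ _ → refl ; scale = λ _ _ → refl }

lin-0 : ∀ {A : Set} → Lin {A} (λ _ → 0ℤ)
lin-0 = record { ext = λ _ → refl ; add = λ _ _ → refl ; scale = λ c _ → sym (ℤ.*-zeroʳ c) }

⊕-swap : ∀ a b c d → (a ⊕ b) ⊕ (c ⊕ d) ≡ (a ⊕ c) ⊕ (b ⊕ d)
⊕-swap = solve-∀

lin-⊕ : ∀ {A : Set} {S T : (A → ℤ) → ℤ} → Lin S → Lin T → Lin (λ f → S f ⊕ T f)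
lin-⊕ {S = S} {T = T} s t = record
  { ext   = λ p → cong₂ _⊕_ (ext s p) (ext t p)
  ; add   = λ f g → trans (cong₂ _⊕_ (add s f g) (add t f g)) (⊕-swap (S f) (S g) (T f) (T g))
  ; scale = λ c f → trans (cong₂ _⊕_ (scale s c f) (scale t c f)) (sym (ℤ.*-distribˡ-+ c (S f) (T f)))
  }

lin-guard : ∀ {A : Set} {S : (A → ℤ) → ℤ} b → Lin S → Lin (λ f → guard b (S f))
lin-guard true  s = s
lin-guard false s = lin-0

lin-∘ : ∀ {A B : Set} {S : (A → ℤ) → ℤ} {T : A → (B → ℤ) → ℤ} →
  Lin S → (∀ x → Lin (T x)) → Lin (λ f → S (λ x → T x f))
lin-∘ {S = S} {T = T} s t = record
  { ext   = λ p → ext s (λ x → ext (t x) p)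
  ; add   = λ f g → trans (ext s (λ x → add (t x) f g)) (add s (λ x → T x f) (λ x → T x g))
  ; scale = λ c f → trans (ext s (λ x → scale (t x) c f)) (scale s c (λ x → T x f))
  }

lin-∑ : ∀ n → Lin (∑ n)
lin-∑ zero    = lin-0
lin-∑ (suc n) = lin-⊕ (lin-∑ n) (lin-eval n)

lin-pre : ∀ {A B : Set} {S : (A → ℤ) → ℤ} (φ : A → B) → Lin S → Lin (λ f → S (f ∘ φ))
lin-pre φ s = lin-∘ s (λ x → lin-eval (φ x))

∑-ext : ∀ n {f g} → (∀ i → f i ≡ g i) → ∑ n f ≡ ∑ n g
∑-ext n = ext (lin-∑ n)

∑-ext< : ∀ n {f g} → (∀ i → i < n → f i ≡ g i) → ∑ n f ≡ ∑ n g
∑-ext< zero    p = refl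
∑-ext< (suc n) p = cong₂ _⊕_ (∑-ext< n (λ i i<n → p i (ℕ.m<n⇒m<1+n i<n))) (p n ℕ.≤-refl)

∑-null< : ∀ n {f} → (∀ i → i < n → f i ≡ 0ℤ) → ∑ n f ≡ 0ℤ
∑-null< n p = trans (∑-ext< n p) (null (lin-∑ n) (λ _ → refl))

∑-swap : ∀ {A : Set} {S : (A → ℤ) → ℤ} → Lin S → ∀ n (f : ℕ → A → ℤ) →
  ∑ n (λ i → S (f i)) ≡ S (λ x → ∑ n (λ i → f i x))
∑-swap s zero    f = sym (null s (λ _ → refl))
∑-swap s (suc n) f = trans (cong₂ _⊕_ (∑-swap s n f) refl) (sym (add s (λ x → ∑ n (λ i → f i x)) (f n)))

∑-suc : ∀ n f → ∑ (suc n) f ≡ f 0 ⊕ ∑ n (f ∘ suc)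
∑-suc zero    f = ℤ.+-comm 0ℤ (f 0)
∑-suc (suc n) f = trans (cong (_⊕ f (suc n)) (∑-suc n f)) (ℤ.+-assoc (f 0) _ _)

∑-+ : ∀ m n f → ∑ (m + n) f ≡ ∑ m f ⊕ ∑ n (λ i → f (m + i))
∑-+ zero    n f = sym (ℤ.+-identityˡ _)
∑-+ (suc m) n f = begin
  ∑ (suc (m + n)) f                                   ≡⟨ ∑-suc (m + n) f ⟩
  f 0 ⊕ ∑ (m + n) (f ∘ suc)                           ≡⟨ cong (f 0 ⊕_) (∑-+ m n (f ∘ suc)) ⟩
  f 0 ⊕ (∑ m (f ∘ suc) ⊕ ∑ n (λ i → f (suc m + i)))   ≡⟨ sym (ℤ.+-assoc (f 0) _ _) ⟩
  (f 0 ⊕ ∑ m (f ∘ suc)) ⊕ ∑ n (λ i → f (suc m + i))   ≡⟨ cong₂ _⊕_ (sym (∑-suc m f)) refl ⟩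
  ∑ (suc m) f ⊕ ∑ n (λ i → f (suc m + i))             ∎

∑-reverse : ∀ n f → ∑ n f ≡ ∑ n (λ i → f (n ∸ suc i))
∑-reverse zero    f = refl
∑-reverse (suc n) f = begin
  ∑ n f ⊕ f n                                  ≡⟨ ℤ.+-comm (∑ n f) (f n) ⟩
  f n ⊕ ∑ n f                                  ≡⟨ cong (f n ⊕_) (∑-reverse n f) ⟩
  f n ⊕ ∑ n (λ i → f (n ∸ suc i))              ≡⟨ sym (∑-suc n (λ i → f (n ∸ i))) ⟩
  ∑ (suc n) (λ i → f (n ∸ i))                  ∎

x≡-x⇒x≡0 : ∀ x → x ≡ - x → x ≡ 0ℤ
x≡-x⇒x≡0 (pos zero)       _ = refl
x≡-x⇒x≡0 (pos (suc n))       ()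
x≡-x⇒x≡0 -[1+ n ]        ()

Antisym : (ℕ → ℕ → ℤ) → Set
Antisym φ = ∀ a b → φ a b ≡ - φ b a

-- Transposing the square preserves the range and negates the summand, so the sum equals its own
-- negative.
∑-square-0 : ∀ n {φ} → Antisym φ → ∑ n (λ a → ∑ n (φ a)) ≡ 0ℤ
∑-square-0 n {φ} anti = x≡-x⇒x≡0 _ (begin
  ∑ n (λ a → ∑ n (φ a))                ≡⟨ ∑-swap (lin-∑ n) n φ ⟩
  ∑ n (λ b → ∑ n (λ a → φ a b))        ≡⟨ ∑-ext n (λ b → ∑-ext n (λ a → anti a b)) ⟩
  ∑ n (λ b → ∑ n (λ a → - φ b a))      ≡⟨ ∑-ext n (λ b → neg (lin-∑ n) (φ b)) ⟩
  ∑ n (λ b → - ∑ n (φ b))              ≡⟨ neg (lin-∑ n) _ ⟩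
  - ∑ n (λ b → ∑ n (φ b))              ∎)

-- Alternating functions

-- Only swaps of neighbours are demanded, at every depth. They generate the symmetric group, and in
-- this form fixing leading arguments costs nothing.
Alt : ∀ n → (Vec ℕ n → ℤ) → Set
Alt zero          f = ⊤
Alt (suc zero)    f = ⊤
Alt (suc (suc n)) f = (∀ a b q → f (a ∷ b ∷ q) ≡ - f (b ∷ a ∷ q)) × (∀ a → Alt (suc n) (λ q → f (a ∷ q)))

alt-tail : ∀ {n f} → Alt (suc n) f → ∀ a → Alt n (λ q → f (a ∷ q))
alt-tail {zero}  _ _ = tt
alt-tail {suc n} h a = proj₂ h a

alt-lin : ∀ {A : Set} {S : (A → ℤ) → ℤ} → Lin S → ∀ {n} (f : A → Vec ℕ n → ℤ) →
  (∀ x → Alt n (f x)) → Alt n (λ v → S (λ x → f x v))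
alt-lin s {zero}        f h = tt
alt-lin s {suc zero}    f h = tt
alt-lin s {suc (suc n)} f h =
  (λ a b q → trans (ext s (λ x → proj₁ (h x) a b q)) (neg s _)) ,
  (λ a → alt-lin s (λ x q → f x (a ∷ q)) (λ x → proj₂ (h x) a))

alt-guard : ∀ b {n f} → Alt n f → Alt n (λ v → guard b (f v))
alt-guard b {f = f} h = alt-lin (lin-guard b (lin-eval tt)) (λ _ → f) (λ _ → h)

alt-map : ∀ (φ : ℕ → ℕ) {n f} → Alt n f → Alt n (λ v → f (vmap φ v))
alt-map φ {zero}        h = tt
alt-map φ {suc zero}    h = tt
alt-map φ {suc (suc n)} h = (λ a b q → proj₁ h (φ a) (φ b) (vmap φ q)) , (λ a → alt-map φ (proj₂ h (φ a)))

alt-ext : ∀ {n f g} → (∀ v → f v ≡ g v) → Alt n f → Alt n g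
alt-ext {zero}        p h = tt
alt-ext {suc zero}    p h = tt
alt-ext {suc (suc n)} p h =
  (λ a b q → trans (sym (p _)) (trans (proj₁ h a b q) (cong -_ (p _)))) , (λ a → alt-ext (λ v → p (a ∷ v)) (proj₂ h a))

sum-swap : ∀ a b c → a + (b + c) ≡ b + (a + c)
sum-swap a b c = trans (sym (ℕ.+-assoc a b c)) (trans (cong (_+ c) (ℕ.+-comm a b)) (ℕ.+-assoc b a c))

-- The total of the arguments is invariant under swaps, so a condition on the weight may be imposed
-- without losing alternation.
alt-sum : ∀ {n} {g : ℕ → Vec ℕ n → ℤ} → (∀ t → Alt n (g t)) → Alt n (λ v → g (sum v) v)
alt-sum {zero}        h = tt
alt-sum {suc zero}    h = tt
alt-sum {suc (suc n)} {g} h =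
  (λ a b q → trans (cong (λ t → g t (a ∷ b ∷ q)) (sum-swap a b (sum q))) (proj₁ (h _) a b q))
  , (λ a → alt-sum {g = λ t q → g (a + t) (a ∷ q)} (λ t → proj₂ (h (a + t)) a))

-- Skewing as a sum over boxes

-- Each bead is lowered independently of the others, without any interlacing condition. This product
-- form is what makes the operators commute with permutations of the beads and with sums over the
-- other beads.
box : ∀ {n} → Vec ℕ n → (Vec ℕ n → ℤ) → ℤ
box []      f = f []
box (x ∷ ξ) f = ∑ (suc x) λ y → box ξ λ η → f (y ∷ η)

lin-box : ∀ {n} (ξ : Vec ℕ n) → Lin (box ξ)
lin-box []      = lin-eval []
lin-box (x ∷ ξ) = lin-∘ (lin-∑ (suc x)) (λ y → lin-pre (y ∷_) (lin-box ξ))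

alt-box : ∀ {n f} → Alt n f → Alt n (λ ξ → box ξ f)
alt-box {zero}        h = tt
alt-box {suc zero}    h = tt
alt-box {suc (suc n)} {f} h = swap , 
  (λ a → alt-lin (lin-∑ (suc a)) (λ y ξ → box ξ (λ η → f (y ∷ η))) (λ y → alt-box (proj₂ h y)))
  where
  swap : ∀ a b q → box (a ∷ b ∷ q) f ≡ - box (b ∷ a ∷ q) f
  swap a b q = begin
    ∑ (suc a) (λ y → ∑ (suc b) (λ z → box q (λ η → f (y ∷ z ∷ η))))
      ≡⟨ ∑-swap (lin-∑ (suc b)) (suc a) _ ⟩
    ∑ (suc b) (λ z → ∑ (suc a) (λ y → box q (λ η → f (y ∷ z ∷ η))))
      ≡⟨ ∑-ext (suc b) (λ z → ∑-ext (suc a) (λ y →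
           trans (ext (lin-box q) (λ η → proj₁ h y z η)) (neg (lin-box q) _))) ⟩
    ∑ (suc b) (λ z → ∑ (suc a) (λ y → - box q (λ η → f (z ∷ y ∷ η))))
      ≡⟨ trans (∑-ext (suc b) (λ z → neg (lin-∑ (suc a)) _)) (neg (lin-∑ (suc b)) _) ⟩
    - ∑ (suc b) (λ z → ∑ (suc a) (λ y → box q (λ η → f (z ∷ y ∷ η)))) ∎

step : ∀ {n} → ℕ → (Vec ℕ n → ℤ) → Vec ℕ n → ℤ
step k f ξ = box ξ λ η → guard (sum η + k ≡ᵇ sum ξ) (f η)

-- The skewing operators h_k^⊥ in bead coordinates, one for each k in κ.
D : ∀ {n} → (Vec ℕ n → ℤ) → List ℕ → Vec ℕ n → ℤ
D f []      = f
D f (k ∷ κ) = step k (D f κ)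

alt-step : ∀ k {n f} → Alt n f → Alt n (step k f)
alt-step k {f = f} h =
  alt-sum {g = λ t ξ → box ξ (λ η → guard (sum η + k ≡ᵇ t) (f η))} λ t →
  alt-box (alt-sum {g = λ s η → guard (s + k ≡ᵇ t) (f η)} λ s → alt-guard (s + k ≡ᵇ t) h)

alt-D : ∀ κ {n f} → Alt n f → Alt n (D f κ)
alt-D []      h = h
alt-D (k ∷ κ) h = alt-step k (alt-D κ h)

lin-D : ∀ κ {n} (ξ : Vec ℕ n) → Lin (λ f → D f κ ξ)
lin-D []      ξ = lin-eval ξ
lin-D (k ∷ κ) ξ = lin-∘ (lin-box ξ) (λ η → lin-guard (sum η + k ≡ᵇ sum ξ) (lin-D κ η))

-- Interlacing partitions and horizontal strips

addδ : ∀ {n} → Vec ℕ n → Vec ℕ n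
addδ []                = []
addδ {suc n} (r ∷ rs) = r + n ∷ addδ rs

head0 : ∀ {n} → Vec ℕ n → ℕ
head0 []      = 0
head0 (r ∷ _) = r

Dec : ∀ {n} → Vec ℕ n → Set
Dec []       = ⊤
Dec (r ∷ rs) = head0 rs ≤ r × Dec rs

Interlace : ∀ {n} → Vec ℕ n → Vec ℕ n → Set
Interlace []      []       = ⊤
Interlace (m ∷ μ) (r ∷ rs) = head0 rs ≤ m × m ≤ r × Interlace μ rs

interlace-head : ∀ {n} (μ v : Vec ℕ n) → Interlace μ v → head0 μ ≤ head0 v
interlace-head []      []      _           = z≤n
interlace-head (m ∷ μ) (r ∷ v) (_ , q , _) = q

interlace-dec : ∀ {n} (μ v : Vec ℕ n) → Interlace μ v → Dec μ
interlace-dec []      []      _           = tt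
interlace-dec (m ∷ μ) (r ∷ v) (p , _ , i) = ℕ.≤-trans (interlace-head μ v i) p , interlace-dec μ v i

-- The sum over all μ such that v/μ is a horizontal strip, each part being given by its excess t
-- over the next part of v. If v were not decreasing, truncated subtraction would still leave a
-- term, hence `Dec` in `strip-ext` and `box-strip`.
strip : ∀ {n} → Vec ℕ n → (Vec ℕ n → ℤ) → ℤ
strip []       f = f []
strip (r ∷ rs) f = ∑ (suc (r ∸ head0 rs)) λ t → strip rs λ μ → f (head0 rs + t ∷ μ)

lin-strip : ∀ {n} (v : Vec ℕ n) → Lin (strip v)
lin-strip []       = lin-eval []
lin-strip (r ∷ rs) = lin-∘ (lin-∑ (suc (r ∸ head0 rs))) (λ t → lin-pre (head0 rs + t ∷_) (lin-strip rs))

strip-ext : ∀ {n} (v : Vec ℕ n) → Dec v → ∀ {f g} → (∀ μ → Interlace μ v → f μ ≡ g μ) → strip v f ≡ strip v g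
strip-ext []       _       p = p [] tt
strip-ext (r ∷ rs) (h , d) p = ∑-ext< (suc (r ∸ head0 rs)) λ t t≤ → strip-ext rs d λ μ i →
  p _ (ℕ.m≤m+n (head0 rs) t ,
       subst (head0 rs + t ≤_) (ℕ.m+[n∸m]≡n h) (ℕ.+-monoʳ-≤ (head0 rs) (ℕ.≤-pred t≤)) , i)

∑-split : ∀ {h r} → h ≤ r → ∀ f → ∑ (suc r) f ≡ ∑ h f ⊕ ∑ (suc (r ∸ h)) (λ t → f (h + t))
∑-split {h} {r} h≤r f = trans
  (cong (λ k → ∑ k f) (trans (cong suc (sym (ℕ.m+[n∸m]≡n h≤r))) (sym (ℕ.+-suc h (r ∸ h)))))
  (∑-+ h (suc (r ∸ h)) f)

-- The part of the box with η₁ ≤ ξ₂ contributes nothing: there (η₁ , η₂) runs over a square.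
box-strip : ∀ {n} (v : Vec ℕ n) → Dec v → ∀ {f} → Alt n f → box (addδ v) f ≡ strip v (f ∘ addδ)
box-strip []       _ _ = refl
box-strip (r ∷ []) _ {f} _ = trans
  (cong (λ k → ∑ (suc k) (λ y → f (y ∷ []))) (ℕ.+-identityʳ r))
  (∑-ext (suc r) (λ t → cong (λ k → f (k ∷ [])) (sym (ℕ.+-identityʳ t))))
box-strip {suc (suc n)} (r ∷ r' ∷ rs) (h , d) {f} alt = begin
  ∑ (suc (r + suc n)) B
    ≡⟨ ∑-split (ℕ.+-monoˡ-≤ (suc n) h) B ⟩
  ∑ (r' + suc n) B ⊕ ∑ (suc (r + suc n ∸ (r' + suc n))) (λ t → B (r' + suc n + t))
    ≡⟨ cong₂ _⊕_ (trans (cong (λ k → ∑ k B) (ℕ.+-suc r' n)) low)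
                 (cong (λ k → ∑ (suc k) (λ t → B (r' + suc n + t))) (trans (cong₂ _∸_ (ℕ.+-comm r (suc n)) (ℕ.+-comm r' (suc n))) (ℕ.[m+n]∸[m+o]≡n∸o (suc n) r r'))) ⟩
  0ℤ ⊕ ∑ (suc (r ∸ r')) (λ t → B (r' + suc n + t))
    ≡⟨ ℤ.+-identityˡ _ ⟩
  ∑ (suc (r ∸ r')) (λ t → B (r' + suc n + t))
    ≡⟨ ∑-ext (suc (r ∸ r')) (λ t → trans (cong B (rearrange t)) (box-strip (r' ∷ rs) d (proj₂ alt _))) ⟩
  ∑ (suc (r ∸ r')) (λ t → strip (r' ∷ rs) (λ μ → f (r' + t + suc n ∷ addδ μ))) ∎
  where
  B : ℕ → ℤ
  B y = box (addδ (r' ∷ rs)) λ η → f (y ∷ η)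
  low : ∑ (suc (r' + n)) B ≡ 0ℤ
  low = ∑-square-0 (suc (r' + n)) (λ y z →
    trans (ext (lin-box (addδ rs)) (λ η → proj₁ alt y z η)) (neg (lin-box (addδ rs)) _))
  rearrange : ∀ t → r' + suc n + t ≡ r' + t + suc n
  rearrange t = trans (ℕ.+-assoc r' (suc n) t)
    (trans (cong (r' +_) (ℕ.+-comm (suc n) t)) (sym (ℕ.+-assoc r' t (suc n))))

-- Sums over words and semistandard tableaux

guard-∧ : ∀ a b x → guard (a ∧ b) x ≡ guard a (guard b x)
guard-∧ true  b x = refl
guard-∧ false b x = refl

guard-comm : ∀ a b x → guard a (guard b x) ≡ guard b (guard a x)
guard-comm true  b     x = refl
guard-comm false true  x = refl
guard-comm false false x = refl

guard-cong : ∀ {a b x} → a ≡ b → guard a x ≡ guard b x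
guard-cong refl = refl

guard-0 : ∀ b {x} → x ≡ 0ℤ → guard b x ≡ 0ℤ
guard-0 true  p = p
guard-0 false p = refl

∑W : ℕ → ℕ → (List ℕ → ℤ) → ℤ
∑W n zero    F = F []
∑W n (suc r) F = ∑ n λ a → ∑W n r λ w → F (a ∷ w)

lin-∑W : ∀ n r → Lin (∑W n r)
lin-∑W n zero    = lin-eval []
lin-∑W n (suc r) = lin-∘ (lin-∑ n) (λ a → lin-pre (a ∷_) (lin-∑W n r))

∑W-ext : ∀ n r {f g} → (∀ w → length w ≡ r → All (_< n) w → f w ≡ g w) → ∑W n r f ≡ ∑W n r g
∑W-ext n zero    p = p [] refl []
∑W-ext n (suc r) p = ∑-ext< n λ a a<n → ∑W-ext n r λ w l al → p (a ∷ w) (cong suc l) (a<n ∷ al)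

∑W-swap : ∀ {A : Set} {S : (A → ℤ) → ℤ} → Lin S → ∀ n r (f : List ℕ → A → ℤ) →
  ∑W n r (λ w → S (f w)) ≡ S (λ x → ∑W n r (λ w → f w x))
∑W-swap s n zero    f = refl
∑W-swap s n (suc r) f = trans
  (∑-ext n (λ a → ∑W-swap s n r (λ w → f (a ∷ w))))
  (∑-swap s n (λ a x → ∑W n r (λ w → f (a ∷ w) x)))

headOK : ℕ → List ℕ → Bool
headOK a []      = true
headOK a (b ∷ _) = a ≤ᵇ b

weakInc-∷ : ∀ a w → weakInc (a ∷ w) ≡ headOK a w ∧ weakInc w
weakInc-∷ a []      = refl
weakInc-∷ a (b ∷ w) = refl

T⇒≡ : ∀ {b} → T b → b ≡ true
T⇒≡ {true} _ = refl

¬T⇒≡ : ∀ {b} → (T b → ⊥) → b ≡ false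
¬T⇒≡ {true}  n = ⊥-elim (n tt)
¬T⇒≡ {false} n = refl

≤⇒≤ᵇ≡ : ∀ {m n} → m ≤ n → (m ≤ᵇ n) ≡ true
≤⇒≤ᵇ≡ p = T⇒≡ (ℕ.≤⇒≤ᵇ p)

>⇒≤ᵇ≡ : ∀ {m n} → n < m → (m ≤ᵇ n) ≡ false
>⇒≤ᵇ≡ {m} {n} p = ¬T⇒≡ (λ t → ℕ.<⇒≱ p (ℕ.≤ᵇ⇒≤ m n t))

<⇒<ᵇ≡ : ∀ {m n} → m < n → (m <ᵇ n) ≡ true
<⇒<ᵇ≡ p = T⇒≡ (ℕ.<⇒<ᵇ p)

≥⇒<ᵇ≡ : ∀ {m n} → n ≤ m → (m <ᵇ n) ≡ false
≥⇒<ᵇ≡ {m} {n} p = ¬T⇒≡ (λ t → ℕ.<⇒≱ (ℕ.<ᵇ⇒< m n t) p)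

headOK-++ : ∀ {a n} → a ≤ n → ∀ w k → headOK a (w ++ L.replicate k n) ≡ headOK a w
headOK-++ p []      zero    = refl
headOK-++ p []      (suc k) = ≤⇒≤ᵇ≡ p
headOK-++ p (b ∷ w) k       = refl

-- A weakly increasing word over {0,…,n} is one over {0,…,n-1} followed by copies of n.
∑W-weakInc : ∀ n r (G : List ℕ → ℤ) → ∑W (suc n) r (λ w → guard (weakInc w) (G w)) ≡
  ∑ (suc r) λ q → ∑W n q λ w → guard (weakInc w) (G (w ++ L.replicate (r ∸ q) n))
∑W-weakInc n zero    G = sym (ℤ.+-identityˡ _)
∑W-weakInc n (suc r) G = begin
  ∑ n inner ⊕ inner n
    ≡⟨ cong₂ _⊕_ (trans (∑-ext< n small) (∑-swap (lin-∑ (suc r)) n _)) large ⟩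
  ∑ (suc r) (H ∘ suc) ⊕ H 0
    ≡⟨ ℤ.+-comm _ (H 0) ⟩
  H 0 ⊕ ∑ (suc r) (H ∘ suc)
    ≡⟨ sym (∑-suc (suc r) H) ⟩
  ∑ (suc (suc r)) H ∎
  where
  inner : ℕ → ℤ
  inner a = ∑W (suc n) r λ w → guard (weakInc (a ∷ w)) (G (a ∷ w))
  pad : ℕ → List ℕ → List ℕ
  pad q w = w ++ L.replicate (r ∸ q) n
  H : ℕ → ℤ
  H q = ∑W n q λ w → guard (weakInc w) (G (w ++ L.replicate (suc r ∸ q) n))
  inner≡ : ∀ a → inner a ≡ ∑ (suc r) λ q → ∑W n q λ w → guard (weakInc w) (guard (headOK a (pad q w)) (G (a ∷ pad q w)))
  inner≡ a = trans
    (ext (lin-∑W (suc n) r) (λ w → trans (guard-cong (weakInc-∷ a w))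
      (trans (guard-∧ (headOK a w) (weakInc w) _) (guard-comm (headOK a w) (weakInc w) _))))
    (∑W-weakInc n r (λ w → guard (headOK a w) (G (a ∷ w))))
  small : ∀ a → a < n → inner a ≡ ∑ (suc r) λ q → ∑W n q λ w → guard (weakInc (a ∷ w)) (G (a ∷ pad q w))
  small a a<n = trans (inner≡ a) (∑-ext (suc r) λ q → ext (lin-∑W n q) λ w →
    trans (cong (guard (weakInc w)) (guard-cong (headOK-++ (ℕ.<⇒≤ a<n) w (r ∸ q))))
    (trans (guard-comm (weakInc w) (headOK a w) _)
    (trans (sym (guard-∧ (headOK a w) (weakInc w) _)) (guard-cong (sym (weakInc-∷ a w))))))
  large : inner n ≡ H 0
  large = begin
    inner n
      ≡⟨ inner≡ n ⟩
    ∑ (suc r) K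
      ≡⟨ ∑-suc r K ⟩
    K 0 ⊕ ∑ r (K ∘ suc)
      -- After a first letter n no smaller letter may follow, so only the term in which the rest of
      -- the word is all n survives.
      ≡⟨ cong₂ _⊕_ (guard-cong (headOK-++ (ℕ.≤-refl {n}) [] r)) (null (lin-∑ r) λ q →
           ∑-null< n λ a a<n → null (lin-∑W n q) λ w → guard-0 (weakInc (a ∷ w))
             (guard-cong (>⇒≤ᵇ≡ a<n))) ⟩
    H 0 ⊕ 0ℤ
      ≡⟨ ℤ.+-identityʳ (H 0) ⟩
    H 0 ∎
    where
    K : ℕ → ℤ
    K q = ∑W n q λ w → guard (weakInc w) (guard (headOK n (pad q w)) (G (n ∷ pad q w)))

above : List ℕ → List ℕ → Bool
above _       []      = true
above []      (_ ∷ _) = true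
above (a ∷ w) (b ∷ u) = (a <ᵇ b) ∧ above w u

-- The letters n appended to the lower row still lie under original letters of w, all smaller than
-- n, and those appended to w have nothing below them.
above-pad : ∀ {n} w j u k → All (_< n) w → length u + k ≤ length w →
  above (w ++ L.replicate j n) (u ++ L.replicate k n) ≡ above w u
above-pad w       j []      zero    _         _       = refl
above-pad (a ∷ w) j []      (suc k) (p ∷ al)  (s≤s h) = cong₂ _∧_ (<⇒<ᵇ≡ p) (above-pad w j [] k al h)
above-pad (a ∷ w) j (b ∷ u) k       (_ ∷ al)  (s≤s h) = cong ((a <ᵇ b) ∧_) (above-pad w j u k al h)

∧-falseʳ : ∀ b → b ∧ false ≡ false
∧-falseʳ true  = refl
∧-falseʳ false = refl

-- The lower row reaches under the first appended n, and no letter exceeds n.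
above-short : ∀ {n} w j u → All (_< suc n) u → length w < length u → above (w ++ L.replicate (suc j) n) u ≡ false
above-short {n} [] j (b ∷ u) (s≤s p ∷ _)  _       = cong (_∧ above (L.replicate j n) u) (≥⇒<ᵇ≡ p)
above-short (a ∷ w) j (b ∷ u) (_ ∷ al)    (s≤s h) = trans (cong ((a <ᵇ b) ∧_) (above-short w j u al h)) (∧-falseʳ _)

-- c is the condition that the row above imposes on the first row.
∑SS : ∀ {m} → ℕ → (List ℕ → Bool) → Vec ℕ m → (List (List ℕ) → ℤ) → ℤ
∑SS n c []       F = F []
∑SS n c (r ∷ rs) F = ∑W n r λ w → guard (c w ∧ weakInc w) (∑SS n (above w) rs λ T → F (w ∷ T))

lin-∑SS : ∀ {m} n c (v : Vec ℕ m) → Lin (∑SS n c v)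
lin-∑SS n c []       = lin-eval []
lin-∑SS n c (r ∷ rs) = lin-∘ (lin-∑W n r) λ w →
  lin-guard (c w ∧ weakInc w) (lin-pre (w ∷_) (lin-∑SS n (above w) rs))

Filling : ∀ {m} → ℕ → Vec ℕ m → List (List ℕ) → Set
Filling n []      []      = ⊤
Filling n []      (_ ∷ _) = ⊥
Filling n (_ ∷ _) []      = ⊥
Filling n (r ∷ v) (w ∷ T) = length w ≡ r × All (_< n) w × Filling n v T

∑SS-ext : ∀ {m} n c (v : Vec ℕ m) {f g} → (∀ T → Filling n v T → f T ≡ g T) → ∑SS n c v f ≡ ∑SS n c v g
∑SS-ext n c []       p = p [] tt
∑SS-ext n c (r ∷ rs) p = ∑W-ext n r λ w l al → cong (guard (c w ∧ weakInc w))
  (∑SS-ext n (above w) rs λ T t → p (w ∷ T) (l , al , t))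

extend : ∀ {m} → ℕ → Vec ℕ m → List (List ℕ) → List (List ℕ)
extend n []       _       = []
extend n (_ ∷ _)  []      = []
extend n (r ∷ rs) (w ∷ T) = (w ++ L.replicate (r ∸ length w) n) ∷ extend n rs T

∑SS-short : ∀ {m} n w j (v : Vec ℕ m) {F} → length w < head0 v → ∑SS (suc n) (above (w ++ L.replicate (suc j) n)) v F ≡ 0ℤ
∑SS-short n w j (r ∷ rs) h = trans
  (∑W-ext (suc n) r λ u l al → guard-cong (cong (_∧ weakInc u)
    (above-short w j u al (subst (length w <_) (sym l) h))))
  (null (lin-∑W (suc n) r) λ _ → refl)

-- In a semistandard tableau the cells with the largest letter n form a horizontal strip. They end
-- each row by weak increase; a row cut below the length of the next one would have an n above a
-- letter, which `short` excludes. The hypothesis says that appending n does not change the verdict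
-- of the row above; for the lower rows it is supplied by `above-pad`, because the shortened row is
-- still at least as long as the next full one.
peel : ∀ {m} n c c' (v : Vec ℕ m) → Dec v → ∀ F →
  (∀ w k → length w + k ≡ head0 v → All (_< n) w → c (w ++ L.replicate k n) ≡ c' w) →
  ∑SS (suc n) c v F ≡ strip v λ μ → ∑SS n c' μ λ T → F (extend n v T)
peel n c c' []       _       F hyp = refl
peel n c c' (r ∷ rs) (h≤r , d) F hyp = begin
  ∑SS (suc n) c (r ∷ rs) F
    ≡⟨ ext (lin-∑W (suc n) r) (λ w → trans (guard-∧ (c w) (weakInc w) _) (guard-comm (c w) (weakInc w) _)) ⟩
  ∑W (suc n) r (λ w → guard (weakInc w) (G w))
    ≡⟨ ∑W-weakInc n r G ⟩
  ∑ (suc r) Q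
    ≡⟨ ∑-split h≤r Q ⟩
  ∑ h Q ⊕ ∑ (suc (r ∸ h)) (λ t → Q (h + t))
    ≡⟨ cong₂ _⊕_ (∑-null< h short) (∑-ext< (suc (r ∸ h)) λ t t≤ → long t (subst (h + t ≤_) (ℕ.m+[n∸m]≡n h≤r) (ℕ.+-monoʳ-≤ h (ℕ.≤-pred t≤)))) ⟩
  0ℤ ⊕ strip (r ∷ rs) (λ μ → ∑SS n c' μ (F ∘ extend n (r ∷ rs)))
    ≡⟨ ℤ.+-identityˡ _ ⟩
  strip (r ∷ rs) (λ μ → ∑SS n c' μ (F ∘ extend n (r ∷ rs))) ∎
  where
  h = head0 rs
  G : List ℕ → ℤ
  G w = guard (c w) (∑SS (suc n) (above w) rs λ T → F (w ∷ T))
  Q : ℕ → ℤ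
  Q q = ∑W n q λ w → guard (weakInc w) (G (w ++ L.replicate (r ∸ q) n))
  short : ∀ q → q < h → Q q ≡ 0ℤ
  short q q<h = trans
    (∑W-ext n q λ w l _ → guard-0 (weakInc w) (guard-0 (c (w ++ L.replicate (r ∸ q) n)) (vanish w l)))
    (null (lin-∑W n q) λ _ → refl)
    where
    vanish : ∀ w → length w ≡ q → ∑SS (suc n) (above (w ++ L.replicate (r ∸ q) n)) rs (λ T → F ((w ++ L.replicate (r ∸ q) n) ∷ T)) ≡ 0ℤ
    vanish w l with r ∸ q | ℕ.m<n⇒0<n∸m (ℕ.<-≤-trans q<h h≤r)
    ... | suc j | _ = ∑SS-short n w j rs (subst (_< h) (sym l) q<h)
  long : ∀ t → h + t ≤ r → Q (h + t) ≡ strip rs λ μ → ∑SS n c' (h + t ∷ μ) (F ∘ extend n (r ∷ rs))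
  long t q≤r = begin
    Q (h + t)
      ≡⟨ ∑W-ext n (h + t) row ⟩
    ∑W n (h + t) (λ w → strip rs (λ μ → guard (c' w ∧ weakInc w) (K w μ)))
      ≡⟨ ∑W-swap (lin-strip rs) n (h + t) _ ⟩
    strip rs (λ μ → ∑W n (h + t) (λ w → guard (c' w ∧ weakInc w) (K w μ))) ∎
    where
    K : List ℕ → Vec ℕ _ → ℤ
    K w μ = ∑SS n (above w) μ λ T → F (extend n (r ∷ rs) (w ∷ T))
    row : ∀ w → length w ≡ h + t → All (_< n) w →
      guard (weakInc w) (G (w ++ L.replicate (r ∸ (h + t)) n)) ≡ strip rs (λ μ → guard (c' w ∧ weakInc w) (K w μ))
    row w l al = begin
      guard (weakInc w) (G (w ++ L.replicate (r ∸ (h + t)) n))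
        ≡⟨ cong (λ q → guard (weakInc w) (G (w ++ L.replicate (r ∸ q) n))) (sym l) ⟩
      guard (weakInc w) (guard (c w⁺) (∑SS (suc n) (above w⁺) rs λ T → F (w⁺ ∷ T)))
        ≡⟨ cong₂ (λ b x → guard (weakInc w) (guard b x))
             (hyp w (r ∸ length w) (ℕ.m+[n∸m]≡n (subst (_≤ r) (sym l) q≤r)) al)
             (peel n (above w⁺) (above w) rs d _ λ u k e _ → above-pad w (r ∸ length w) u k al
               (subst (_≤ length w) (sym e) (subst (h ≤_) (sym l) (ℕ.m≤m+n h t)))) ⟩
      guard (weakInc w) (guard (c' w) (strip rs (K w)))
        ≡⟨ trans (guard-comm (weakInc w) (c' w) _) (sym (guard-∧ (c' w) (weakInc w) _)) ⟩
      guard (c' w ∧ weakInc w) (strip rs (K w))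
        ≡⟨ sym (pull-guard (lin-strip rs) (c' w ∧ weakInc w) (K w)) ⟩
      strip rs (λ μ → guard (c' w ∧ weakInc w) (K w μ)) ∎
      where
      w⁺ = w ++ L.replicate (r ∸ length w) n

-- Schur coefficients as sums

ind : Bool → ℤ
ind b = guard b 1ℤ

∑L : {A : Set} → List A → (A → ℤ) → ℤ
∑L xs f = sumℤ (L.map f xs)

∑L-ext : {A : Set} (xs : List A) {f g : A → ℤ} → (∀ x → f x ≡ g x) → ∑L xs f ≡ ∑L xs g
∑L-ext xs p = cong sumℤ (L.map-cong p xs)

∑L-map : {A B : Set} (h : A → B) (xs : List A) (f : B → ℤ) → ∑L (L.map h xs) f ≡ ∑L xs (f ∘ h)
∑L-map h xs f = cong sumℤ (sym (L.map-∘ xs))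

∑L-++ : {A : Set} (xs ys : List A) (f : A → ℤ) → ∑L (xs ++ ys) f ≡ ∑L xs f ⊕ ∑L ys f
∑L-++ []       ys f = sym (ℤ.+-identityˡ _)
∑L-++ (x ∷ xs) ys f = trans (cong (f x ⊕_) (∑L-++ xs ys f)) (sym (ℤ.+-assoc (f x) _ _))

∑L-concatMap : {A B : Set} (h : A → List B) (xs : List A) (f : B → ℤ) →
  ∑L (L.concatMap h xs) f ≡ ∑L xs (λ x → ∑L (h x) f)
∑L-concatMap h []       f = refl
∑L-concatMap h (x ∷ xs) f = trans (∑L-++ (h x) (L.concatMap h xs) f) (cong (∑L (h x) f ⊕_) (∑L-concatMap h xs f))

∑L-upTo : ∀ n f → ∑L (upTo n) f ≡ ∑ n f
∑L-upTo zero    f = refl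
∑L-upTo (suc n) f = begin
  ∑L (upTo (suc n)) f          ≡⟨ cong (λ xs → ∑L xs f) (sym (L.upTo-∷ʳ n)) ⟩
  ∑L (upTo n ++ n ∷ []) f      ≡⟨ ∑L-++ (upTo n) (n ∷ []) f ⟩
  ∑L (upTo n) f ⊕ (f n ⊕ 0ℤ)   ≡⟨ cong₂ _⊕_ (∑L-upTo n f) (ℤ.+-identityʳ (f n)) ⟩
  ∑ (suc n) f                  ∎

count-∷ : {A : Set} (p : A → Bool) (x : A) (xs : List A) → count p (x ∷ xs) ≡ (if p x then 1 else 0) + count p xs
count-∷ p x xs with p x
... | true  = refl
... | false = refl

count-∑L : {A : Set} (p : A → Bool) (xs : List A) → pos (count p xs) ≡ ∑L xs (ind ∘ p)
count-∑L p []       = refl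
count-∑L p (x ∷ xs) = trans (cong pos (count-∷ p x xs)) (trans (split (p x)) (cong (ind (p x) ⊕_) (count-∑L p xs)))
  where
  split : ∀ b → pos ((if b then 1 else 0) + count p xs) ≡ ind b ⊕ pos (count p xs)
  split true  = refl
  split false = refl

∑L-words : ∀ n r f → ∑L (words n r) f ≡ ∑W n r f
∑L-words n zero    f = ℤ.+-identityʳ (f [])
∑L-words n (suc r) f = begin
  ∑L (words n (suc r)) f
    ≡⟨ ∑L-concatMap (λ a → L.map (a ∷_) (words n r)) (upTo n) f ⟩
  ∑L (upTo n) (λ a → ∑L (L.map (a ∷_) (words n r)) f)
    ≡⟨ ∑L-upTo n _ ⟩
  ∑ n (λ a → ∑L (L.map (a ∷_) (words n r)) f)
    ≡⟨ ∑-ext n (λ a → trans (∑L-map (a ∷_) (words n r) f) (∑L-words n r _)) ⟩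
  ∑W n (suc r) f ∎

SSfrom : (List ℕ → Bool) → List (List ℕ) → Bool
SSfrom c []      = true
SSfrom c (w ∷ T) = (c w ∧ weakInc w) ∧ SSfrom (above w) T

above-and : ∀ u w → and (L.zipWith (λ below above → above <ᵇ below) u w) ≡ above w u
above-and []      w       = refl
above-and (b ∷ u) []      = refl
above-and (b ∷ u) (a ∷ w) = cong ((a <ᵇ b) ∧_) (above-and u w)

semistandard-from : ∀ T → semistandard T ≡ SSfrom (λ _ → true) T
semistandard-from []      = refl
semistandard-from (w ∷ T) = go w T
  where
  ∧-4 : ∀ x y a z → (x ∧ y) ∧ (a ∧ z) ≡ x ∧ (a ∧ (y ∧ z))
  ∧-4 true  true  a     z = refl
  ∧-4 true  false true  z = refl
  ∧-4 true  false false z = refl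
  ∧-4 false y     a     z = refl
  go : ∀ w T → semistandard (w ∷ T) ≡ weakInc w ∧ SSfrom (above w) T
  go w []       = trans (∧-identityʳ _) refl
  go w (w' ∷ T) = begin
    (weakInc w ∧ and (L.map weakInc (w' ∷ T))) ∧ (and (L.zipWith (λ below above → above <ᵇ below) w' w) ∧ colStrict (w' ∷ T))
      ≡⟨ cong (λ b → (weakInc w ∧ and (L.map weakInc (w' ∷ T))) ∧ (b ∧ colStrict (w' ∷ T))) (above-and w' w) ⟩
    (weakInc w ∧ and (L.map weakInc (w' ∷ T))) ∧ (above w w' ∧ colStrict (w' ∷ T))
      ≡⟨ ∧-4 (weakInc w) _ (above w w') _ ⟩
    weakInc w ∧ (above w w' ∧ semistandard (w' ∷ T))
      ≡⟨ cong (λ b → weakInc w ∧ (above w w' ∧ b)) (go w' T) ⟩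
    weakInc w ∧ (above w w' ∧ (weakInc w' ∧ SSfrom (above w') T))
      ≡⟨ cong (weakInc w ∧_) (sym (∧-assoc (above w w') (weakInc w') _)) ⟩
    weakInc w ∧ SSfrom (above w) (w' ∷ T) ∎

∑L-fillings : ∀ {m} n c (v : Vec ℕ m) F → ∑L (fillings n (toList v)) (λ T → guard (SSfrom c T) (F T)) ≡ ∑SS n c v F
∑L-fillings n c []       F = ℤ.+-identityʳ (F [])
∑L-fillings n c (r ∷ rs) F = begin
  ∑L (fillings n (r ∷ toList rs)) (λ T → guard (SSfrom c T) (F T))
    ≡⟨ ∑L-concatMap (λ w → L.map (w ∷_) (fillings n (toList rs))) (words n r) _ ⟩
  ∑L (words n r) (λ w → ∑L (L.map (w ∷_) (fillings n (toList rs))) (λ T → guard (SSfrom c T) (F T)))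
    ≡⟨ ∑L-words n r _ ⟩
  ∑W n r (λ w → ∑L (L.map (w ∷_) (fillings n (toList rs))) (λ T → guard (SSfrom c T) (F T)))
    ≡⟨ ext (lin-∑W n r) row ⟩
  ∑SS n c (r ∷ rs) F ∎
  where
  row : ∀ w → ∑L (L.map (w ∷_) (fillings n (toList rs))) (λ T → guard (SSfrom c T) (F T))
    ≡ guard (c w ∧ weakInc w) (∑SS n (above w) rs λ T → F (w ∷ T))
  row w = trans (∑L-map (w ∷_) (fillings n (toList rs)) _) (trans (factor (c w ∧ weakInc w))
    (cong (guard (c w ∧ weakInc w)) (∑L-fillings n (above w) rs (λ T → F (w ∷ T)))))
    where
    zeros : ∀ (Ts : List (List (List ℕ))) → ∑L Ts (λ _ → 0ℤ) ≡ 0ℤ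
    zeros []       = refl
    zeros (_ ∷ Ts) = trans (ℤ.+-identityˡ _) (zeros Ts)
    factor : ∀ b → ∑L (fillings n (toList rs)) (λ T → guard (b ∧ SSfrom (above w) T) (F (w ∷ T)))
      ≡ guard b (∑L (fillings n (toList rs)) (λ T → guard (SSfrom (above w) T) (F (w ∷ T))))
    factor true  = refl
    factor false = zeros (fillings n (toList rs))

schur : ∀ {m} → Vec ℕ m → List ℕ → ℤ
schur v α = ∑SS (length α) (λ _ → true) v λ T → ind (hasContent α T)

schurCoeff-schur : ∀ {m} (v : Vec ℕ m) α → pos (schurCoeff (toList v) α) ≡ schur v α
schurCoeff-schur v α = begin
  pos (schurCoeff (toList v) α)
    ≡⟨ count-∑L _ (fillings (length α) (toList v)) ⟩
  ∑L (fillings (length α) (toList v)) (λ T → ind (semistandard T ∧ hasContent α T))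
    ≡⟨ ∑L-ext (fillings (length α) (toList v)) (λ T → trans (guard-∧ (semistandard T) _ _)
         (guard-cong (semistandard-from T))) ⟩
  ∑L (fillings (length α) (toList v)) (λ T → guard (SSfrom (λ _ → true) T) (ind (hasContent α T)))
    ≡⟨ ∑L-fillings (length α) (λ _ → true) v _ ⟩
  schur v α ∎

-- Content of an extended filling

occ : ℕ → List ℕ → ℕ
occ i w = count (λ e → e ≡ᵇ i) w

occ-++ : ∀ i u w → occ i (u ++ w) ≡ occ i u + occ i w
occ-++ i []      w = refl
occ-++ i (x ∷ u) w = begin
  occ i (x ∷ u ++ w)                               ≡⟨ count-∷ _ x (u ++ w) ⟩
  (if x ≡ᵇ i then 1 else 0) + occ i (u ++ w)       ≡⟨ cong (_ +_) (occ-++ i u w) ⟩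
  (if x ≡ᵇ i then 1 else 0) + (occ i u + occ i w)  ≡⟨ sym (ℕ.+-assoc (if x ≡ᵇ i then 1 else 0) _ _) ⟩
  (if x ≡ᵇ i then 1 else 0) + occ i u + occ i w    ≡⟨ cong (_+ occ i w) (sym (count-∷ _ x u)) ⟩
  occ i (x ∷ u) + occ i w                          ∎

≢⇒≡ᵇ : ∀ {m n} → (m ≡ n → ⊥) → (m ≡ᵇ n) ≡ false
≢⇒≡ᵇ {m} {n} ne = ¬T⇒≡ (λ t → ne (ℕ.≡ᵇ⇒≡ m n t))

occ-replicate-≢ : ∀ {i n} → i < n → ∀ k → occ i (L.replicate k n) ≡ 0
occ-replicate-≢ p zero    = refl
occ-replicate-≢ {i} {n} p (suc k) = trans (count-∷ _ n (L.replicate k n))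
  (cong₂ (λ b x → (if b then 1 else 0) + x) (≢⇒≡ᵇ (λ e → ℕ.<⇒≢ p (sym e))) (occ-replicate-≢ p k))

occ-replicate-≡ : ∀ n k → occ n (L.replicate k n) ≡ k
occ-replicate-≡ n zero    = refl
occ-replicate-≡ n (suc k) = trans (count-∷ _ n (L.replicate k n))
  (cong₂ (λ b x → (if b then 1 else 0) + x) (T⇒≡ (ℕ.≡⇒≡ᵇ n n refl)) (occ-replicate-≡ n k))

occ-All< : ∀ {n} w → All (_< n) w → occ n w ≡ 0
occ-All< []      []       = refl
occ-All< (x ∷ w) (p ∷ al) = trans (count-∷ _ x w)
  (cong₂ (λ b y → (if b then 1 else 0) + y) (≢⇒≡ᵇ (ℕ.<⇒≢ p)) (occ-All< w al))

occ-extend-< : ∀ {m i n} → i < n → (μ v : Vec ℕ m) → ∀ T → Filling n μ T → occ i (concat (extend n v T)) ≡ occ i (concat T)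
occ-extend-< p []      []      []      _ = refl
occ-extend-< {i = i} {n} p (m ∷ μ) (r ∷ v) (w ∷ T) (l , al , t) = begin
  occ i ((w ++ pad) ++ concat (extend n v T))        ≡⟨ occ-++ i (w ++ pad) _ ⟩
  occ i (w ++ pad) + occ i (concat (extend n v T))   ≡⟨ cong₂ _+_ (occ-++ i w pad) (occ-extend-< p μ v T t) ⟩
  occ i w + occ i pad + occ i (concat T)             ≡⟨ cong (λ x → occ i w + x + occ i (concat T)) (occ-replicate-≢ p (r ∸ length w)) ⟩
  occ i w + 0 + occ i (concat T)                     ≡⟨ cong (_+ occ i (concat T)) (ℕ.+-identityʳ (occ i w)) ⟩
  occ i w + occ i (concat T)                         ≡⟨ sym (occ-++ i w (concat T)) ⟩
  occ i (w ++ concat T)                              ∎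
  where pad = L.replicate (r ∸ length w) n

+-swap : ∀ a b c d → (a + b) + (c + d) ≡ (a + c) + (b + d)
+-swap a b c d = trans (ℕ.+-assoc a b (c + d)) (trans (cong (a +_) (sum-swap b c d)) (sym (ℕ.+-assoc a c (b + d))))

occ-extend-≡ : ∀ {m n} (μ v : Vec ℕ m) → Interlace μ v → ∀ T → Filling n μ T → sum μ + occ n (concat (extend n v T)) ≡ sum v
occ-extend-≡ []      []      _           []      _ = refl
occ-extend-≡ {n = n} (m ∷ μ) (r ∷ v) (_ , m≤r , i) (w ∷ T) (l , al , t) = begin
  m + sum μ + occ n ((w ++ pad) ++ concat (extend n v T))
    ≡⟨ cong (m + sum μ +_) (trans (occ-++ n (w ++ pad) _) (cong (_+ occ n (concat (extend n v T))) (occ-++ n w pad))) ⟩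
  m + sum μ + (occ n w + occ n pad + occ n (concat (extend n v T)))
    ≡⟨ cong (λ x → m + sum μ + (x + occ n (concat (extend n v T))))
         (cong₂ _+_ (occ-All< w al) (trans (occ-replicate-≡ n (r ∸ length w)) (cong (r ∸_) l))) ⟩
  m + sum μ + (r ∸ m + occ n (concat (extend n v T)))
    ≡⟨ +-swap m (sum μ) (r ∸ m) _ ⟩
  m + (r ∸ m) + (sum μ + occ n (concat (extend n v T)))
    ≡⟨ cong₂ _+_ (ℕ.m+[n∸m]≡n m≤r) (occ-extend-≡ μ v i T t) ⟩
  r + sum v ∎
  where pad = L.replicate (r ∸ length w) n

all< : ℕ → (ℕ → Bool) → Bool
all< n p = and (L.map p (upTo n))

and-++ : ∀ xs ys → and (xs ++ ys) ≡ and xs ∧ and ys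
and-++ []       ys = refl
and-++ (x ∷ xs) ys = trans (cong (x ∧_) (and-++ xs ys)) (sym (∧-assoc x _ _))

all<-suc : ∀ n p → all< (suc n) p ≡ all< n p ∧ p n
all<-suc n p = begin
  and (L.map p (upTo (suc n)))           ≡⟨ cong (and ∘ L.map p) (sym (L.upTo-∷ʳ n)) ⟩
  and (L.map p (upTo n ++ n ∷ []))       ≡⟨ cong and (L.map-++ p (upTo n) (n ∷ [])) ⟩
  and (L.map p (upTo n) ++ p n ∷ [])     ≡⟨ and-++ (L.map p (upTo n)) (p n ∷ []) ⟩
  all< n p ∧ (p n ∧ true)                ≡⟨ cong (all< n p ∧_) (∧-identityʳ (p n)) ⟩
  all< n p ∧ p n                         ∎

all<-ext : ∀ n {p q} → (∀ i → i < n → p i ≡ q i) → all< n p ≡ all< n q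
all<-ext zero    e = refl
all<-ext (suc n) {p} {q} e = trans (all<-suc n p)
  (trans (cong₂ _∧_ (all<-ext n (λ i i<n → e i (ℕ.m<n⇒m<1+n i<n))) (e n ℕ.≤-refl)) (sym (all<-suc n q)))

nth-∷ʳ-< : ∀ α k i → i < length α → nth i (α ++ k ∷ []) ≡ nth i α
nth-∷ʳ-< (a ∷ α) k zero    _       = refl
nth-∷ʳ-< (a ∷ α) k (suc i) (s≤s p) = nth-∷ʳ-< α k i p

nth-∷ʳ-≡ : ∀ α k → nth (length α) (α ++ k ∷ []) ≡ k
nth-∷ʳ-≡ []      k = refl
nth-∷ʳ-≡ (a ∷ α) k = nth-∷ʳ-≡ α k

length-∷ʳ : ∀ (α : List ℕ) k → length (α ++ k ∷ []) ≡ suc (length α)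
length-∷ʳ []      k = refl
length-∷ʳ (a ∷ α) k = cong suc (length-∷ʳ α k)

+-≡ᵇ : ∀ s a b → (s + a ≡ᵇ s + b) ≡ (a ≡ᵇ b)
+-≡ᵇ zero    a b = refl
+-≡ᵇ (suc s) a b = +-≡ᵇ s a b

≡ᵇ-sym : ∀ a b → (a ≡ᵇ b) ≡ (b ≡ᵇ a)
≡ᵇ-sym zero    zero    = refl
≡ᵇ-sym zero    (suc b) = refl
≡ᵇ-sym (suc a) zero    = refl
≡ᵇ-sym (suc a) (suc b) = ≡ᵇ-sym a b

-- Padding affects only the letter `length α`, which then occurs once for each cell of the strip.
-- The size condition is stated without subtraction so that it matches the one in `step`.
hasContent-extend : ∀ {m} α k (μ v : Vec ℕ m) → Interlace μ v → ∀ T → Filling (length α) μ T →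
  hasContent (α ++ k ∷ []) (extend (length α) v T) ≡ (sum μ + k ≡ᵇ sum v) ∧ hasContent α T
hasContent-extend α k μ v i T t = begin
  all< (length (α ++ k ∷ [])) p
    ≡⟨ cong (λ l → all< l p) (length-∷ʳ α k) ⟩
  all< (suc n) p
    ≡⟨ all<-suc n p ⟩
  all< n p ∧ p n
    ≡⟨ cong₂ _∧_ (all<-ext n (λ j j<n → cong₂ _≡ᵇ_ (occ-extend-< j<n μ v T t) (nth-∷ʳ-< α k j j<n))) last ⟩
  hasContent α T ∧ (sum μ + k ≡ᵇ sum v)
    ≡⟨ ∧-comm (hasContent α T) _ ⟩
  (sum μ + k ≡ᵇ sum v) ∧ hasContent α T ∎
  where
  n = length α
  p : ℕ → Bool
  p j = occ j (concat (extend n v T)) ≡ᵇ nth j (α ++ k ∷ [])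
  last : p n ≡ (sum μ + k ≡ᵇ sum v)
  last = begin
    (occ n E ≡ᵇ nth n (α ++ k ∷ []))        ≡⟨ cong (occ n E ≡ᵇ_) (nth-∷ʳ-≡ α k) ⟩
    (occ n E ≡ᵇ k)                          ≡⟨ ≡ᵇ-sym (occ n E) k ⟩
    (k ≡ᵇ occ n E)                          ≡⟨ sym (+-≡ᵇ (sum μ) k (occ n E)) ⟩
    (sum μ + k ≡ᵇ sum μ + occ n E)          ≡⟨ cong (sum μ + k ≡ᵇ_) (occ-extend-≡ μ v i T t) ⟩
    (sum μ + k ≡ᵇ sum v)                    ∎
    where E = concat (extend n v T)

-- The branching rule. It strips the largest letter, hence the last exponent, which is why exponent
-- lists are reversed when they are passed to `D`.
schur-∷ʳ : ∀ {m} (v : Vec ℕ m) → Dec v → ∀ α k →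
  schur v (α ++ k ∷ []) ≡ strip v λ μ → guard (sum μ + k ≡ᵇ sum v) (schur μ α)
schur-∷ʳ v d α k = begin
  ∑SS (length (α ++ k ∷ [])) c v h
    ≡⟨ cong (λ l → ∑SS l c v h) (length-∷ʳ α k) ⟩
  ∑SS (suc n) c v h
    ≡⟨ peel n c c v d h (λ _ _ _ _ → refl) ⟩
  strip v (λ μ → ∑SS n c μ (h ∘ extend n v))
    ≡⟨ strip-ext v d (λ μ i → trans
         (∑SS-ext n c μ (λ T t → trans (guard-cong (hasContent-extend α k μ v i T t)) (guard-∧ (sum μ + k ≡ᵇ sum v) _ _)))
         (pull-guard (lin-∑SS n c μ) (sum μ + k ≡ᵇ sum v) _)) ⟩
  strip v (λ μ → guard (sum μ + k ≡ᵇ sum v) (schur μ α)) ∎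
  where
  n = length α
  c : List ℕ → Bool
  c _ = true
  h : List (List ℕ) → ℤ
  h T = ind (hasContent (α ++ k ∷ []) T)

-- Schur coefficients through alternating functions

-- Testing the first argument is enough for alternating functions: any other argument can be moved
-- to the front.
Supp : ∀ {n} → (Vec ℕ n → ℤ) → Set
Supp {zero}  f = ⊤
Supp {suc n} f = ∀ x q → suc n ≤ x → f (x ∷ q) ≡ 0ℤ

δ : ∀ n → Vec ℕ n
δ zero    = []
δ (suc n) = n ∷ δ n

addδ-0 : ∀ n → addδ (replicate n 0) ≡ δ n
addδ-0 zero    = refl
addδ-0 (suc n) = cong (n ∷_) (addδ-0 n)

dec-0 : ∀ {n} (v : Vec ℕ n) → Dec v → head0 v ≤ 0 → v ≡ replicate n 0
dec-0 []      _       _   = refl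
dec-0 (0 ∷ v) (p , d) z≤n = cong (0 ∷_) (dec-0 v d p)

sum-addδ : ∀ {n} (v : Vec ℕ n) → sum (addδ v) ≡ sum (δ n) + sum v
sum-addδ []                = refl
sum-addδ {suc n} (r ∷ rs) = trans (cong₂ _+_ (ℕ.+-comm r n) (sum-addδ rs)) (+-swap n r (sum (δ n)) (sum rs))

-- With no letters available only the empty shape has a tableau. Correspondingly, if the first part
-- is positive then the first bead is at least n and f vanishes; otherwise the beads are δ n.
schur-[] : ∀ {n} (v : Vec ℕ n) → Dec v → ∀ {f} → Supp f → f (addδ v) ≡ f (δ n) ⊗ schur v []
schur-[] [] _ _ = sym (ℤ.*-identityʳ _)
schur-[] {suc n} (suc r ∷ rs) _ {f} s = trans (s _ _ (s≤s (ℕ.m≤n+m n r))) (sym (ℤ.*-zeroʳ (f (δ (suc n)))))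
schur-[] {suc n} (zero ∷ rs) (p , d) {f} s rewrite dec-0 rs d p = begin
  f (n ∷ addδ (replicate n 0))                      ≡⟨ cong (λ q → f (n ∷ q)) (addδ-0 n) ⟩
  f (δ (suc n))                                     ≡⟨ sym (ℤ.*-identityʳ _) ⟩
  f (δ (suc n)) ⊗ 1ℤ                                ≡⟨ cong (f (δ (suc n)) ⊗_) (sym (empty n _ refl)) ⟩
  f (δ (suc n)) ⊗ schur (0 ∷ replicate n 0) []      ∎
  where
  empty : ∀ n c → c [] ≡ true → ∑SS 0 c (replicate n 0) (λ _ → 1ℤ) ≡ 1ℤ
  empty zero    c p = refl
  empty (suc n) c p = trans (guard-cong (cong (_∧ true) p)) (empty n (above []) refl)

-- Both sides obey the same recursion: `box-strip` reduces the box to a strip because `D f κ`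
-- alternates, and the strip is the branching rule. The staircase adds the same amount to both
-- weights and cancels. A general f is needed because later the function of the even beads takes the
-- value ±1 at δ n.
D-schur : ∀ {n} {f : Vec ℕ n → ℤ} → Alt n f → Supp f → ∀ κ (v : Vec ℕ n) → Dec v →
  D f κ (addδ v) ≡ f (δ n) ⊗ schur v (reverse κ)
D-schur alt s []      v d = schur-[] v d s
D-schur {n} {f} alt s (k ∷ κ) v d = begin
  box (addδ v) (g (sum (addδ v)))
    ≡⟨ box-strip v d (alt-sum {g = λ t η → guard (t + k ≡ᵇ sum (addδ v)) (D f κ η)} (λ t → alt-guard _ (alt-D κ alt))) ⟩
  strip v (λ μ → g (sum (addδ v)) (addδ μ))
    ≡⟨ strip-ext v d (λ μ i → trans (cong₂ guard (weights μ) (D-schur alt s κ μ (interlace-dec μ v i)))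
         (guard-⊗ (sum μ + k ≡ᵇ sum v) (f (δ n)) (schur μ (reverse κ)))) ⟩
  strip v (λ μ → f (δ n) ⊗ guard (sum μ + k ≡ᵇ sum v) (schur μ (reverse κ)))
    ≡⟨ scale (lin-strip v) (f (δ n)) _ ⟩
  f (δ n) ⊗ strip v (λ μ → guard (sum μ + k ≡ᵇ sum v) (schur μ (reverse κ)))
    ≡⟨ cong (f (δ n) ⊗_) (sym (schur-∷ʳ v d (reverse κ) k)) ⟩
  f (δ n) ⊗ schur v (reverse κ ++ k ∷ [])
    ≡⟨ cong (λ α → f (δ n) ⊗ schur v α) (sym (L.unfold-reverse k κ)) ⟩
  f (δ n) ⊗ schur v (reverse (k ∷ κ)) ∎
  where
  g : ℕ → Vec ℕ n → ℤ
  g t η = guard (sum η + k ≡ᵇ t) (D f κ η)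
  guard-⊗ : ∀ b x y → guard b (x ⊗ y) ≡ x ⊗ guard b y
  guard-⊗ true  x y = refl
  guard-⊗ false x y = sym (ℤ.*-zeroʳ x)
  weights : ∀ μ → (sum (addδ μ) + k ≡ᵇ sum (addδ v)) ≡ (sum μ + k ≡ᵇ sum v)
  weights μ = trans
    (cong₂ _≡ᵇ_ (trans (cong (_+ k) (sum-addδ μ)) (ℕ.+-assoc (sum (δ n)) (sum μ) k)) (sum-addδ v))
    (+-≡ᵇ (sum (δ n)) (sum μ + k) (sum v))

-- Convolution sums and the even-odd pairing

dbl : ℕ → ℕ
dbl zero    = zero
dbl (suc n) = suc (suc (dbl n))

conv : ℕ → (ℕ → ℕ → ℤ) → ℤ
conv zero    g = g 0 0
conv (suc L) g = g 0 (suc L) ⊕ conv L λ a b → g (suc a) b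

uncurry : (ℕ → ℕ → ℤ) → ℕ × ℕ → ℤ
uncurry g (a , b) = g a b

lin-conv : ∀ L → Lin {ℕ × ℕ} (λ f → conv L λ a b → f (a , b))
lin-conv zero    = lin-eval (0 , 0)
lin-conv (suc L) = lin-⊕ (lin-eval (0 , suc L)) (lin-pre (λ (a , b) → suc a , b) (lin-conv L))

conv-ext : ∀ L {g h} → (∀ a b → a + b ≡ L → g a b ≡ h a b) → conv L g ≡ conv L h
conv-ext zero    p = p 0 0 refl
conv-ext (suc L) p = cong₂ _⊕_ (p 0 (suc L) refl) (conv-ext L λ a b e → p (suc a) b (cong suc e))

conv-suc : ∀ L g → conv (suc L) g ≡ (conv L λ a b → g a (suc b)) ⊕ g (suc L) 0
conv-suc zero    g = refl
conv-suc (suc L) g = trans (cong (g 0 (suc (suc L)) ⊕_) (conv-suc L (λ a b → g (suc a) b)))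
  (sym (ℤ.+-assoc (g 0 (suc (suc L))) _ _))

conv-flip : ∀ L g → conv L g ≡ conv L λ a b → g b a
conv-flip zero    g = refl
conv-flip (suc L) g = begin
  g 0 (suc L) ⊕ conv L (λ a b → g (suc a) b)   ≡⟨ cong (g 0 (suc L) ⊕_) (conv-flip L _) ⟩
  g 0 (suc L) ⊕ conv L (λ a b → g (suc b) a)   ≡⟨ ℤ.+-comm (g 0 (suc L)) _ ⟩
  conv L (λ a b → g (suc b) a) ⊕ g 0 (suc L)   ≡⟨ sym (conv-suc L (λ a b → g b a)) ⟩
  conv (suc L) (λ a b → g b a)                 ∎

conv-neg : ∀ L g → conv L (λ a b → - g a b) ≡ - conv L g
conv-neg L g = neg (lin-conv L) (uncurry g)

conv-⊕ : ∀ L g h → conv L (λ a b → g a b ⊕ h a b) ≡ conv L g ⊕ conv L h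
conv-⊕ L g h = add (lin-conv L) (uncurry g) (uncurry h)

conv-antisym : ∀ L g → Antisym g → conv L g ≡ 0ℤ
conv-antisym L g anti = x≡-x⇒x≡0 _ (begin
  conv L g                     ≡⟨ conv-ext L (λ a b _ → anti a b) ⟩
  conv L (λ a b → - g b a)     ≡⟨ conv-neg L (λ a b → g b a) ⟩
  - conv L (λ a b → g b a)     ≡⟨ cong -_ (sym (conv-flip L g)) ⟩
  - conv L g                   ∎)

conv-∑ : ∀ L g → conv L g ≡ ∑ (suc L) λ b → g (L ∸ b) b
conv-∑ zero    g = sym (ℤ.+-identityˡ _)
conv-∑ (suc L) g = begin
  conv (suc L) g
    ≡⟨ conv-flip (suc L) g ⟩
  g (suc L) 0 ⊕ conv L (λ a b → g b (suc a))
    ≡⟨ cong (g (suc L) 0 ⊕_) (trans (conv-flip L _) (conv-∑ L _)) ⟩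
  g (suc L) 0 ⊕ ∑ (suc L) (λ b → g (L ∸ b) (suc b))
    ≡⟨ sym (∑-suc (suc L) (λ b → g (suc L ∸ b) b)) ⟩
  ∑ (suc (suc L)) (λ b → g (suc L ∸ b) b) ∎

-- For a fixed second index b, both sides let the first index run from 0 to L - b.
conv-triangle : ∀ L g → ∑ (suc L) (λ K → conv K g) ≡ conv L λ a b → ∑ (suc a) λ c → g c b
conv-triangle zero    g = refl
conv-triangle (suc L) g = begin
  ∑ (suc L) (λ K → conv K g) ⊕ conv (suc L) g
    ≡⟨ cong (_⊕ conv (suc L) g) (trans (conv-triangle L g) (sym (ℤ.+-identityˡ _))) ⟩
  conv (suc L) (λ a b → ∑ a λ c → g c b) ⊕ conv (suc L) g
    ≡⟨ sym (conv-⊕ (suc L) (λ a b → ∑ a λ c → g c b) g) ⟩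
  conv (suc L) (λ a b → ∑ (suc a) λ c → g c b) ∎

-- With R(Y,Z) the sum of φ over y < Y, z < Z, write φ as a second difference of R;
-- in the convolution two of the four terms are antisymmetric and vanish.
conv-pair : ∀ {φ} → Antisym φ → ∀ L →
  conv L (λ a b → ∑ (suc (dbl a)) λ y → ∑ (suc (suc (dbl b))) λ z → φ y z)
  ≡ ∑ (suc L) λ K → conv K λ a b → φ (dbl a) (suc (dbl b))
conv-pair {φ} anti zero = begin
  0ℤ ⊕ (0ℤ ⊕ φ 0 0 ⊕ φ 0 1)   ≡⟨ cong (λ x → 0ℤ ⊕ (0ℤ ⊕ x ⊕ φ 0 1)) (x≡-x⇒x≡0 _ (anti 0 0)) ⟩
  0ℤ ⊕ (0ℤ ⊕ 0ℤ ⊕ φ 0 1)      ≡⟨ cong (0ℤ ⊕_) (ℤ.+-identityˡ (φ 0 1)) ⟩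
  0ℤ ⊕ φ 0 1                  ∎
conv-pair {φ} anti (suc L) = begin
  C r₁₁
    ≡⟨ conv-ext (suc L) (λ a b _ → difference (dbl a) (suc (dbl b))) ⟩
  C (λ a b → (r₁₀ a b ⊕ r₀₁ a b) ⊕ (- r₀₀ a b ⊕ φ (dbl a) (suc (dbl b))))
    ≡⟨ trans (conv-⊕ (suc L) (λ a b → r₁₀ a b ⊕ r₀₁ a b) (λ a b → - r₀₀ a b ⊕ φ (dbl a) (suc (dbl b))))
         (cong₂ _⊕_ (conv-⊕ (suc L) r₁₀ r₀₁) (conv-⊕ (suc L) (λ a b → - r₀₀ a b) (λ a b → φ (dbl a) (suc (dbl b))))) ⟩
  (C r₁₀ ⊕ C r₀₁) ⊕ (C (λ a b → - r₀₀ a b) ⊕ C (λ a b → φ (dbl a) (suc (dbl b))))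
    ≡⟨ cong₂ (λ x y → x ⊕ (y ⊕ C (λ a b → φ (dbl a) (suc (dbl b)))))
         (cong₂ _⊕_ (conv-antisym (suc L) r₁₀ (λ a b → anti-R (suc (dbl a)) (suc (dbl b)))) C-r₀₁)
         (trans (conv-neg (suc L) r₀₀) C-r₀₀) ⟩
  (0ℤ ⊕ 0ℤ) ⊕ (conv L r₁₁ ⊕ C (λ a b → φ (dbl a) (suc (dbl b))))
    ≡⟨ ℤ.+-identityˡ _ ⟩
  conv L r₁₁ ⊕ C (λ a b → φ (dbl a) (suc (dbl b)))
    ≡⟨ cong (_⊕ C (λ a b → φ (dbl a) (suc (dbl b)))) (conv-pair anti L) ⟩
  ∑ (suc (suc L)) (λ K → conv K λ a b → φ (dbl a) (suc (dbl b))) ∎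
  where
  C = conv (suc L)
  R : ℕ → ℕ → ℤ
  R Y Z = ∑ Y λ y → ∑ Z λ z → φ y z
  r₁₁ r₁₀ r₀₁ r₀₀ : ℕ → ℕ → ℤ
  r₁₁ a b = R (suc (dbl a)) (suc (suc (dbl b)))
  r₁₀ a b = R (suc (dbl a)) (suc (dbl b))
  r₀₁ a b = R (dbl a) (suc (suc (dbl b)))
  r₀₀ a b = R (dbl a) (suc (dbl b))
  difference : ∀ Y Z → R (suc Y) (suc Z) ≡ (R (suc Y) Z ⊕ R Y (suc Z)) ⊕ (- R Y Z ⊕ φ Y Z)
  difference Y Z = ring (∑ Y λ y → ∑ (suc Z) λ z → φ y z) (∑ Z (φ Y)) (φ Y Z) (R Y Z)
    where
    ring : ∀ p q r s → p ⊕ (q ⊕ r) ≡ ((s ⊕ q) ⊕ p) ⊕ (- s ⊕ r)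
    ring = solve-∀
  anti-R : Antisym R
  anti-R Y Z = begin
    ∑ Y (λ y → ∑ Z (λ z → φ y z))      ≡⟨ ∑-swap (lin-∑ Z) Y φ ⟩
    ∑ Z (λ z → ∑ Y (λ y → φ y z))      ≡⟨ ∑-ext Z (λ z → trans (∑-ext Y (λ y → anti y z)) (neg (lin-∑ Y) (φ z))) ⟩
    ∑ Z (λ z → - ∑ Y (λ y → φ z y))    ≡⟨ neg (lin-∑ Z) _ ⟩
    - ∑ Z (λ z → ∑ Y (λ y → φ z y))    ∎
  C-r₀₁ : C r₀₁ ≡ 0ℤ
  C-r₀₁ = trans (ℤ.+-identityˡ _) (conv-antisym L (λ a b → r₀₁ (suc a) b) λ a b → anti-R (suc (suc (dbl a))) (suc (suc (dbl b))))
  -- The term with a = 0 is an empty sum. Shifting a by one makes the two bounds those of `r₁₁` in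
  -- exchanged roles, so this term reproduces the left-hand side for L and drives the induction.
  C-r₀₀ : - C r₀₀ ≡ conv L r₁₁
  C-r₀₀ = begin
    - (0ℤ ⊕ conv L (λ a b → R (suc (suc (dbl a))) (suc (dbl b))))
      ≡⟨ cong -_ (trans (ℤ.+-identityˡ _) (conv-ext L (λ a b _ → anti-R (suc (suc (dbl a))) (suc (dbl b))))) ⟩
    - conv L (λ a b → - r₁₁ b a)
      ≡⟨ cong -_ (conv-neg L _) ⟩
    - - conv L (λ a b → r₁₁ b a)
      ≡⟨ trans (ℤ.neg-involutive _) (sym (conv-flip L r₁₁)) ⟩
    conv L r₁₁ ∎

-- Tuples of even-odd pairs

-- Every pair carries its own total: all totals start out equal, but skewing lowers them
-- independently.
∑P : ∀ {n} → Vec ℕ n → (Vec ℕ n → Vec ℕ n → ℤ) → ℤ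
∑P []       h = h [] []
∑P (L ∷ Ls) h = conv L λ a b → ∑P Ls λ as bs → h (a ∷ as) (b ∷ bs)

lin-∑P : ∀ {n} (Ls : Vec ℕ n) → Lin {Vec ℕ n × Vec ℕ n} (λ f → ∑P Ls λ as bs → f (as , bs))
lin-∑P []       = lin-eval ([] , [])
lin-∑P (L ∷ Ls) = lin-∘ (lin-conv L) λ (a , b) → lin-pre (λ (as , bs) → a ∷ as , b ∷ bs) (lin-∑P Ls)

∑P-ext : ∀ {n} (Ls : Vec ℕ n) {g h} → (∀ as bs → sum as + sum bs ≡ sum Ls → g as bs ≡ h as bs) → ∑P Ls g ≡ ∑P Ls h
∑P-ext []       p = p [] [] refl
∑P-ext (L ∷ Ls) p = conv-ext L λ a b e → ∑P-ext Ls λ as bs es →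
  p (a ∷ as) (b ∷ bs) (trans (+-swap a (sum as) b (sum bs)) (cong₂ _+_ e es))

il : ∀ {n} → Vec ℕ n → Vec ℕ n → Vec ℕ (dbl n)
il []       []       = []
il (a ∷ as) (b ∷ bs) = a ∷ b ∷ il as bs

eo : ∀ {n} → Vec ℕ n → Vec ℕ n → Vec ℕ (dbl n)
eo as bs = il (vmap dbl as) (vmap (suc ∘ dbl) bs)

-- `conv-pair` is applied to one pair at a time. With the other pairs already treated and summed
-- over, what is left is an antisymmetric function φ of the two beads of the first pair, since they
-- occupy neighbouring arguments of F.
∑P-box : ∀ {n} (Ls : Vec ℕ n) {F} → Alt (dbl n) F →
  ∑P Ls (λ as bs → box (eo as bs) F) ≡ box Ls λ Ks → ∑P Ks λ as bs → F (eo as bs)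
∑P-box []       alt = refl
∑P-box {suc n} (L ∷ Ls) {F} alt = begin
  conv L (λ a b → ∑P Ls λ as bs → ∑ (suc (dbl a)) λ y → ∑ (suc (suc (dbl b))) λ z → box (eo as bs) (F₂ y z))
    ≡⟨ conv-ext L (λ a b _ → sym (trans
         (∑-ext (suc (dbl a)) (λ y → ∑-swap (lin-∑P Ls) (suc (suc (dbl b))) (λ z (as , bs) → box (eo as bs) (F₂ y z))))
         (∑-swap (lin-∑P Ls) (suc (dbl a)) (λ y (as , bs) → ∑ (suc (suc (dbl b))) λ z → box (eo as bs) (F₂ y z))))) ⟩
  conv L (λ a b → ∑ (suc (dbl a)) λ y → ∑ (suc (suc (dbl b))) λ z → ∑P Ls λ as bs → box (eo as bs) (F₂ y z))
    ≡⟨ conv-ext L (λ a b _ → ∑-ext (suc (dbl a)) λ y → ∑-ext (suc (suc (dbl b))) λ z →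
         ∑P-box Ls (alt-tail {f = λ q → F (y ∷ q)} (alt-tail {f = F} alt y) z)) ⟩
  conv L (λ a b → ∑ (suc (dbl a)) λ y → ∑ (suc (suc (dbl b))) λ z → φ y z)
    ≡⟨ conv-pair anti L ⟩
  ∑ (suc L) (λ K → conv K λ a b → φ (dbl a) (suc (dbl b)))
    ≡⟨ ∑-ext (suc L) (λ K → conv-swap K) ⟩
  ∑ (suc L) (λ K → box Ls λ Ks → ∑P (K ∷ Ks) λ as bs → F (eo as bs)) ∎
  where
  F₂ : ℕ → ℕ → Vec ℕ (dbl n) → ℤ
  F₂ y z η = F (y ∷ z ∷ η)
  φ : ℕ → ℕ → ℤ
  φ y z = box Ls λ Ks → ∑P Ks λ as bs → F₂ y z (eo as bs)
  anti : Antisym φ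
  anti y z = trans
    (ext (lin-box Ls) (λ Ks → trans (∑P-ext Ks (λ as bs _ → proj₁ alt y z (eo as bs))) (neg (lin-∑P Ks) _)))
    (neg (lin-box Ls) _)
  conv-swap : ∀ K → conv K (λ a b → φ (dbl a) (suc (dbl b))) ≡ box Ls λ Ks → conv K λ a b → ∑P Ks λ as bs → F (eo (a ∷ as) (b ∷ bs))
  conv-swap K = begin
    conv K (λ a b → φ (dbl a) (suc (dbl b)))
      ≡⟨ conv-∑ K _ ⟩
    ∑ (suc K) (λ b → φ (dbl (K ∸ b)) (suc (dbl b)))
      ≡⟨ ∑-swap (lin-box Ls) (suc K) _ ⟩
    box Ls (λ Ks → ∑ (suc K) λ b → ∑P Ks λ as bs → F (eo (K ∸ b ∷ as) (b ∷ bs)))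
      ≡⟨ ext (lin-box Ls) (λ Ks → sym (conv-∑ K _)) ⟩
    box Ls (λ Ks → conv K λ a b → ∑P Ks λ as bs → F (eo (a ∷ as) (b ∷ bs))) ∎

-- `conv-triangle` in each coordinate: lowering the total of a pair in all ways is the same as
-- lowering its first half in all ways and keeping the second.
∑P-triangle : ∀ {n} (Ls : Vec ℕ n) h → box Ls (λ Ks → ∑P Ks h) ≡ ∑P Ls λ as bs → box as λ cs → h cs bs
∑P-triangle []       h = refl
∑P-triangle (L ∷ Ls) h = begin
  ∑ (suc L) (λ K → box Ls λ Ks → conv K λ a b → ∑P Ks λ as bs → h (a ∷ as) (b ∷ bs))
    ≡⟨ ∑-ext (suc L) (λ K → trans (ext (lin-box Ls) (λ Ks → conv-∑ K _))
         (trans (sym (∑-swap (lin-box Ls) (suc K) _)) (sym (conv-∑ K G)))) ⟩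
  ∑ (suc L) (λ K → conv K G)
    ≡⟨ conv-triangle L G ⟩
  conv L (λ a b → ∑ (suc a) λ c → G c b)
    ≡⟨ conv-ext L (λ a b _ → trans (∑-ext (suc a) (λ c → ∑P-triangle Ls _))
         (∑-swap (lin-∑P Ls) (suc a) (λ c (as , bs) → box as λ cs → h (c ∷ cs) (b ∷ bs)))) ⟩
  conv L (λ a b → ∑P Ls λ as bs → ∑ (suc a) λ c → box as λ cs → h (c ∷ cs) (b ∷ bs)) ∎
  where
  G : ℕ → ℕ → ℤ
  G a b = box Ls λ Ks → ∑P Ks λ as bs → h (a ∷ as) (b ∷ bs)

-- Parity of the skewing degree

data Parity : ℕ → Set where
  isEven : ∀ k → Parity (dbl k)
  isOdd  : ∀ k → Parity (suc (dbl k))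

parity : ∀ k → Parity k
parity zero = isEven 0
parity (suc k) with parity k
... | isEven j = isOdd j
... | isOdd j  = isEven (suc j)

even-dbl : ∀ k → even (dbl k) ≡ true
even-dbl zero    = refl
even-dbl (suc k) = even-dbl k

even-suc-dbl : ∀ k → even (suc (dbl k)) ≡ false
even-suc-dbl zero    = refl
even-suc-dbl (suc k) = even-suc-dbl k

dbl≡*2 : ∀ k → dbl k ≡ k * 2
dbl≡*2 zero    = refl
dbl≡*2 (suc k) = cong (suc ∘ suc) (dbl≡*2 k)

dbl-/2 : ∀ k → dbl k / 2 ≡ k
dbl-/2 k = trans (cong (_/ 2) (dbl≡*2 k)) (m*n/n≡m k 2)

dbl-+ : ∀ m n → dbl (m + n) ≡ dbl m + dbl n
dbl-+ zero    n = refl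
dbl-+ (suc m) n = cong (suc ∘ suc) (dbl-+ m n)

dbl-≡ᵇ : ∀ m n → (dbl m ≡ᵇ dbl n) ≡ (m ≡ᵇ n)
dbl-≡ᵇ zero    zero    = refl
dbl-≡ᵇ zero    (suc n) = refl
dbl-≡ᵇ (suc m) zero    = refl
dbl-≡ᵇ (suc m) (suc n) = dbl-≡ᵇ m n

suc-dbl-≡ᵇ : ∀ m n → (suc (dbl m) ≡ᵇ dbl n) ≡ false
suc-dbl-≡ᵇ m       zero    = refl
suc-dbl-≡ᵇ zero    (suc n) = ≢⇒≡ᵇ (dbl-pos n)
  where
  dbl-pos : ∀ n → 1 ≡ suc (suc (dbl n)) → ⊥
  dbl-pos n ()
suc-dbl-≡ᵇ (suc m) (suc n) = suc-dbl-≡ᵇ m n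

sum-eo : ∀ {n} (as bs : Vec ℕ n) → sum (eo as bs) ≡ n + dbl (sum as + sum bs)
sum-eo []       []       = refl
sum-eo {suc n} (a ∷ as) (b ∷ bs) = begin
  dbl a + (suc (dbl b) + sum (eo as bs))               ≡⟨ ℕ.+-suc (dbl a) _ ⟩
  suc (dbl a + (dbl b + sum (eo as bs)))               ≡⟨ cong suc (sym (ℕ.+-assoc (dbl a) (dbl b) _)) ⟩
  suc (dbl a + dbl b + sum (eo as bs))                 ≡⟨ cong suc (cong₂ _+_ (sym (dbl-+ a b)) (sum-eo as bs)) ⟩
  suc (dbl (a + b) + (n + dbl (sum as + sum bs)))      ≡⟨ cong suc (sum-swap (dbl (a + b)) n _) ⟩
  suc (n + (dbl (a + b) + dbl (sum as + sum bs)))      ≡⟨ cong (λ x → suc (n + x)) (sym (dbl-+ (a + b) _)) ⟩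
  suc (n + dbl ((a + b) + (sum as + sum bs)))          ≡⟨ cong (λ x → suc (n + dbl x)) (+-swap a b (sum as) (sum bs)) ⟩
  suc (n + dbl (a + sum as + (b + sum bs)))            ∎

weight-eo : ∀ n s k t → (n + dbl s + k ≡ᵇ n + dbl t) ≡ even k ∧ (s + k / 2 ≡ᵇ t)
weight-eo n s k t = trans (cong (_≡ᵇ n + dbl t) (ℕ.+-assoc n (dbl s) k))
  (trans (+-≡ᵇ n (dbl s + k) (dbl t)) (go k (parity k)))
  where
  go : ∀ k → Parity k → (dbl s + k ≡ᵇ dbl t) ≡ even k ∧ (s + k / 2 ≡ᵇ t)
  go _ (isEven j) = begin
    (dbl s + dbl j ≡ᵇ dbl t)                     ≡⟨ cong (_≡ᵇ dbl t) (sym (dbl-+ s j)) ⟩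
    (dbl (s + j) ≡ᵇ dbl t)                       ≡⟨ dbl-≡ᵇ (s + j) t ⟩
    (s + j ≡ᵇ t)                                 ≡⟨ cong₂ (λ b i → b ∧ (s + i ≡ᵇ t)) (sym (even-dbl j)) (sym (dbl-/2 j)) ⟩
    even (dbl j) ∧ (s + dbl j / 2 ≡ᵇ t)          ∎
  go _ (isOdd j) = begin
    (dbl s + suc (dbl j) ≡ᵇ dbl t)               ≡⟨ cong (_≡ᵇ dbl t) (trans (ℕ.+-suc (dbl s) (dbl j)) (cong suc (sym (dbl-+ s j)))) ⟩
    (suc (dbl (s + j)) ≡ᵇ dbl t)                 ≡⟨ suc-dbl-≡ᵇ (s + j) t ⟩
    false                                        ≡⟨ cong (_∧ (s + suc (dbl j) / 2 ≡ᵇ t)) (sym (even-suc-dbl j)) ⟩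
    even (suc (dbl j)) ∧ (s + suc (dbl j) / 2 ≡ᵇ t) ∎

-- Skewing the even-odd pairing by h_k is skewing its even half by h_{k/2}.
∑P-D : ∀ {n} {F : Vec ℕ (dbl n) → ℤ} → Alt (dbl n) F → ∀ κ (Ls : Vec ℕ n) →
  ∑P Ls (λ as bs → D F κ (eo as bs))
  ≡ guard (and (L.map even κ)) (∑P Ls λ as bs → D (λ cs → F (eo cs bs)) (L.map (_/ 2) κ) as)
∑P-D alt []      Ls = refl
∑P-D {n} {F} alt (k ∷ κ) Ls = begin
  ∑P Ls (λ as bs → box (eo as bs) (G (sum (eo as bs))))
    -- The weight of all beads is the constant S on this range. Freezing it makes the summand one
    -- fixed alternating function, as `∑P-box` requires.
    ≡⟨ ∑P-ext Ls (λ as bs e → cong (λ t → box (eo as bs) (G t)) (trans (sum-eo as bs) (cong (λ s → n + dbl s) e))) ⟩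
  ∑P Ls (λ as bs → box (eo as bs) (G S))
    ≡⟨ ∑P-box Ls (alt-sum {g = λ s η → guard (s + k ≡ᵇ S) (D F κ η)} (λ s → alt-guard _ (alt-D κ alt))) ⟩
  box Ls (λ Ks → ∑P Ks λ as bs → G S (eo as bs))
    -- Before and after lowering, the weights are n plus an even number, so an odd k contributes
    -- nothing and an even k lowers the totals by k / 2.
    ≡⟨ ext (lin-box Ls) weigh ⟩
  box Ls (λ Ks → guard (even k) (guard (and (L.map even κ)) (∑P Ks λ as bs → H as bs)))
    ≡⟨ trans (pull-guard (lin-box Ls) (even k) _) (cong (guard (even k)) (pull-guard (lin-box Ls) (and (L.map even κ)) _)) ⟩
  guard (even k) (guard (and (L.map even κ)) (box Ls λ Ks → ∑P Ks λ as bs → H as bs))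
    ≡⟨ sym (guard-∧ (even k) _ _) ⟩
  guard (even k ∧ and (L.map even κ)) (box Ls λ Ks → ∑P Ks λ as bs → H as bs)
    -- The lowered totals are now charged to the even halves alone; the sum of the odd halves
    -- cancels from the weight condition, leaving precisely `step (k / 2)` on the even halves.
    ≡⟨ cong (guard (even k ∧ and (L.map even κ))) (trans (∑P-triangle Ls H)
         (∑P-ext Ls λ as bs e → ext (lin-box as) λ cs → guard-cong (unweigh as bs cs e))) ⟩
  guard (even k ∧ and (L.map even κ)) (∑P Ls λ as bs → D (λ cs → F (eo cs bs)) (L.map (_/ 2) (k ∷ κ)) as) ∎
  where
  S = n + dbl (sum Ls)
  G : ℕ → Vec ℕ (dbl n) → ℤ
  G t η = guard (sum η + k ≡ᵇ t) (D F κ η)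
  H : Vec ℕ n → Vec ℕ n → ℤ
  H as bs = guard (sum as + sum bs + k / 2 ≡ᵇ sum Ls) (D (λ cs → F (eo cs bs)) (L.map (_/ 2) κ) as)
  weigh : ∀ Ks → ∑P Ks (λ as bs → G S (eo as bs)) ≡ guard (even k) (guard (and (L.map even κ)) (∑P Ks λ as bs → H as bs))
  weigh Ks = begin
    ∑P Ks (λ as bs → G S (eo as bs))
      ≡⟨ ∑P-ext Ks (λ as bs e → guard-cong (trans (cong (λ s → s + k ≡ᵇ S) (trans (sum-eo as bs) (cong (λ s → n + dbl s) e)))
           (weight-eo n (sum Ks) k (sum Ls)))) ⟩
    ∑P Ks (λ as bs → guard (even k ∧ w) (D F κ (eo as bs)))
      ≡⟨ trans (pull-guard (lin-∑P Ks) (even k ∧ w) _) (guard-∧ (even k) w _) ⟩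
    guard (even k) (guard w (∑P Ks λ as bs → D F κ (eo as bs)))
      ≡⟨ cong (λ x → guard (even k) (guard w x)) (∑P-D alt κ Ks) ⟩
    guard (even k) (guard w (guard (and (L.map even κ)) (∑P Ks λ as bs → D (λ cs → F (eo cs bs)) (L.map (_/ 2) κ) as)))
      ≡⟨ cong (guard (even k)) (trans (guard-comm w (and (L.map even κ)) _)
           (cong (guard (and (L.map even κ))) (sym (pull-guard (lin-∑P Ks) w _)))) ⟩
    guard (even k) (guard (and (L.map even κ)) (∑P Ks λ as bs → guard w (D (λ cs → F (eo cs bs)) (L.map (_/ 2) κ) as)))
      ≡⟨ cong (λ x → guard (even k) (guard (and (L.map even κ)) x))
           (∑P-ext Ks λ as bs e → guard-cong (cong (λ s → s + k / 2 ≡ᵇ sum Ls) (sym e))) ⟩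
    guard (even k) (guard (and (L.map even κ)) (∑P Ks λ as bs → H as bs)) ∎
    where w = sum Ks + k / 2 ≡ᵇ sum Ls
  unweigh : ∀ as bs cs → sum as + sum bs ≡ sum Ls → (sum cs + sum bs + k / 2 ≡ᵇ sum Ls) ≡ (sum cs + k / 2 ≡ᵇ sum as)
  unweigh as bs cs e = begin
    (sum cs + sum bs + k / 2 ≡ᵇ sum Ls)
      ≡⟨ cong₂ _≡ᵇ_ (trans (cong (_+ k / 2) (ℕ.+-comm (sum cs) (sum bs))) (ℕ.+-assoc (sum bs) (sum cs) (k / 2)))
           (trans (sym e) (ℕ.+-comm (sum as) (sum bs))) ⟩
    (sum bs + (sum cs + k / 2) ≡ᵇ sum bs + sum as)
      ≡⟨ +-≡ᵇ (sum bs) _ _ ⟩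
    (sum cs + k / 2 ≡ᵇ sum as) ∎

-- Signs

σ : ℕ → ℤ
σ zero    = 1ℤ
σ (suc n) = - σ n

σ-+ : ∀ m n → σ (m + n) ≡ σ m ⊗ σ n
σ-+ zero    n = sym (ℤ.*-identityˡ (σ n))
σ-+ (suc m) n = trans (cong -_ (σ-+ m n)) (ℤ.neg-distribˡ-* (σ m) (σ n))

σ-square : ∀ n → σ n ⊗ σ n ≡ 1ℤ
σ-square zero    = refl
σ-square (suc n) = trans (ring (σ n)) (σ-square n)
  where
  ring : ∀ x → - x ⊗ - x ≡ x ⊗ x
  ring = solve-∀

σ-dbl : ∀ n → σ (dbl n) ≡ 1ℤ
σ-dbl zero    = refl
σ-dbl (suc n) = trans (ℤ.neg-involutive _) (σ-dbl n)

-- Alternating functions: moving, reversing and interleaving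

alt-∷ʳ : ∀ {n f} → Alt (suc n) f → ∀ (q : Vec ℕ n) b → f (q ∷ʳ b) ≡ σ n ⊗ f (b ∷ q)
alt-∷ʳ alt [] b = sym (ℤ.*-identityˡ _)
alt-∷ʳ {suc n} {f} alt (x ∷ q) b = begin
  f (x ∷ (q ∷ʳ b))           ≡⟨ alt-∷ʳ (proj₂ alt x) q b ⟩
  σ n ⊗ f (x ∷ b ∷ q)        ≡⟨ cong (σ n ⊗_) (proj₁ alt x b q) ⟩
  σ n ⊗ - f (b ∷ x ∷ q)      ≡⟨ ring (σ n) (f (b ∷ x ∷ q)) ⟩
  - σ n ⊗ f (b ∷ x ∷ q)      ∎
  where
  ring : ∀ a b → a ⊗ - b ≡ - a ⊗ b
  ring = solve-∀

asc desc : ℕ → ∀ n → Vec ℕ n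
asc  m zero    = []
asc  m (suc n) = m ∷ asc (suc m) n
desc m zero    = []
desc m (suc n) = m + n ∷ desc m n

desc-∷ʳ : ∀ m n → desc m (suc n) ≡ desc (suc m) n ∷ʳ m
desc-∷ʳ m zero    = cong (_∷ []) (ℕ.+-identityʳ m)
desc-∷ʳ m (suc n) = cong₂ _∷_ (ℕ.+-suc m n) (desc-∷ʳ m n)

-- The binomial coefficient C(n,2), in the recursive form in which the signs accumulate.
tri : ℕ → ℕ
tri zero    = 0
tri (suc n) = n + tri n

alt-asc : ∀ {n f} → Alt n f → ∀ m → f (asc m n) ≡ σ (tri n) ⊗ f (desc m n)
alt-asc {zero}      alt m = sym (ℤ.*-identityˡ _)
alt-asc {suc n} {f} alt m = begin
  f (m ∷ asc (suc m) n)
    ≡⟨ alt-asc (alt-tail {f = f} alt m) (suc m) ⟩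
  σ (tri n) ⊗ f (m ∷ desc (suc m) n)
    ≡⟨ cong (σ (tri n) ⊗_) (trans (sym (ℤ.*-identityˡ _)) (cong (_⊗ f (m ∷ desc (suc m) n)) (sym (σ-square n)))) ⟩
  σ (tri n) ⊗ ((σ n ⊗ σ n) ⊗ f (m ∷ desc (suc m) n))
    ≡⟨ ring (σ (tri n)) (σ n) (f (m ∷ desc (suc m) n)) ⟩
  (σ n ⊗ σ (tri n)) ⊗ (σ n ⊗ f (m ∷ desc (suc m) n))
    ≡⟨ cong₂ _⊗_ (sym (σ-+ n (tri n))) (sym (alt-∷ʳ {f = f} alt (desc (suc m) n) m)) ⟩
  σ (n + tri n) ⊗ f (desc (suc m) n ∷ʳ m)
    ≡⟨ cong (λ v → σ (n + tri n) ⊗ f v) (sym (desc-∷ʳ m n)) ⟩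
  σ (n + tri n) ⊗ f (desc m (suc n)) ∎
  where
  ring : ∀ t s x → t ⊗ ((s ⊗ s) ⊗ x) ≡ (s ⊗ t) ⊗ (s ⊗ x)
  ring = solve-∀

neg-3 : ∀ {w x y z : ℤ} → w ≡ - x → x ≡ - y → y ≡ - z → w ≡ - z
neg-3 refl refl refl = ℤ.neg-involutive _

-- Exchanging two entries with one entry between them takes three adjacent swaps, an odd number.
alt-ilˡ : ∀ {n F} → Alt (dbl n) F → ∀ bs → Alt n (λ as → F (il as bs))
alt-ilˡ {zero}        alt bs = tt
alt-ilˡ {suc zero}    alt bs = tt
alt-ilˡ {suc (suc n)} {F} alt (b ∷ b' ∷ bs) =
  (λ a a' q → neg-3 (proj₁ (proj₂ alt a) b a' (b' ∷ il q bs))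
                    (proj₁ alt a a' (b ∷ b' ∷ il q bs))
                    (proj₁ (proj₂ alt a') a b (b' ∷ il q bs))) ,
  (λ a → alt-ilˡ {suc n} {λ q → F (a ∷ b ∷ q)} (proj₂ (proj₂ alt a) b) (b' ∷ bs))

alt-ilʳ : ∀ {n F} → Alt (dbl n) F → ∀ as → Alt n (λ bs → F (il as bs))
alt-ilʳ {zero}        alt as = tt
alt-ilʳ {suc zero}    alt as = tt
alt-ilʳ {suc (suc n)} {F} alt (a ∷ a' ∷ as) =
  (λ b b' q → neg-3 (proj₁ (proj₂ alt a) b a' (b' ∷ il as q))
                    (proj₁ (proj₂ (proj₂ alt a) a') b b' (il as q))
                    (proj₁ (proj₂ alt a) a' b' (b ∷ il as q))) ,
  (λ b → alt-ilʳ {suc n} {λ q → F (a ∷ b ∷ q)} (proj₂ (proj₂ alt a) b) (a' ∷ as))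

-- Symmetric functions of a vector vanishing on repetitions

Sym : ∀ n → (Vec ℕ n → ℤ) → Set
Sym zero          g = ⊤
Sym (suc zero)    g = ⊤
Sym (suc (suc n)) g =
  (∀ a b q → g (a ∷ b ∷ q) ≡ g (b ∷ a ∷ q)) × (∀ a q → g (a ∷ a ∷ q) ≡ 0ℤ) × (∀ a → Sym (suc n) (λ q → g (a ∷ q)))

sym-tail : ∀ {n g} → Sym (suc n) g → ∀ a → Sym n (λ q → g (a ∷ q))
sym-tail {zero}  _ _ = tt
sym-tail {suc n} h a = proj₂ (proj₂ h) a

sym-scale : ∀ {n} (c : ℤ) {g} → Sym n g → Sym n (λ v → c ⊗ g v)
sym-scale {zero}        c h = tt
sym-scale {suc zero}    c h = tt
sym-scale {suc (suc n)} c (s , z , t) =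
  (λ a b q → cong (c ⊗_) (s a b q)) ,
  (λ a q → trans (cong (c ⊗_) (z a q)) (ℤ.*-zeroʳ c)) , (λ a → sym-scale c (t a))

sym-sum : ∀ {n} {g : ℕ → Vec ℕ n → ℤ} → (∀ t → Sym n (g t)) → Sym n (λ v → g (sum v) v)
sym-sum {zero}        h = tt
sym-sum {suc zero}    h = tt
sym-sum {suc (suc n)} {g} h =
  (λ a b q → trans (cong (λ t → g t (a ∷ b ∷ q)) (sum-swap a b (sum q))) (proj₁ (h _) a b q)) ,
  (λ a q → proj₁ (proj₂ (h _)) a q) ,
  (λ a → sym-sum {g = λ t q → g (a + t) (a ∷ q)} (λ t → proj₂ (proj₂ (h (a + t))) a))

-- One swap of v swaps both families and the two signs cancel; a repeated entry repeats an argument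
-- of an alternating function.
sym-bialt : ∀ {n} {H : Vec ℕ n → Vec ℕ n → ℤ} → (∀ bs → Alt n (λ as → H as bs)) → (∀ as → Alt n (H as)) →
  ∀ (φ ψ : ℕ → ℕ) → Sym n (λ v → H (vmap φ v) (vmap ψ v))
sym-bialt {zero}        l r φ ψ = tt
sym-bialt {suc zero}    l r φ ψ = tt
sym-bialt {suc (suc n)} {H} l r φ ψ =
  (λ a b q → trans (proj₁ (l _) (φ a) (φ b) (vmap φ q))
    (trans (cong -_ (proj₁ (r _) (ψ a) (ψ b) (vmap ψ q))) (ℤ.neg-involutive _))) ,
  (λ a q → x≡-x⇒x≡0 _ (proj₁ (l _) (φ a) (φ a) (vmap φ q))) ,
  (λ a → sym-bialt {suc n} {λ as bs → H (φ a ∷ as) (ψ a ∷ bs)} (λ bs → proj₂ (l _) (φ a)) (λ as → proj₂ (r _) (ψ a)) φ ψ)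

-- All n-tuples below X, respectively the strictly decreasing ones, which represent the n-subsets;
-- `∑D` branches on whether X - 1 belongs to the subset, just as `choose` branches on the top row.
∑T ∑D : ∀ n → ℕ → (Vec ℕ n → ℤ) → ℤ
∑T zero    X g = g []
∑T (suc n) X g = ∑ X λ x → ∑T n X λ v → g (x ∷ v)
∑D zero    X       g = g []
∑D (suc n) zero    g = 0ℤ
∑D (suc n) (suc X) g = ∑D (suc n) X g ⊕ ∑D n X λ v → g (X ∷ v)

lin-∑T : ∀ n X → Lin (∑T n X)
lin-∑T zero    X = lin-eval []
lin-∑T (suc n) X = lin-∘ (lin-∑ X) (λ x → lin-pre (x ∷_) (lin-∑T n X))

lin-∑D : ∀ n X → Lin (∑D n X)
lin-∑D zero    X       = lin-eval []
lin-∑D (suc n) zero    = lin-0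
lin-∑D (suc n) (suc X) = lin-⊕ (lin-∑D (suc n) X) (lin-pre (X ∷_) (lin-∑D n X))

-- A tuple that contributes contains the new value X at most once, since g vanishes on repetitions;
-- by symmetry its n + 1 possible places give equal sums.
∑T-suc : ∀ n X {g} → Sym (suc n) g → ∑T (suc n) (suc X) g ≡ ∑T (suc n) X g ⊕ pos (suc n) ⊗ ∑T n X (λ v → g (X ∷ v))
∑T-suc zero    X {g} s = cong (∑T 1 X g ⊕_) (sym (ℤ.*-identityˡ _))
∑T-suc (suc n) X {g} (s , z , t) = begin
  ∑ X (λ y → ∑T (suc n) (suc X) (λ v → g (y ∷ v))) ⊕ ∑T (suc n) (suc X) (λ v → g (X ∷ v))
    ≡⟨ cong₂ _⊕_ (trans (∑-ext X (λ y → ∑T-suc n X (t y))) (add (lin-∑ X) _ _)) (∑T-suc n X (t X)) ⟩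
  (A ⊕ ∑ X (λ y → c ⊗ ∑T n X (λ v → g (y ∷ X ∷ v)))) ⊕ (B ⊕ c ⊗ ∑T n X (λ v → g (X ∷ X ∷ v)))
    ≡⟨ cong₂ (λ p q → (A ⊕ p) ⊕ (B ⊕ c ⊗ q))
         (trans (scale (lin-∑ X) c _) (cong (c ⊗_) (∑-ext X (λ y → ext (lin-∑T n X) (λ v → s y X v)))))
         (null (lin-∑T n X) (z X)) ⟩
  (A ⊕ c ⊗ B) ⊕ (B ⊕ c ⊗ 0ℤ)
    ≡⟨ ring A B c ⟩
  A ⊕ (1ℤ ⊕ c) ⊗ B ∎
  where
  c = pos (suc n)
  A = ∑T (suc (suc n)) X g
  B = ∑T (suc n) X (λ v → g (X ∷ v))
  ring : ∀ a b c → (a ⊕ c ⊗ b) ⊕ (b ⊕ c ⊗ 0ℤ) ≡ a ⊕ (1ℤ ⊕ c) ⊗ b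
  ring = solve-∀

∑T-∑D : ∀ n X {g} → Sym n g → ∑T n X g ≡ pos (n !) ⊗ ∑D n X g
∑T-∑D zero    X       s = sym (ℤ.*-identityˡ _)
∑T-∑D (suc n) zero    s = sym (ℤ.*-zeroʳ (pos (suc n !)))
∑T-∑D (suc n) (suc X) {g} s = begin
  ∑T (suc n) (suc X) g
    ≡⟨ ∑T-suc n X s ⟩
  ∑T (suc n) X g ⊕ pos (suc n) ⊗ ∑T n X (λ v → g (X ∷ v))
    ≡⟨ cong₂ (λ p q → p ⊕ pos (suc n) ⊗ q) (∑T-∑D (suc n) X s) (∑T-∑D n X (sym-tail {g = g} s X)) ⟩
  pos (suc n !) ⊗ A ⊕ pos (suc n) ⊗ (pos (n !) ⊗ B)
    ≡⟨ cong (pos (suc n !) ⊗ A ⊕_) (trans (sym (ℤ.*-assoc (pos (suc n)) (pos (n !)) B)) (cong (_⊗ B) (sym (ℤ.pos-* (suc n) (n !))))) ⟩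
  pos (suc n !) ⊗ A ⊕ pos (suc n !) ⊗ B
    ≡⟨ sym (ℤ.*-distribˡ-+ (pos (suc n !)) A B) ⟩
  pos (suc n !) ⊗ (A ⊕ B) ∎
  where
  A = ∑D (suc n) X g
  B = ∑D n X (λ v → g (X ∷ v))

∑D-few : ∀ n X {g} → X < n → ∑D n X g ≡ 0ℤ
∑D-few (suc n) zero    _       = refl
∑D-few (suc n) (suc X) (s≤s h) = cong₂ _⊕_ (∑D-few (suc n) X (ℕ.m<n⇒m<1+n h)) (∑D-few n X h)

∑D-full : ∀ n g → ∑D n n g ≡ g (δ n)
∑D-full zero    g = refl
∑D-full (suc n) g = trans (cong₂ _⊕_ (∑D-few (suc n) n ℕ.≤-refl) (∑D-full n _)) (ℤ.+-identityˡ _)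

-- A strictly decreasing n-tuple with first entry below n can only be δ n.
∑D-supp : ∀ n {X g} → Supp g → n ≤ X → ∑D n X g ≡ g (δ n)
∑D-supp zero    s _ = refl
∑D-supp (suc n) {suc X} {g} s (s≤s n≤X) with ℕ.m≤n⇒m<n∨m≡n n≤X
... | inj₂ refl = ∑D-full (suc n) g
... | inj₁ n<X  = trans (cong₂ _⊕_ (∑D-supp (suc n) {g = g} s n<X) (null (lin-∑D n X) (λ q → s X q n<X))) (ℤ.+-identityʳ _)

-- The pairs (ℓ + j , L - j), j ≤ L = ℓ - 1, are the pairs (dbl a , suc (dbl b)), a + b = L, up to orientation.

dbl≡+ : ∀ n → dbl n ≡ n + n
dbl≡+ zero    = refl
dbl≡+ (suc n) = cong suc (trans (cong suc (dbl≡+ n)) (sym (ℕ.+-suc n n)))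

∑-dbl : ∀ n f → ∑ (n + n) f ≡ ∑ n (f ∘ dbl) ⊕ ∑ n (f ∘ suc ∘ dbl)
∑-dbl n f = trans (cong (λ k → ∑ k f) (sym (dbl≡+ n))) (go n)
  where
  ring : ∀ a b c d → (a ⊕ b) ⊕ c ⊕ d ≡ (a ⊕ c) ⊕ (b ⊕ d)
  ring = solve-∀
  go : ∀ n → ∑ (dbl n) f ≡ ∑ n (f ∘ dbl) ⊕ ∑ n (f ∘ suc ∘ dbl)
  go zero    = refl
  go (suc n) = trans (cong (λ x → x ⊕ f (dbl n) ⊕ f (suc (dbl n))) (go n)) (ring (∑ n (f ∘ dbl)) (∑ n (f ∘ suc ∘ dbl)) _ _)

halve : ∀ {x y} → x ⊕ x ≡ y ⊕ y → x ≡ y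
halve {x} {y} e = ℤ.*-cancelˡ-≡ (pos 2) x y (trans (two x) (trans e (sym (two y))))
  where
  two : ∀ x → pos 2 ⊗ x ≡ x ⊕ x
  two = solve-∀

-- The indices up to 2L + 1 split into pairs of odd sum. Each pair has one member in the upper half
-- and one even member, and Q does not distinguish the members, so both sums are half of the total.
∑-fold : ∀ L Q → (∀ x y → x + y ≡ suc (L + L) → Q x ≡ Q y) → ∑ (suc L) (λ j → Q (suc L + j)) ≡ ∑ (suc L) (Q ∘ dbl)
∑-fold L Q symQ = halve (begin
  hi ⊕ hi                         ≡⟨ cong (_⊕ hi) (sym lo≡hi) ⟩
  ∑ (suc L) Q ⊕ hi                ≡⟨ sym (∑-+ (suc L) (suc L) Q) ⟩
  ∑ (suc L + suc L) Q             ≡⟨ ∑-dbl (suc L) Q ⟩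
  ev ⊕ ∑ (suc L) (Q ∘ suc ∘ dbl)  ≡⟨ cong (ev ⊕_) od≡ev ⟩
  ev ⊕ ev                         ∎)
  where
  hi = ∑ (suc L) (λ j → Q (suc L + j))
  ev = ∑ (suc L) (Q ∘ dbl)
  lo≡hi : ∑ (suc L) Q ≡ hi
  lo≡hi = trans (∑-reverse (suc L) Q) (∑-ext< (suc L) λ i i≤L → symQ (L ∸ i) (suc L + i) (begin
    L ∸ i + (suc L + i)     ≡⟨ ℕ.+-suc (L ∸ i) (L + i) ⟩
    suc (L ∸ i + (L + i))   ≡⟨ cong suc (sum-swap (L ∸ i) L i) ⟩
    suc (L + (L ∸ i + i))   ≡⟨ cong (λ x → suc (L + x)) (ℕ.m∸n+n≡m (ℕ.≤-pred i≤L)) ⟩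
    suc (L + L)             ∎))
  od≡ev : ∑ (suc L) (Q ∘ suc ∘ dbl) ≡ ev
  od≡ev = trans (∑-reverse (suc L) _) (∑-ext< (suc L) λ i i≤L → symQ (suc (dbl (L ∸ i))) (dbl i) (begin
    suc (dbl (L ∸ i) + dbl i)   ≡⟨ cong suc (sym (dbl-+ (L ∸ i) i)) ⟩
    suc (dbl (L ∸ i + i))       ≡⟨ cong (suc ∘ dbl) (ℕ.m∸n+n≡m (ℕ.≤-pred i≤L)) ⟩
    suc (dbl L)                 ≡⟨ cong suc (dbl≡+ L) ⟩
    suc (L + L)                 ∎))

-- Attach the sign of k to the pair (k , M - k), where M = 2L + 1. Since M is odd, reversing the
-- pair flips this sign and antisymmetry flips φ, so the signed value depends on the unordered pair
-- only and `∑-fold` applies. Rewriting the sign of j as that of L + 1 + j costs the factor in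
-- front.
conv-orient : ∀ {φ} → Antisym φ → ∀ L →
  ∑ (suc L) (λ j → σ j ⊗ φ (suc L + j) (L ∸ j)) ≡ σ (suc L) ⊗ conv L λ a b → φ (dbl a) (suc (dbl b))
conv-orient {φ} anti L = begin
  ∑ ℓ (λ j → σ j ⊗ φ (ℓ + j) (L ∸ j))
    ≡⟨ ∑-ext ℓ (λ j → trans (cong₂ (λ s y → s ⊗ φ (ℓ + j) y) (sign j) (sym (complement j)))
         (ℤ.*-assoc (σ ℓ) (σ (ℓ + j)) _)) ⟩
  ∑ ℓ (λ j → σ ℓ ⊗ Q (ℓ + j))
    ≡⟨ scale (lin-∑ ℓ) (σ ℓ) _ ⟩
  σ ℓ ⊗ ∑ ℓ (λ j → Q (ℓ + j))
    ≡⟨ cong (σ ℓ ⊗_) (∑-fold L Q symQ) ⟩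
  σ ℓ ⊗ ∑ ℓ (Q ∘ dbl)
    ≡⟨ cong (σ ℓ ⊗_) (∑-ext< ℓ λ a a<ℓ → trans (cong₂ (λ s y → s ⊗ φ (dbl a) y) (σ-dbl a) (odd a (ℕ.≤-pred a<ℓ))) (ℤ.*-identityˡ _)) ⟩
  σ ℓ ⊗ ∑ ℓ (λ a → φ (dbl a) (suc (dbl (L ∸ a))))
    ≡⟨ cong (σ ℓ ⊗_) (sym (trans (conv-flip L _) (conv-∑ L _))) ⟩
  σ ℓ ⊗ conv L (λ a b → φ (dbl a) (suc (dbl b))) ∎
  where
  ℓ = suc L
  M = suc (L + L)
  Q : ℕ → ℤ
  Q k = σ k ⊗ φ k (M ∸ k)
  complement : ∀ j → M ∸ (ℓ + j) ≡ L ∸ j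
  complement j = ℕ.[m+n]∸[m+o]≡n∸o L L j
  sign : ∀ j → σ j ≡ σ ℓ ⊗ σ (ℓ + j)
  sign j = sym (trans (cong (σ ℓ ⊗_) (σ-+ ℓ j)) (trans (sym (ℤ.*-assoc (σ ℓ) (σ ℓ) (σ j)))
    (trans (cong (_⊗ σ j) (σ-square ℓ)) (ℤ.*-identityˡ (σ j)))))
  odd : ∀ a → a ≤ L → M ∸ dbl a ≡ suc (dbl (L ∸ a))
  odd a a≤L = begin
    suc (L + L) ∸ dbl a                      ≡⟨ cong (λ x → suc x ∸ dbl a) (sym (dbl≡+ L)) ⟩
    suc (dbl L) ∸ dbl a                      ≡⟨ cong (λ x → suc (dbl x) ∸ dbl a) (sym (ℕ.m∸n+n≡m a≤L)) ⟩
    suc (dbl (L ∸ a + a)) ∸ dbl a            ≡⟨ cong (λ x → suc x ∸ dbl a) (dbl-+ (L ∸ a) a) ⟩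
    suc (dbl (L ∸ a)) + dbl a ∸ dbl a        ≡⟨ ℕ.m+n∸n≡m (suc (dbl (L ∸ a))) (dbl a) ⟩
    suc (dbl (L ∸ a))                        ∎
  σ-odd : ∀ x y → x + y ≡ M → σ x ≡ - σ y
  σ-odd x y e = begin
    σ x                      ≡⟨ trans (sym (ℤ.*-identityʳ (σ x))) (cong (σ x ⊗_) (sym (σ-square y))) ⟩
    σ x ⊗ (σ y ⊗ σ y)        ≡⟨ trans (sym (ℤ.*-assoc (σ x) (σ y) (σ y))) (cong (_⊗ σ y) (sym (σ-+ x y))) ⟩
    σ (x + y) ⊗ σ y          ≡⟨ cong (λ k → σ k ⊗ σ y) (trans e (cong suc (sym (dbl≡+ L)))) ⟩
    - σ (dbl L) ⊗ σ y        ≡⟨ cong (λ s → - s ⊗ σ y) (σ-dbl L) ⟩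
    -1ℤ ⊗ σ y                ≡⟨ ℤ.-1*i≡-i (σ y) ⟩
    - σ y                    ∎
  symQ : ∀ x y → x + y ≡ M → Q x ≡ Q y
  symQ x y e = begin
    σ x ⊗ φ x (M ∸ x)
      ≡⟨ cong₂ _⊗_ (σ-odd x y e) (cong (φ x) (trans (cong (_∸ x) (sym e)) (ℕ.m+n∸m≡n x y))) ⟩
    - σ y ⊗ φ x y
      ≡⟨ cong (- σ y ⊗_) (anti x y) ⟩
    - σ y ⊗ - φ y x
      ≡⟨ ring (σ y) (φ y x) ⟩
    σ y ⊗ φ y x
      ≡⟨ cong (λ z → σ y ⊗ φ y z) (sym (trans (cong (_∸ y) (sym e)) (ℕ.m+n∸n≡m x y))) ⟩
    σ y ⊗ φ y (M ∸ y) ∎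
    where
    ring : ∀ a b → - a ⊗ - b ≡ a ⊗ b
    ring = solve-∀

∑P-diagonal : ∀ n L (h : Vec ℕ n → Vec ℕ n → ℤ) →
  ∑P (replicate n L) h ≡ ∑T n (suc L) λ bs → h (vmap (L ∸_) bs) bs
∑P-diagonal zero    L h = refl
∑P-diagonal (suc n) L h = trans (conv-∑ L _) (∑-ext (suc L) λ b → ∑P-diagonal n L _)

∑T-orient : ∀ n L {F : Vec ℕ (dbl n) → ℤ} → Alt (dbl n) F →
  ∑T n (suc L) (λ js → σ (sum js) ⊗ F (il (vmap (suc L +_) js) (vmap (L ∸_) js)))
  ≡ σ (n * suc L) ⊗ ∑P (replicate n L) λ as bs → F (eo as bs)
∑T-orient zero    L alt = refl
∑T-orient (suc n) L {F} alt = begin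
  ∑ ℓ (λ j → ∑T n ℓ λ js → σ (j + sum js) ⊗ F (ℓ + j ∷ L ∸ j ∷ pairs js))
    ≡⟨ ∑-ext ℓ (λ j → trans
         (ext (lin-∑T n ℓ) (λ js → trans (cong (_⊗ F (ℓ + j ∷ L ∸ j ∷ pairs js)) (σ-+ j (sum js))) (ℤ.*-assoc (σ j) _ _)))
         (trans (scale (lin-∑T n ℓ) (σ j) _)
           (cong (σ j ⊗_) (∑T-orient n L (alt-tail {f = λ q → F (ℓ + j ∷ q)} (alt-tail {f = F} alt (ℓ + j)) (L ∸ j)))))) ⟩
  ∑ ℓ (λ j → σ j ⊗ (σ (n * ℓ) ⊗ φ (ℓ + j) (L ∸ j)))
    ≡⟨ ∑-ext ℓ (λ j → comm (σ j) (σ (n * ℓ)) _) ⟩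
  ∑ ℓ (λ j → σ (n * ℓ) ⊗ (σ j ⊗ φ (ℓ + j) (L ∸ j)))
    ≡⟨ scale (lin-∑ ℓ) (σ (n * ℓ)) _ ⟩
  σ (n * ℓ) ⊗ ∑ ℓ (λ j → σ j ⊗ φ (ℓ + j) (L ∸ j))
    ≡⟨ cong (σ (n * ℓ) ⊗_) (conv-orient anti L) ⟩
  σ (n * ℓ) ⊗ (σ ℓ ⊗ conv L (λ a b → φ (dbl a) (suc (dbl b))))
    ≡⟨ trans (comm (σ (n * ℓ)) (σ ℓ) _) (sym (ℤ.*-assoc (σ ℓ) (σ (n * ℓ)) _)) ⟩
  (σ ℓ ⊗ σ (n * ℓ)) ⊗ conv L (λ a b → φ (dbl a) (suc (dbl b)))
    ≡⟨ cong (_⊗ conv L (λ a b → φ (dbl a) (suc (dbl b)))) (sym (σ-+ ℓ (n * ℓ))) ⟩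
  σ (ℓ + n * ℓ) ⊗ conv L (λ a b → φ (dbl a) (suc (dbl b))) ∎
  where
  ℓ = suc L
  pairs : Vec ℕ n → Vec ℕ (dbl n)
  pairs js = il (vmap (ℓ +_) js) (vmap (L ∸_) js)
  φ : ℕ → ℕ → ℤ
  φ x y = ∑P (replicate n L) λ as bs → F (x ∷ y ∷ eo as bs)
  anti : Antisym φ
  anti x y = trans (∑P-ext (replicate n L) (λ as bs _ → proj₁ alt x y (eo as bs))) (neg (lin-∑P (replicate n L)) _)
  comm : ∀ a b c → a ⊗ (b ⊗ c) ≡ b ⊗ (a ⊗ c)
  comm = solve-∀

-- An alternating function supported on the permutations of δ n

∏ : ∀ {n} → (ℕ → ℤ) → Vec ℕ n → ℤ
∏ c []      = 1ℤ
∏ c (x ∷ v) = c x ⊗ ∏ c v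

alt-scale : ∀ c {n f} → Alt n f → Alt n (λ v → c ⊗ f v)
alt-scale c {zero}        h = tt
alt-scale c {suc zero}    h = tt
alt-scale c {suc (suc n)} {f} (s , t) =
  (λ a b q → trans (cong (c ⊗_) (s a b q)) (sym (ℤ.neg-distribʳ-* c (f (b ∷ a ∷ q))))) , (λ a → alt-scale c (t a))

alt-∏ : ∀ c {n f} → Alt n f → Alt n (λ v → ∏ c v ⊗ f v)
alt-∏ c {zero}        h = tt
alt-∏ c {suc zero}    h = tt
alt-∏ c {suc (suc n)} {f} (s , t) =
  (λ a b q → trans (cong ((c a ⊗ (c b ⊗ ∏ c q)) ⊗_) (s a b q)) (ring (c a) (c b) (∏ c q) (f (b ∷ a ∷ q)))) ,
  (λ a → alt-ext (λ q → ring' (c a) (∏ c q) (f (a ∷ q))) (alt-∏ c (alt-scale (c a) (t a))))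
  where
  ring : ∀ a b p x → (a ⊗ (b ⊗ p)) ⊗ - x ≡ - ((b ⊗ (a ⊗ p)) ⊗ x)
  ring = solve-∀
  ring' : ∀ a p x → p ⊗ (a ⊗ x) ≡ (a ⊗ p) ⊗ x
  ring' = solve-∀

cmp : ℕ → ℕ → ℤ
cmp zero    zero    = 0ℤ
cmp zero    (suc b) = -1ℤ
cmp (suc a) zero    = 1ℤ
cmp (suc a) (suc b) = cmp a b

cmp-antisym : Antisym cmp
cmp-antisym zero    zero    = refl
cmp-antisym zero    (suc b) = refl
cmp-antisym (suc a) zero    = refl
cmp-antisym (suc a) (suc b) = cmp-antisym a b

cmp-> : ∀ {a b} → b < a → cmp a b ≡ 1ℤ
cmp-> {suc a} {zero}  _       = refl
cmp-> {suc a} {suc b} (s≤s p) = cmp-> p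

-- A Vandermonde product with every difference replaced by its sign; it is zero on repetitions and 1
-- on decreasing vectors.
sgn : ∀ {n} → Vec ℕ n → ℤ
sgn []      = 1ℤ
sgn (x ∷ v) = ∏ (cmp x) v ⊗ sgn v

alt-sgn : ∀ n → Alt n sgn
alt-sgn zero          = tt
alt-sgn (suc zero)    = tt
alt-sgn (suc (suc n)) =
  (λ a b q → trans (cong (λ x → (x ⊗ ∏ (cmp a) q) ⊗ (∏ (cmp b) q ⊗ sgn q)) (cmp-antisym a b))
    (ring (cmp b a) (∏ (cmp a) q) (∏ (cmp b) q) (sgn q))) ,
  (λ a → alt-∏ (cmp a) (alt-sgn (suc n)))
  where
  ring : ∀ c p q s → (- c ⊗ p) ⊗ (q ⊗ s) ≡ - ((c ⊗ q) ⊗ (p ⊗ s))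
  ring = solve-∀

-- The sign of v as a permutation of δ n, and zero if it is none. It picks out the empty partition,
-- so by `D-schur` skewing it yields Schur coefficients with factor 1.
base : ∀ n → Vec ℕ n → ℤ
base n v = ∏ (λ x → ind (x <ᵇ n)) v ⊗ sgn v

alt-base : ∀ n → Alt n (base n)
alt-base n = alt-∏ _ (alt-sgn n)

supp-base : ∀ n → Supp (base n)
supp-base zero    = tt
supp-base (suc n) x q h = trans
  (cong (λ c → (c ⊗ ∏ (λ x → ind (x <ᵇ suc n)) q) ⊗ sgn (x ∷ q)) (guard-cong (≥⇒<ᵇ≡ h)))
  (trans (cong (_⊗ sgn (x ∷ q)) (ℤ.*-zeroˡ (∏ (λ x → ind (x <ᵇ suc n)) q))) (ℤ.*-zeroˡ (sgn (x ∷ q))))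

∏-δ : ∀ n {c} → (∀ x → x < n → c x ≡ 1ℤ) → ∏ c (δ n) ≡ 1ℤ
∏-δ zero    p = refl
∏-δ (suc n) {c} p = cong₂ _⊗_ (p n ℕ.≤-refl) (∏-δ n (λ x x<n → p x (ℕ.m<n⇒m<1+n x<n)))

sgn-δ : ∀ n → sgn (δ n) ≡ 1ℤ
sgn-δ zero    = refl
sgn-δ (suc n) = cong₂ _⊗_ (∏-δ n {cmp n} (λ x → cmp->)) (sgn-δ n)

base-δ : ∀ n → base n (δ n) ≡ 1ℤ
base-δ n = cong₂ _⊗_ (∏-δ n (λ x x<n → guard-cong (<⇒<ᵇ≡ x<n))) (sgn-δ n)

-- The identity for bead configurations

-- In each of the n pairs the odd bead follows the smaller even one; one swap per pair produces the
-- decreasing order.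
alt-eo-δ : ∀ n {F} → Alt (dbl n) F → F (eo (δ n) (δ n)) ≡ σ n ⊗ F (δ (dbl n))
alt-eo-δ zero    alt = sym (ℤ.*-identityˡ _)
alt-eo-δ (suc n) {F} alt = begin
  F (dbl n ∷ suc (dbl n) ∷ eo (δ n) (δ n))
    ≡⟨ proj₁ alt (dbl n) (suc (dbl n)) _ ⟩
  - F (suc (dbl n) ∷ dbl n ∷ eo (δ n) (δ n))
    ≡⟨ cong -_ (alt-eo-δ n (alt-tail {f = λ q → F (suc (dbl n) ∷ q)} (alt-tail {f = F} alt (suc (dbl n))) (dbl n))) ⟩
  - (σ n ⊗ F (δ (dbl (suc n))))
    ≡⟨ ℤ.neg-distribˡ-* (σ n) _ ⟩
  - σ n ⊗ F (δ (dbl (suc n))) ∎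

map-δ : ∀ n m L → suc L ≡ m + n → vmap (L ∸_) (δ n) ≡ asc m n
map-δ zero    m L e = refl
map-δ (suc n) m L e = cong₂ _∷_
  (trans (cong (_∸ n) (ℕ.suc-injective (trans e (ℕ.+-suc m n)))) (ℕ.m+n∸n≡m m n))
  (map-δ n (suc m) L (trans e (ℕ.+-suc m n)))

addδ-replicate : ∀ n m → addδ (replicate n m) ≡ desc m n
addδ-replicate zero    m = refl
addδ-replicate (suc n) m = cong (m + n ∷_) (addδ-replicate n m)

dec-replicate : ∀ n m → Dec (replicate n m)
dec-replicate zero          m = tt
dec-replicate (suc zero)    m = z≤n , tt
dec-replicate (suc (suc n)) m = ℕ.≤-refl , dec-replicate (suc n) m

dbl-≤ : ∀ {m n} → m ≤ n → dbl m ≤ dbl n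
dbl-≤ z≤n     = z≤n
dbl-≤ (s≤s p) = s≤s (s≤s (dbl-≤ p))

supp-eoˡ : ∀ n {F} → Supp {dbl n} F → ∀ bs → Supp {n} (λ as → F (eo as bs))
supp-eoˡ zero    s bs = tt
supp-eoˡ (suc n) s (b ∷ bs) x q h = s (dbl x) _ (dbl-≤ h)

supp-eoʳ : ∀ n {F} → Alt (dbl (suc n)) F → Supp {dbl (suc n)} F → ∀ as b bs → suc n ≤ b → F (eo as (b ∷ bs)) ≡ 0ℤ
supp-eoʳ n alt s (a ∷ as) b bs h = trans (proj₁ alt (dbl a) (suc (dbl b)) _)
  (cong -_ (s (suc (dbl b)) _ (ℕ.m≤n⇒m≤1+n (dbl-≤ h))))

-- The operators act on the even halves only. The odd halves remain parameters of `base`, so an odd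
-- bead that is too large kills every term.
supp-D : ∀ n κ φ → Supp {n} (λ bs → D (λ cs → base (dbl n) (eo cs bs)) κ (vmap φ bs))
supp-D zero    κ φ = tt
supp-D (suc n) κ φ b bs h = null (lin-D κ (vmap φ (b ∷ bs)))
  λ cs → supp-eoʳ n {base (dbl (suc n))} (alt-base (dbl (suc n))) (supp-base (dbl (suc n))) cs b bs h

∑P-rect : ∀ n m L → suc L ≡ m + n → ∀ κ →
  ∑P (replicate n L) (λ as bs → D (λ cs → base (dbl n) (eo cs bs)) κ as)
  ≡ pos (n !) ⊗ (σ (tri n) ⊗ (σ n ⊗ schur (replicate n m) (reverse κ)))
∑P-rect n m L e κ = begin
  ∑P (replicate n L) (λ as bs → H bs as)
    ≡⟨ ∑P-diagonal n L (λ as bs → H bs as) ⟩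
  ∑T n (suc L) (λ bs → H bs (vmap (L ∸_) bs))
    ≡⟨ ∑T-∑D n (suc L) symG ⟩
  pos (n !) ⊗ ∑D n (suc L) G
    -- Only odd beads 1, 3, ..., 2n - 1 survive, in one decreasing arrangement; n ≤ L + 1 guarantees
    -- that it lies in the range.
    ≡⟨ cong (pos (n !) ⊗_) (∑D-supp n (supp-D n κ (L ∸_)) (subst (n ≤_) (sym e) (ℕ.m≤n+m n m))) ⟩
  pos (n !) ⊗ H (δ n) (vmap (L ∸_) (δ n))
    ≡⟨ cong (λ v → pos (n !) ⊗ H (δ n) v) (map-δ n m L e) ⟩
  pos (n !) ⊗ H (δ n) (asc m n)
    -- The complements L - b ascend as b descends, whereas the beads of a partition are listed in
    -- descending order; the reversal costs C(n,2) swaps.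
    ≡⟨ cong (pos (n !) ⊗_) (alt-asc (altH (δ n)) m) ⟩
  pos (n !) ⊗ (σ (tri n) ⊗ H (δ n) (desc m n))
    ≡⟨ cong (λ v → pos (n !) ⊗ (σ (tri n) ⊗ H (δ n) v)) (sym (addδ-replicate n m)) ⟩
  pos (n !) ⊗ (σ (tri n) ⊗ H (δ n) (addδ (replicate n m)))
    ≡⟨ cong (λ x → pos (n !) ⊗ (σ (tri n) ⊗ x))
         (D-schur (alt-F (δ n)) (supp-eoˡ n (supp-base (dbl n)) (δ n)) κ (replicate n m) (dec-replicate n m)) ⟩
  pos (n !) ⊗ (σ (tri n) ⊗ (F (δ n) (δ n) ⊗ schur (replicate n m) (reverse κ)))
    ≡⟨ cong (λ x → pos (n !) ⊗ (σ (tri n) ⊗ (x ⊗ schur (replicate n m) (reverse κ))))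
         (trans (alt-eo-δ n (alt-base (dbl n))) (trans (cong (σ n ⊗_) (base-δ (dbl n))) (ℤ.*-identityʳ (σ n)))) ⟩
  pos (n !) ⊗ (σ (tri n) ⊗ (σ n ⊗ schur (replicate n m) (reverse κ))) ∎
  where
  F : Vec ℕ n → Vec ℕ n → ℤ
  F bs as = base (dbl n) (eo as bs)
  H : Vec ℕ n → Vec ℕ n → ℤ
  H bs as = D (F bs) κ as
  G : Vec ℕ n → ℤ
  G bs = H bs (vmap (L ∸_) bs)
  alt-F : ∀ bs → Alt n (F bs)
  alt-F bs = alt-map dbl {f = λ as → base (dbl n) (il as (vmap (suc ∘ dbl) bs))} (alt-ilˡ (alt-base (dbl n)) _)
  altH : ∀ bs → Alt n (H bs)
  altH bs = alt-D κ (alt-F bs)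
  altH' : ∀ as → Alt n (λ bs → H bs as)
  altH' as = alt-lin (lin-D κ as) (λ cs bs → F bs cs) λ cs →
    alt-map (suc ∘ dbl) {f = λ bs → base (dbl n) (il (vmap dbl cs) bs)} (alt-ilʳ (alt-base (dbl n)) (vmap dbl cs))
  map-id : ∀ {k} (v : Vec ℕ k) → vmap id v ≡ v
  map-id []      = refl
  map-id (x ∷ v) = cong (x ∷_) (map-id v)
  symG : Sym n G
  symG = sym-ext (λ v → cong (λ u → H u (vmap (L ∸_) v)) (map-id v)) (sym-bialt {H = H} altH' altH id (L ∸_))
    where
    sym-ext : ∀ {n f g} → (∀ v → f v ≡ g v) → Sym n f → Sym n g
    sym-ext {zero}        p h = tt
    sym-ext {suc zero}    p h = tt
    sym-ext {suc (suc n)} p (s , z , t) =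
      (λ a b q → trans (sym (p _)) (trans (s a b q) (p _))) ,
      (λ a q → trans (sym (p _)) (z a q)) , (λ a → sym-ext (λ v → p (a ∷ v)) (t a))

∑D-beads : ∀ n m L → suc L ≡ m + n → ∀ κ →
  ∑D n (suc L) (λ js → σ (sum js) ⊗ D (base (dbl n)) κ (il (vmap (suc L +_) js) (vmap (L ∸_) js)))
  ≡ σ (n * suc L) ⊗ guard (and (L.map even κ)) (σ (tri n) ⊗ (σ n ⊗ schur (replicate n m) (reverse (L.map (_/ 2) κ))))
∑D-beads n m L e κ = ℤ.*-cancelˡ-≡ (pos (n !)) _ _ {{n ℕ.!≢0}} (begin
  pos (n !) ⊗ ∑D n (suc L) g
    ≡⟨ sym (∑T-∑D n (suc L) symg) ⟩
  ∑T n (suc L) g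
    ≡⟨ ∑T-orient n L (alt-D κ (alt-base (dbl n))) ⟩
  σ (n * suc L) ⊗ ∑P (replicate n L) (λ as bs → D (base (dbl n)) κ (eo as bs))
    ≡⟨ cong (σ (n * suc L) ⊗_) (∑P-D (alt-base (dbl n)) κ (replicate n L)) ⟩
  σ (n * suc L) ⊗ guard ev (∑P (replicate n L) λ as bs → D (λ cs → base (dbl n) (eo cs bs)) (L.map (_/ 2) κ) as)
    ≡⟨ cong (λ x → σ (n * suc L) ⊗ guard ev x) (∑P-rect n m L e (L.map (_/ 2) κ)) ⟩
  σ (n * suc L) ⊗ guard ev (pos (n !) ⊗ R)
    ≡⟨ pull ev ⟩
  pos (n !) ⊗ (σ (n * suc L) ⊗ guard ev R) ∎)
  where
  ev = and (L.map even κ)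
  R = σ (tri n) ⊗ (σ n ⊗ schur (replicate n m) (reverse (L.map (_/ 2) κ)))
  Dκ = D (base (dbl n)) κ
  g : Vec ℕ n → ℤ
  g js = σ (sum js) ⊗ Dκ (il (vmap (suc L +_) js) (vmap (L ∸_) js))
  symg : Sym n g
  symg = sym-sum {g = λ t js → σ t ⊗ Dκ (il (vmap (suc L +_) js) (vmap (L ∸_) js))} λ t → sym-scale (σ t)
    (sym-bialt {H = λ as bs → Dκ (il as bs)} (alt-ilˡ (alt-D κ (alt-base (dbl n)))) (alt-ilʳ (alt-D κ (alt-base (dbl n)))) (suc L +_) (L ∸_))
  pull : ∀ b → σ (n * suc L) ⊗ guard b (pos (n !) ⊗ R) ≡ pos (n !) ⊗ (σ (n * suc L) ⊗ guard b R)
  pull true  = ring (σ (n * suc L)) (pos (n !)) R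
    where
    ring : ∀ a b c → a ⊗ (b ⊗ c) ≡ b ⊗ (a ⊗ c)
    ring = solve-∀
  pull false = trans (ℤ.*-zeroʳ (σ (n * suc L))) (sym (trans (cong (pos (n !) ⊗_) (ℤ.*-zeroʳ (σ (n * suc L)))) (ℤ.*-zeroʳ (pos (n !)))))

-- The 3-bar quotient of Λ ℓ with added nodes

-- The head is the top row, and a part depends only on its own choice and the number of rows below.
-- Removing the top row therefore leaves a configuration of the same kind for a smaller ℓ.
parts : List Bool → List ℕ
parts []       = []
parts (b ∷ bs) = (if b then suc (3 * length bs + 1) else 3 * length bs + 1) ∷ parts bs

Λ-suc : ∀ ℓ → Λ (suc ℓ) ≡ (3 * ℓ + 1) ∷ Λ ℓ
Λ-suc ℓ = cong ((3 * ℓ + 1) ∷_)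
  (trans (L.map-applyUpTo suc (λ i → 3 * (suc ℓ ∸ suc i) + 1) ℓ) (sym (L.map-upTo _ ℓ)))

addNodes-parts : ∀ bs → addNodes (Λ (length bs)) bs ≡ parts bs
addNodes-parts []       = refl
addNodes-parts (b ∷ bs) = trans (cong (λ xs → addNodes xs (b ∷ bs)) (Λ-suc (length bs)))
  (cong ((if b then suc (3 * length bs + 1) else 3 * length bs + 1) ∷_) (addNodes-parts bs))

-- Doubles of strict partitions, hook by hook

Strict : List ℕ → Set
Strict []       = ⊤
Strict (p ∷ ps) = nth 0 ps < p × Strict ps

parts-bound : ∀ bs → nth 0 (parts bs) ≤ 3 * length bs
parts-bound []           = z≤n
parts-bound (false ∷ bs) = subst (3 * length bs + 1 ≤_) (sym (ℕ.*-suc 3 (length bs)))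
  (subst (_≤ 3 + 3 * length bs) (ℕ.+-comm 1 (3 * length bs)) (ℕ.+-monoˡ-≤ (3 * length bs) {1} {3} (s≤s z≤n)))
parts-bound (true ∷ bs)  = subst (suc (3 * length bs + 1) ≤_) (sym (ℕ.*-suc 3 (length bs)))
  (subst (_≤ 3 + 3 * length bs) (cong suc (ℕ.+-comm 1 (3 * length bs))) (ℕ.+-monoˡ-≤ (3 * length bs) {2} {3} (s≤s (s≤s z≤n))))

parts-strict : ∀ bs → Strict (parts bs)
parts-strict []           = tt
parts-strict (false ∷ bs) =
  subst (nth 0 (parts bs) <_) (ℕ.+-comm 1 (3 * length bs)) (s≤s (parts-bound bs)) , parts-strict bs
parts-strict (true ∷ bs)  =
  ℕ.m<n⇒m<1+n (subst (nth 0 (parts bs) <_) (ℕ.+-comm 1 (3 * length bs)) (s≤s (parts-bound bs))) , parts-strict bs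

-- The local `row` of `double` with the partition as an argument, so that the diagrams of a
-- partition and of its tail can be compared.
doubleRow : List ℕ → ℕ → ℕ
doubleRow λs i =
  if i ≤ᵇ length λs
  then nth (i ∸ 1) λs + i
  else count (λ j → i ≤ᵇ (nth (j ∸ 1) λs ∸ 1) + j) (L.map suc (upTo (length λs)))

strict-nth : ∀ ps → Strict ps → ∀ j → j < length ps → 1 ≤ nth j ps × nth j ps + j ≤ nth 0 ps
strict-nth (p ∷ ps) (h , s) zero    _       = ℕ.≤-trans (s≤s z≤n) h , ℕ.≤-reflexive (ℕ.+-identityʳ p)
strict-nth (p ∷ ps) (h , s) (suc j) (s≤s l) = let (pos₁ , b) = strict-nth ps s j l in
  pos₁ , ℕ.≤-trans (ℕ.≤-reflexive (ℕ.+-suc (nth j ps) j)) (ℕ.≤-trans (s≤s b) h)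

strict-length : ∀ ps → Strict ps → length ps ≤ nth 0 ps
strict-length []       _       = z≤n
strict-length (p ∷ ps) (h , s) = ℕ.≤-trans (s≤s (strict-length ps s)) h

count-map : {A B : Set} (p : B → Bool) (h : A → B) (xs : List A) → count p (L.map h xs) ≡ count (p ∘ h) xs
count-map p h []       = refl
count-map p h (x ∷ xs) = trans (count-∷ p (h x) (L.map h xs))
  (trans (cong (_ +_) (count-map p h xs)) (sym (count-∷ (p ∘ h) x xs)))

count-upTo-suc : ∀ p n → count p (upTo (suc n)) ≡ (if p 0 then 1 else 0) + count (p ∘ suc) (upTo n)
count-upTo-suc p n = trans (count-∷ p 0 (L.applyUpTo suc n))
  (cong (_ +_) (trans (cong (count p) (sym (L.map-upTo suc n))) (count-map p suc (upTo n))))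

count-ext : ∀ n {p q : ℕ → Bool} → (∀ j → j < n → p j ≡ q j) → count p (upTo n) ≡ count q (upTo n)
count-ext zero    e = refl
count-ext (suc n) {p} {q} e = trans (count-upTo-suc p n)
  (trans (cong₂ (λ b c → (if b then 1 else 0) + c) (e 0 (s≤s z≤n)) (count-ext n (λ j l → e (suc j) (s≤s l))))
    (sym (count-upTo-suc q n)))

count-false : ∀ {A : Set} (xs : List A) → count (λ _ → false) xs ≡ 0
count-false []       = refl
count-false (x ∷ xs) = count-false xs

-- A new largest part p wraps an outer hook around the diagram. Its leg occupies the first column
-- down to row p, so within these rows the old diagram reappears moved down and right by one.
doubleRow-∷ : ∀ p ps i → suc (suc i) ≤ p → doubleRow (p ∷ ps) (suc (suc i)) ≡ suc (doubleRow ps (suc i))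
doubleRow-∷ p ps i i≤p = trans (cong (λ c → if i <ᵇ length ps then nth i ps + suc (suc i) else c) tall)
  (trans (cong (λ c → if i <ᵇ length ps then c else suc old) (ℕ.+-suc (nth i ps) (suc i))) (pull (i <ᵇ length ps)))
  where
  old = count (λ j → suc i ≤ᵇ (nth (j ∸ 1) ps ∸ 1) + j) (L.map suc (upTo (length ps)))
  d = length ps
  pull : ∀ b {x y} → (if b then suc x else suc y) ≡ suc (if b then x else y)
  pull true  = refl
  pull false = refl
  tall : count (λ j → suc (suc i) ≤ᵇ (nth (j ∸ 1) (p ∷ ps) ∸ 1) + j) (L.map suc (upTo (suc d)))
    ≡ suc (count (λ j → suc i ≤ᵇ (nth (j ∸ 1) ps ∸ 1) + j) (L.map suc (upTo d)))
  tall = begin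
    count (λ j → suc (suc i) ≤ᵇ (nth (j ∸ 1) (p ∷ ps) ∸ 1) + j) (L.map suc (upTo (suc d)))
      ≡⟨ trans (count-map (λ j → suc (suc i) ≤ᵇ (nth (j ∸ 1) (p ∷ ps) ∸ 1) + j) suc (upTo (suc d)))
           (count-upTo-suc (λ j → suc (suc i) ≤ᵇ (nth j (p ∷ ps) ∸ 1) + suc j) d) ⟩
    (if suc (suc i) ≤ᵇ (p ∸ 1) + 1 then 1 else 0) + count (λ j → suc (suc i) ≤ᵇ (nth j ps ∸ 1) + suc (suc j)) (upTo d)
      ≡⟨ cong₂ (λ b c → (if b then 1 else 0) + c)
           (≤⇒≤ᵇ≡ (subst (suc (suc i) ≤_) (sym (ℕ.m∸n+n≡m (ℕ.≤-trans (s≤s z≤n) i≤p))) i≤p))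
           (count-ext d (λ j _ → cong (suc (suc i) ≤ᵇ_) (ℕ.+-suc (nth j ps ∸ 1) (suc j)))) ⟩
    suc (count (λ j → suc i ≤ᵇ (nth j ps ∸ 1) + suc j) (upTo d))
      ≡⟨ cong suc (sym (count-map _ suc (upTo d))) ⟩
    suc (count (λ j → suc i ≤ᵇ (nth (j ∸ 1) ps ∸ 1) + j) (L.map suc (upTo d))) ∎

doubleRow-0 : ∀ ps → Strict ps → ∀ i → nth 0 ps ≤ i → doubleRow ps (suc i) ≡ 0
doubleRow-0 ps s i h = trans
  (cong (λ b → if b then nth i ps + suc i else count tall (L.map suc (upTo (length ps))))
    (≥⇒<ᵇ≡ (ℕ.≤-trans (strict-length ps s) h)))
  (trans (count-map tall suc (upTo (length ps)))
    (trans (count-ext (length ps) (λ j l → >⇒≤ᵇ≡ (small j l))) (count-false (upTo (length ps)))))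
  where
  tall : ℕ → Bool
  tall j = suc i ≤ᵇ (nth (j ∸ 1) ps ∸ 1) + j
  small : ∀ j → j < length ps → (nth j ps ∸ 1) + suc j < suc i
  small j l = let (pos₁ , b) = strict-nth ps s j l in s≤s (ℕ.≤-trans (ℕ.≤-reflexive
    (trans (ℕ.+-suc (nth j ps ∸ 1) j) (cong (_+ j) (trans (ℕ.+-comm 1 (nth j ps ∸ 1)) (ℕ.m∸n+n≡m pos₁))))) (ℕ.≤-trans b h))

applyUpTo-+ : ∀ (f : ℕ → ℕ) m n → L.applyUpTo f (m + n) ≡ L.applyUpTo f m ++ L.applyUpTo (λ i → f (m + i)) n
applyUpTo-+ f zero    n = refl
applyUpTo-+ f (suc m) n = cong (f 0 ∷_) (applyUpTo-+ (f ∘ suc) m n)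

applyUpTo-ext : ∀ {f g : ℕ → ℕ} n → (∀ i → i < n → f i ≡ g i) → L.applyUpTo f n ≡ L.applyUpTo g n
applyUpTo-ext zero    e = refl
applyUpTo-ext (suc n) e = cong₂ _∷_ (e 0 (s≤s z≤n)) (applyUpTo-ext n (λ i l → e (suc i) (s≤s l)))

applyUpTo-const : ∀ (c : ℕ) n → L.applyUpTo (λ _ → c) n ≡ L.replicate n c
applyUpTo-const c zero    = refl
applyUpTo-const c (suc n) = cong (c ∷_) (applyUpTo-const c n)

double-apply : ∀ λs → double λs ≡ L.applyUpTo (doubleRow λs ∘ suc) (nth 0 λs)
double-apply λs = trans (sym (L.map-∘ (upTo (nth 0 λs)))) (L.map-upTo _ (nth 0 λs))

-- The old diagram has q rows, so the first column of the new hook, of length p = q + z + 1, sticks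
-- out below it by z single cells.
double-∷ : ∀ q z ps → Strict (suc (q + z) ∷ ps) → q ≡ nth 0 ps →
  double (suc (q + z) ∷ ps) ≡ suc (suc (q + z)) ∷ L.map suc (double ps) ++ L.replicate z 1
double-∷ q z ps (h , s) refl = begin
  double (p ∷ ps)
    ≡⟨ double-apply (p ∷ ps) ⟩
  p + 1 ∷ L.applyUpTo (λ i → doubleRow (p ∷ ps) (suc (suc i))) (q + z)
    ≡⟨ cong₂ _∷_ (ℕ.+-comm p 1) (applyUpTo-ext (q + z) (λ i l → doubleRow-∷ p ps i (s≤s l))) ⟩
  suc p ∷ L.applyUpTo (λ i → suc (doubleRow ps (suc i))) (q + z)
    ≡⟨ cong (suc p ∷_) (applyUpTo-+ _ q z) ⟩
  suc p ∷ L.applyUpTo (λ i → suc (doubleRow ps (suc i))) q ++ L.applyUpTo (λ i → suc (doubleRow ps (suc (q + i)))) z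
    ≡⟨ cong₂ (λ xs ys → suc p ∷ xs ++ ys)
         (sym (trans (cong (L.map suc) (double-apply ps)) (L.map-applyUpTo _ suc q)))
         (trans (applyUpTo-ext z (λ i _ → cong suc (doubleRow-0 ps s (q + i) (ℕ.m≤m+n q i)))) (applyUpTo-const 1 z)) ⟩
  suc p ∷ L.map suc (double ps) ++ L.replicate z 1 ∎
  where p = suc (q + z)

-- The double, padded with zeros to three rows per part. Zeros of the inner padding become ones,
-- because the new first column runs past all of them; an added node prolongs this column by one
-- more row, and the last places stay empty.
padded : List Bool → List ℕ
padded []       = []
padded (b ∷ bs) = suc (nth 0 (parts (b ∷ bs))) ∷ L.map suc (padded bs) ++ (if b then 1 else 0) ∷ 0 ∷ []

length-padded : ∀ bs → length (padded bs) ≡ 3 * length bs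
length-padded []       = refl
length-padded (b ∷ bs) = begin
  suc (length (L.map suc (padded bs) ++ _ ∷ 0 ∷ []))      ≡⟨ cong suc (L.length-++ (L.map suc (padded bs))) ⟩
  suc (length (L.map suc (padded bs)) + 2)                ≡⟨ cong (λ n → suc (n + 2)) (trans (L.length-map suc (padded bs)) (length-padded bs)) ⟩
  suc (3 * length bs + 2)                                 ≡⟨ cong suc (ℕ.+-comm (3 * length bs) 2) ⟩
  3 + 3 * length bs                                       ≡⟨ sym (ℕ.*-suc 3 (length bs)) ⟩
  3 * suc (length bs)                                     ∎

map-replicate-++ : ∀ z c → L.map suc (L.replicate z 0) ++ c ≡ L.replicate z 1 ++ c
map-replicate-++ zero    c = refl
map-replicate-++ (suc z) c = cong (1 ∷_) (map-replicate-++ z c)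

replicate-+1 : ∀ z (c : List ℕ) → L.replicate (z + 1) 1 ++ c ≡ L.replicate z 1 ++ 1 ∷ c
replicate-+1 zero    c = refl
replicate-+1 (suc z) c = cong (1 ∷_) (replicate-+1 z c)

double-padded : ∀ bs z → nth 0 (parts bs) + z ≡ 3 * length bs → double (parts bs) ++ L.replicate z 0 ≡ padded bs
double-padded []       zero e = refl
double-padded (b ∷ bs) z    e = go b z e
  where
  k = length bs
  q = nth 0 (parts bs)
  z' = 3 * k ∸ q
  qz' : q + z' ≡ 3 * k
  qz' = ℕ.m+[n∸m]≡n (parts-bound bs)
  tail : ∀ c → L.map suc (double (parts bs)) ++ L.replicate z' 1 ++ c ≡ L.map suc (padded bs) ++ c
  tail c = begin
    L.map suc (double (parts bs)) ++ L.replicate z' 1 ++ c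
      ≡⟨ cong (L.map suc (double (parts bs)) ++_) (sym (map-replicate-++ z' c)) ⟩
    L.map suc (double (parts bs)) ++ L.map suc (L.replicate z' 0) ++ c
      ≡⟨ sym (L.++-assoc (L.map suc (double (parts bs))) _ c) ⟩
    (L.map suc (double (parts bs)) ++ L.map suc (L.replicate z' 0)) ++ c
      ≡⟨ cong (_++ c) (sym (L.map-++ suc (double (parts bs)) _)) ⟩
    L.map suc (double (parts bs) ++ L.replicate z' 0) ++ c
      ≡⟨ cong (λ xs → L.map suc xs ++ c) (double-padded bs z' qz') ⟩
    L.map suc (padded bs) ++ c ∎
  unfold : ∀ p w → p ≡ suc (q + w) → Strict (p ∷ parts bs) → ∀ c →
    double (p ∷ parts bs) ++ c ≡ suc p ∷ L.map suc (double (parts bs)) ++ L.replicate w 1 ++ c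
  unfold _ w refl s c = trans (cong (_++ c) (double-∷ q w (parts bs) s refl))
    (cong (_ ∷_) (L.++-assoc (L.map suc (double (parts bs))) (L.replicate w 1) c))
  go : ∀ b z → nth 0 (parts (b ∷ bs)) + z ≡ 3 * suc k → double (parts (b ∷ bs)) ++ L.replicate z 0 ≡ padded (b ∷ bs)
  -- The double has as many rows as its largest part, 3k + 1 here and 3k + 2 with the added node,
  -- which forces z to be 2, respectively 1.
  go false z e = trans
    (cong (λ w → double (parts (false ∷ bs)) ++ L.replicate w 0) (ℕ.+-cancelˡ-≡ (3 * k + 1) z 2
      (trans e (trans (ℕ.*-suc 3 k) (trans (ℕ.+-comm 3 (3 * k)) (sym (ℕ.+-assoc (3 * k) 1 2)))))))
    (trans (unfold _ z' (trans (ℕ.+-comm (3 * k) 1) (cong suc (sym qz'))) (parts-strict (false ∷ bs)) _)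
      (cong (suc (3 * k + 1) ∷_) (tail (0 ∷ 0 ∷ []))))
  go true z e = trans
    (cong (λ w → double (parts (true ∷ bs)) ++ L.replicate w 0) (ℕ.+-cancelˡ-≡ (suc (3 * k + 1)) z 1
      (trans e (trans (ℕ.*-suc 3 k) (trans (ℕ.+-comm 3 (3 * k)) (trans (sym (ℕ.+-assoc (3 * k) 1 2)) (ℕ.+-suc (3 * k + 1) 1)))))))
    (trans (unfold _ (z' + 1) (cong suc (trans (cong (_+ 1) (sym qz')) (ℕ.+-assoc q z' 1))) (parts-strict (true ∷ bs)) _)
      (cong (suc (suc (3 * k + 1)) ∷_) (trans (cong (L.map suc (double (parts bs)) ++_) (replicate-+1 z' (0 ∷ []))) (tail (1 ∷ 0 ∷ [])))))

-- Beads of the quotient and their shape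

trues falses : List Bool → ℕ
trues []           = 0
trues (true ∷ bs)  = suc (trues bs)
trues (false ∷ bs) = trues bs
falses []           = 0
falses (true ∷ bs)  = falses bs
falses (false ∷ bs) = suc (falses bs)

trues+falses : ∀ bs → trues bs + falses bs ≡ length bs
trues+falses []           = refl
trues+falses (true ∷ bs)  = cong suc (trues+falses bs)
trues+falses (false ∷ bs) = trans (ℕ.+-suc (trues bs) (falses bs)) (cong suc (trues+falses bs))

shape beads : ∀ bs → Vec ℕ (dbl (falses bs))
shape []           = []
shape (true ∷ bs)  = vmap suc (shape bs)
shape (false ∷ bs) = dbl (trues bs) ∷ (shape bs ∷ʳ 0)
beads []           = []
beads (true ∷ bs)  = vmap suc (beads bs)
beads (false ∷ bs) = suc (dbl (length bs)) ∷ (vmap suc (beads bs) ∷ʳ 0)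

addδ-map : ∀ {n} (v : Vec ℕ n) → addδ (vmap suc v) ≡ vmap suc (addδ v)
addδ-map []      = refl
addδ-map (x ∷ v) = cong (_ ∷_) (addδ-map v)

addδ-∷ʳ : ∀ {n} (v : Vec ℕ n) → addδ (v ∷ʳ 0) ≡ vmap suc (addδ v) ∷ʳ 0
addδ-∷ʳ []      = refl
addδ-∷ʳ {suc n} (x ∷ v) = cong₂ _∷_ (ℕ.+-suc x n) (addδ-∷ʳ v)

addδ-shape : ∀ bs → addδ (shape bs) ≡ beads bs
addδ-shape []           = refl
addδ-shape (true ∷ bs)  = trans (addδ-map (shape bs)) (cong (vmap suc) (addδ-shape bs))
addδ-shape (false ∷ bs) = cong₂ _∷_
  (trans (ℕ.+-suc (dbl (trues bs)) (dbl (falses bs))) (cong suc (trans (sym (dbl-+ (trues bs) (falses bs))) (cong dbl (trues+falses bs)))))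
  (trans (addδ-∷ʳ (shape bs)) (cong (λ v → vmap suc v ∷ʳ 0) (addδ-shape bs)))

dec-map : ∀ {n} (v : Vec ℕ n) → Dec v → Dec (vmap suc v)
dec-map []          _       = tt
dec-map (x ∷ [])    _       = z≤n , tt
dec-map (x ∷ y ∷ v) (p , d) = s≤s p , dec-map (y ∷ v) d

head0-∷ʳ : ∀ {n} (v : Vec ℕ n) → head0 (v ∷ʳ 0) ≡ head0 v
head0-∷ʳ []      = refl
head0-∷ʳ (x ∷ v) = refl

dec-∷ʳ : ∀ {n} (v : Vec ℕ n) → Dec v → Dec (v ∷ʳ 0)
dec-∷ʳ []      _       = z≤n , tt
dec-∷ʳ (x ∷ v) (p , d) = subst (_≤ x) (sym (head0-∷ʳ v)) p , dec-∷ʳ v d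

head0-map : ∀ {n} (v : Vec ℕ n) → head0 (vmap suc v) ≤ suc (head0 v)
head0-map []      = z≤n
head0-map (x ∷ v) = ℕ.≤-refl

head0-shape : ∀ bs → head0 (shape bs) ≤ dbl (trues bs)
head0-shape []           = z≤n
head0-shape (true ∷ bs)  = ℕ.≤-trans (head0-map (shape bs)) (ℕ.m≤n⇒m≤1+n (s≤s (head0-shape bs)))
head0-shape (false ∷ bs) = ℕ.≤-refl

dec-shape : ∀ bs → Dec (shape bs)
dec-shape []           = tt
dec-shape (true ∷ bs)  = dec-map (shape bs) (dec-shape bs)
dec-shape (false ∷ bs) = subst (_≤ dbl (trues bs)) (sym (head0-∷ʳ (shape bs))) (head0-shape bs) , dec-∷ʳ (shape bs) (dec-shape bs)

-- Reading the quotient off the beads of the double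

shift : List ℕ → List ℕ
shift xs = L.zipWith _+_ xs (downFrom (length xs))

-- Every old bead rises by 3, one from its longer row and two from the two rows appended after it,
-- so its residue mod 3 is kept.
shift-snoc : ∀ xs b c → shift (L.map suc xs ++ b ∷ c ∷ []) ≡ L.map (3 +_) (shift xs) ++ suc b ∷ c ∷ []
shift-snoc []       b c = cong₂ _∷_ (ℕ.+-comm b 1) (cong (_∷ []) (ℕ.+-identityʳ c))
shift-snoc (x ∷ xs) b c = cong₂ _∷_ (trans (cong (λ n → suc x + n)
    (trans (L.length-++ (L.map suc xs)) (trans (ℕ.+-comm _ 2) (cong (2 +_) (L.length-map suc xs)))))
    (cong suc (trans (ℕ.+-suc x (suc (length xs))) (cong suc (ℕ.+-suc x (length xs))))))
  (shift-snoc xs b c)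

select : List ℕ → List ℕ
select xs = L.map (λ x → (x ∸ 1) / 3) (L.filterᵇ (λ x → x % 3 ≡ᵇ 1) xs)

filter-∷ : ∀ {A : Set} (p : A → Bool) x xs → L.filterᵇ p (x ∷ xs) ≡ (if p x then x ∷ L.filterᵇ p xs else L.filterᵇ p xs)
filter-∷ p x xs with p x
... | true  = refl
... | false = refl

select-∷ : ∀ x xs → select (x ∷ xs) ≡ (if x % 3 ≡ᵇ 1 then (x ∸ 1) / 3 ∷ select xs else select xs)
select-∷ x xs = trans (cong (L.map _) (filter-∷ _ x xs)) (push (x % 3 ≡ᵇ 1))
  where
  push : ∀ b → L.map (λ x → (x ∸ 1) / 3) (if b then x ∷ L.filterᵇ (λ x → x % 3 ≡ᵇ 1) xs else L.filterᵇ (λ x → x % 3 ≡ᵇ 1) xs)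
    ≡ (if b then (x ∸ 1) / 3 ∷ select xs else select xs)
  push true  = refl
  push false = refl

select-++ : ∀ xs ys → select (xs ++ ys) ≡ select xs ++ select ys
select-++ xs ys = trans (cong (L.map _) (L.filter-++ _ xs ys)) (L.map-++ _ (L.filterᵇ _ xs) _)

select-map : ∀ xs → select (L.map (3 +_) xs) ≡ L.map suc (select xs)
select-map []       = refl
select-map (x ∷ xs) = trans (select-∷ (3 + x) (L.map (3 +_) xs))
  (trans (step₁ x) (cong (L.map suc) (sym (select-∷ x xs))))
  where
  step₁ : ∀ x → (if x % 3 ≡ᵇ 1 then (3 + x ∸ 1) / 3 ∷ select (L.map (3 +_) xs) else select (L.map (3 +_) xs))
    ≡ L.map suc (if x % 3 ≡ᵇ 1 then (x ∸ 1) / 3 ∷ select xs else select xs)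
  step₁ zero    = select-map xs
  step₁ (suc y) with suc y % 3 ≡ᵇ 1
  ... | true  = cong₂ _∷_ (m+n/n y) (select-map xs)
    where
    m+n/n : ∀ y → (3 + y) / 3 ≡ suc (y / 3)
    m+n/n y = m/n≡1+[m∸n]/n {3 + y} {3} (s≤s (s≤s (s≤s z≤n)))
  ... | false = select-map xs

toList-map : ∀ {n} (v : Vec ℕ n) → toList (vmap suc v) ≡ L.map suc (toList v)
toList-map []      = refl
toList-map (x ∷ v) = cong (suc x ∷_) (toList-map v)

toList-∷ʳ : ∀ {n} (v : Vec ℕ n) x → toList (v ∷ʳ x) ≡ toList v ++ x ∷ []
toList-∷ʳ []      x = refl
toList-∷ʳ (y ∷ v) x = cong (y ∷_) (toList-∷ʳ v x)

-- Old beads keep their runner and rise by one place. For a row without a node, with k rows below,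
-- the new beads are 6k + 4, 1 and 0: the first two are on runner 1, at places 2k + 1 and 0. For a
-- row with a node they are 6k + 5, 2 and 0, none of them on runner 1.
select-beads : ∀ bs → select (shift (padded bs)) ≡ toList (beads bs)
select-beads [] = refl
select-beads (b ∷ bs) = trans (cong (λ n → select (suc (nth 0 (parts (b ∷ bs))) + n ∷ shift (L.map suc (padded bs) ++ (if b then 1 else 0) ∷ 0 ∷ [])))
    (trans (ℕ.suc-injective (trans (length-padded (b ∷ bs)) (ℕ.*-suc 3 k))) (ℕ.+-comm 2 (3 * k))))
  (trans (cong (λ xs → select (suc (nth 0 (parts (b ∷ bs))) + (3 * k + 2) ∷ xs)) (shift-snoc (padded bs) (if b then 1 else 0) 0)) (go b))
  where
  k = length bs
  mid : ∀ c → select (L.map (3 +_) (shift (padded bs)) ++ c) ≡ toList (vmap suc (beads bs)) ++ select c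
  mid c = trans (select-++ (L.map (3 +_) (shift (padded bs))) c) (cong (_++ select c)
    (trans (select-map (shift (padded bs))) (trans (cong (L.map suc) (select-beads bs)) (sym (toList-map (beads bs))))))
  first : ∀ i → suc (i + (3 * k + 1)) + (3 * k + 2) ≡ suc (i + dbl k * 3 + 3)
  first i = cong suc (begin
    i + (3 * k + 1) + (3 * k + 2)   ≡⟨ ℕ.+-assoc i (3 * k + 1) (3 * k + 2) ⟩
    i + (3 * k + 1 + (3 * k + 2))   ≡⟨ cong (i +_) (+-swap (3 * k) 1 (3 * k) 2) ⟩
    i + (3 * k + 3 * k + 3)         ≡⟨ cong (λ x → i + (x + 3)) (trans (sym (ℕ.*-distribˡ-+ 3 k k)) (trans (cong (3 *_) (sym (dbl≡+ k))) (ℕ.*-comm 3 (dbl k)))) ⟩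
    i + (dbl k * 3 + 3)             ≡⟨ sym (ℕ.+-assoc i (dbl k * 3) 3) ⟩
    i + dbl k * 3 + 3               ∎)
  go : ∀ b → select (suc (nth 0 (parts (b ∷ bs))) + (3 * k + 2) ∷ L.map (3 +_) (shift (padded bs)) ++ suc (if b then 1 else 0) ∷ 0 ∷ []) ≡ toList (beads (b ∷ bs))
  go false = begin
    select (suc (3 * k + 1) + (3 * k + 2) ∷ xs)
      ≡⟨ trans (cong (λ x → select (x ∷ xs)) (first 0)) (select-∷ (suc (dbl k * 3 + 3)) xs) ⟩
    (if suc (dbl k * 3 + 3) % 3 ≡ᵇ 1 then (dbl k * 3 + 3) / 3 ∷ select xs else select xs)
      ≡⟨ cong₂ (λ r q → if r ≡ᵇ 1 then q ∷ select xs else select xs)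
           (trans (cong (_% 3) (cong suc (trans (ℕ.+-comm (dbl k * 3) 3) refl))) ([m+kn]%n≡m%n 1 (suc (dbl k)) 3))
           (trans (cong (_/ 3) (ℕ.+-comm (dbl k * 3) 3)) (m*n/n≡m (suc (dbl k)) 3)) ⟩
    suc (dbl k) ∷ select xs
      ≡⟨ cong (suc (dbl k) ∷_) (trans (mid (1 ∷ 0 ∷ [])) (sym (toList-∷ʳ (vmap suc (beads bs)) 0))) ⟩
    toList (beads (false ∷ bs)) ∎
    where xs = L.map (3 +_) (shift (padded bs)) ++ 1 ∷ 0 ∷ []
  go true = begin
    select (suc (1 + (3 * k + 1)) + (3 * k + 2) ∷ xs)
      ≡⟨ trans (cong (λ x → select (x ∷ xs)) (first 1)) (select-∷ (suc (suc (dbl k * 3 + 3))) xs) ⟩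
    (if suc (suc (dbl k * 3 + 3)) % 3 ≡ᵇ 1 then suc (dbl k * 3 + 3) / 3 ∷ select xs else select xs)
      ≡⟨ cong (λ r → if r ≡ᵇ 1 then suc (dbl k * 3 + 3) / 3 ∷ select xs else select xs)
           (trans (cong (_% 3) (cong (suc ∘ suc) (ℕ.+-comm (dbl k * 3) 3))) ([m+kn]%n≡m%n 2 (suc (dbl k)) 3)) ⟩
    select xs
      ≡⟨ trans (mid (2 ∷ 0 ∷ [])) (L.++-identityʳ _) ⟩
    toList (beads (true ∷ bs)) ∎
    where xs = L.map (3 +_) (shift (padded bs)) ++ 2 ∷ 0 ∷ []

length-toList : ∀ {n} (v : Vec ℕ n) → length (toList v) ≡ n
length-toList []      = refl
length-toList (x ∷ v) = cong suc (length-toList v)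

unshift : ∀ {n} (v : Vec ℕ n) → L.zipWith _∸_ (toList (addδ v)) (downFrom n) ≡ toList v
unshift []                = refl
unshift {suc n} (x ∷ v) = cong₂ _∷_ (ℕ.m+n∸n≡m x n) (unshift v)

residue₁ : ∀ k → (3 * k + 1) % 3 ≡ 1
residue₁ k = trans (cong (_% 3) (trans (ℕ.+-comm (3 * k) 1) (cong suc (ℕ.*-comm 3 k)))) ([m+kn]%n≡m%n 1 k 3)

residue₂ : ∀ k → suc (3 * k + 1) % 3 ≡ 2
residue₂ k = trans (cong (λ x → suc x % 3) (trans (ℕ.+-comm (3 * k) 1) (cong suc (ℕ.*-comm 3 k)))) ([m+kn]%n≡m%n 2 k 3)

padding : ∀ bs → let l = nth 0 (parts bs) in l + (3 ∸ l % 3) % 3 ≡ 3 * length bs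
padding []           = refl
padding (false ∷ bs) = begin
  3 * k + 1 + (3 ∸ (3 * k + 1) % 3) % 3   ≡⟨ cong (λ r → 3 * k + 1 + (3 ∸ r) % 3) (residue₁ k) ⟩
  3 * k + 1 + 2                           ≡⟨ trans (ℕ.+-assoc (3 * k) 1 2) (trans (ℕ.+-comm (3 * k) 3) (sym (ℕ.*-suc 3 k))) ⟩
  3 * suc k                               ∎
  where
  k = length bs
padding (true ∷ bs)  = begin
  suc (3 * k + 1) + (3 ∸ suc (3 * k + 1) % 3) % 3   ≡⟨ cong (λ r → suc (3 * k + 1) + (3 ∸ r) % 3) (residue₂ k) ⟩
  suc (3 * k + 1) + 1                               ≡⟨ cong suc (ℕ.+-assoc (3 * k) 1 1) ⟩
  suc (3 * k + 2)                                   ≡⟨ trans (sym (ℕ.+-suc (3 * k) 2)) (trans (ℕ.+-comm (3 * k) 3) (sym (ℕ.*-suc 3 k))) ⟩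
  3 * suc k                                         ∎
  where
  k = length bs

length-double : ∀ λs → length (double λs) ≡ nth 0 λs
length-double λs = trans (cong length (double-apply λs)) (L.length-applyUpTo _ (nth 0 λs))

barQuot1-parts : ∀ bs → barQuot1 (parts bs) ≡ toList (shape bs)
barQuot1-parts bs = begin
  L.zipWith _∸_ (select ξ) (downFrom (length (select ξ)))
    ≡⟨ cong (λ xs → L.zipWith _∸_ xs (downFrom (length xs))) sel≡ ⟩
  L.zipWith _∸_ (toList (beads bs)) (downFrom (length (toList (beads bs))))
    ≡⟨ cong (λ n → L.zipWith _∸_ (toList (beads bs)) (downFrom n)) (length-toList (beads bs)) ⟩
  L.zipWith _∸_ (toList (beads bs)) (downFrom (dbl (falses bs)))
    ≡⟨ cong (λ v → L.zipWith _∸_ (toList v) (downFrom (dbl (falses bs)))) (sym (addδ-shape bs)) ⟩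
  L.zipWith _∸_ (toList (addδ (shape bs))) (downFrom (dbl (falses bs)))
    ≡⟨ unshift (shape bs) ⟩
  toList (shape bs) ∎
  where
  λs = double (parts bs)
  len = length λs
  N = len + ((3 ∸ len % 3) % 3)
  ξ = L.zipWith _+_ (λs ++ L.replicate (N ∸ len) 0) (downFrom N)
  N≡ : N ≡ 3 * length bs
  N≡ = trans (cong (λ l → l + ((3 ∸ l % 3) % 3)) (length-double (parts bs))) (padding bs)
  sel≡ : select ξ ≡ toList (beads bs)
  sel≡ = trans (cong select (cong₂ (λ xs n → L.zipWith _+_ xs (downFrom n))
      (double-padded bs (N ∸ len) (trans (cong₂ (λ a b → a + (b ∸ len)) (sym (length-double (parts bs))) refl)
        (trans (ℕ.m+[n∸m]≡n (ℕ.m≤m+n len _)) N≡)))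
      (trans N≡ (sym (length-padded bs)))))
    (select-beads bs)

-- The beads in pairs

-- The rows without an added node, numbered 0, 1, … from the bottom row of Λ ℓ.
js : ∀ bs → Vec ℕ (falses bs)
js []           = []
js (true ∷ bs)  = js bs
js (false ∷ bs) = length bs ∷ js bs

vmap-∷ʳ : ∀ {n} (φ : ℕ → ℕ) (v : Vec ℕ n) x → vmap φ (v ∷ʳ x) ≡ vmap φ v ∷ʳ φ x
vmap-∷ʳ φ []      x = refl
vmap-∷ʳ φ (y ∷ v) x = cong (φ y ∷_) (vmap-∷ʳ φ v x)

vmap-+-suc : ∀ {n} k (v : Vec ℕ n) → vmap (k +_) (vmap suc v) ≡ vmap (suc k +_) v
vmap-+-suc k []      = refl
vmap-+-suc k (x ∷ v) = cong₂ _∷_ (ℕ.+-suc k x) (vmap-+-suc k v)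

-- The innermost bead of each pair moves past an even number of beads.
alt-beads : ∀ bs k ℓ → ℓ ≡ k + length bs → ∀ {F} → Alt (dbl (falses bs)) F →
  F (vmap (k +_) (beads bs)) ≡ F (il (vmap (ℓ +_) (js bs)) (vmap (λ j → ℓ ∸ suc j) (js bs)))
alt-beads []           k ℓ e     alt = refl
-- Here k counts the rows already passed from the top, each of which raises all remaining beads by
-- one.
alt-beads (true ∷ bs)  k ℓ e {F} alt =
  trans (cong F (vmap-+-suc k (beads bs))) (alt-beads bs (suc k) ℓ (trans e (ℕ.+-suc k (length bs))) alt)
alt-beads (false ∷ bs) k ℓ e {F} alt = begin
  F (top ∷ vmap (k +_) (vmap suc (beads bs) ∷ʳ 0))
    ≡⟨ cong (λ q → F (top ∷ q)) (trans (vmap-∷ʳ (k +_) (vmap suc (beads bs)) 0)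
         (cong (_∷ʳ (k + 0)) (vmap-+-suc k (beads bs)))) ⟩
  F (top ∷ (vmap (suc k +_) (beads bs) ∷ʳ (k + 0)))
    ≡⟨ alt-∷ʳ {f = λ q → F (top ∷ q)} (alt-tail {f = F} alt top) _ (k + 0) ⟩
  σ (dbl (falses bs)) ⊗ F (top ∷ k + 0 ∷ vmap (suc k +_) (beads bs))
    ≡⟨ trans (cong (_⊗ F (top ∷ k + 0 ∷ vmap (suc k +_) (beads bs))) (σ-dbl (falses bs))) (ℤ.*-identityˡ _) ⟩
  F (top ∷ k + 0 ∷ vmap (suc k +_) (beads bs))
    ≡⟨ cong₂ (λ x y → F (x ∷ y ∷ vmap (suc k +_) (beads bs))) top≡ bottom≡ ⟩
  F (ℓ + length bs ∷ ℓ ∸ suc (length bs) ∷ vmap (suc k +_) (beads bs))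
    ≡⟨ alt-beads bs (suc k) ℓ (trans e (ℕ.+-suc k (length bs)))
         (alt-tail {f = λ q → F (ℓ + length bs ∷ q)} (alt-tail {f = F} alt _) _) ⟩
  F (ℓ + length bs ∷ ℓ ∸ suc (length bs) ∷ il (vmap (ℓ +_) (js bs)) (vmap (λ j → ℓ ∸ suc j) (js bs))) ∎
  where
  top = k + suc (dbl (length bs))
  top≡ : top ≡ ℓ + length bs
  top≡ = trans (cong (λ x → k + suc x) (dbl≡+ (length bs)))
    (trans (sym (ℕ.+-assoc k (suc (length bs)) (length bs))) (cong (_+ length bs) (sym e)))
  bottom≡ : k + 0 ≡ ℓ ∸ suc (length bs)
  bottom≡ = trans (ℕ.+-identityʳ k) (sym (trans (cong (_∸ suc (length bs)) e) (ℕ.m+n∸n≡m k (suc (length bs)))))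

map-+0 : ∀ {n} (v : Vec ℕ n) → vmap (0 +_) v ≡ v
map-+0 []      = refl
map-+0 (x ∷ v) = cong (x ∷_) (map-+0 v)

schur-beads : ∀ bs ℓ → ℓ ≡ length bs → ∀ α → pos (schurCoeff (barQuot1 (parts bs)) α) ≡
  D (base (dbl (falses bs))) (reverse α) (il (vmap (ℓ +_) (js bs)) (vmap (λ j → ℓ ∸ suc j) (js bs)))
schur-beads bs ℓ e α = begin
  pos (schurCoeff (barQuot1 (parts bs)) α)
    ≡⟨ cong (λ λs → pos (schurCoeff λs α)) (barQuot1-parts bs) ⟩
  pos (schurCoeff (toList (shape bs)) α)
    ≡⟨ schurCoeff-schur (shape bs) α ⟩
  schur (shape bs) α
    ≡⟨ trans (sym (ℤ.*-identityˡ _)) (cong₂ _⊗_ (sym (base-δ N)) (cong (schur (shape bs)) (sym (L.reverse-involutive α)))) ⟩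
  base N (δ N) ⊗ schur (shape bs) (reverse (reverse α))
    ≡⟨ sym (D-schur (alt-base N) (supp-base N) (reverse α) (shape bs) (dec-shape bs)) ⟩
  D (base N) (reverse α) (addδ (shape bs))
    ≡⟨ cong (D (base N) (reverse α)) (trans (addδ-shape bs) (sym (map-+0 (beads bs)))) ⟩
  D (base N) (reverse α) (vmap (0 +_) (beads bs))
    ≡⟨ alt-beads bs 0 ℓ e (alt-D (reverse α) (alt-base N)) ⟩
  D (base N) (reverse α) (il (vmap (ℓ +_) (js bs)) (vmap (λ j → ℓ ∸ suc j) (js bs))) ∎
  where N = dbl (falses bs)

-- The 3-bar sign

∏L : (ℕ → ℤ) → List ℕ → ℤ
∏L f []       = 1ℤ
∏L f (x ∷ xs) = f x ⊗ ∏L f xs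

∏L-++ : ∀ f xs ys → ∏L f (xs ++ ys) ≡ ∏L f xs ⊗ ∏L f ys
∏L-++ f []       ys = sym (ℤ.*-identityˡ _)
∏L-++ f (x ∷ xs) ys = trans (cong (f x ⊗_) (∏L-++ f xs ys)) (sym (ℤ.*-assoc (f x) _ _))

∏L-1 : ∀ {f xs} → All (λ x → f x ≡ 1ℤ) xs → ∏L f xs ≡ 1ℤ
∏L-1 []       = refl
∏L-1 (p ∷ ps) = cong₂ _⊗_ p (∏L-1 ps)

inv : ℕ → ℕ → ℤ
inv x y = if y <ᵇ x then -1ℤ else 1ℤ

inv-> : ∀ {x y} → y < x → inv x y ≡ -1ℤ
inv-> p = cong (λ b → if b then -1ℤ else 1ℤ) (<⇒<ᵇ≡ p)

inv-≤ : ∀ {x y} → x ≤ y → inv x y ≡ 1ℤ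
inv-≤ p = cong (λ b → if b then -1ℤ else 1ℤ) (≥⇒<ᵇ≡ p)

inv-flip : ∀ {x y} → (x ≡ y → ⊥) → inv x y ≡ - inv y x
inv-flip {x} {y} ne with ℕ.<-cmp x y
... | tri< x<y _ _ = trans (inv-≤ (ℕ.<⇒≤ x<y)) (cong -_ (sym (inv-> x<y)))
... | tri≈ _ x≡y _ = ⊥-elim (ne x≡y)
... | tri> _ _ y<x = trans (inv-> y<x) (cong -_ (sym (inv-≤ (ℕ.<⇒≤ y<x))))

-- The inversion sign as a product over pairs of entries, so that rearranging a list becomes
-- rearranging factors.
invSign : List ℕ → ℤ
invSign []       = 1ℤ
invSign (x ∷ xs) = ∏L (inv x) xs ⊗ invSign xs

σ-inversions : ∀ xs → σ (inversions xs) ≡ invSign xs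
σ-inversions []       = refl
σ-inversions (x ∷ xs) = trans (σ-+ (count (λ y → y <ᵇ x) xs) (inversions xs)) (cong₂ _⊗_ (σ-count xs) (σ-inversions xs))
  where
  σ-count : ∀ ys → σ (count (λ y → y <ᵇ x) ys) ≡ ∏L (inv x) ys
  σ-count []       = refl
  σ-count (y ∷ ys) = trans (cong σ (count-∷ (λ y → y <ᵇ x) y ys)) (trans (split (y <ᵇ x)) (cong (inv x y ⊗_) (σ-count ys)))
    where
    c = count (λ y → y <ᵇ x) ys
    split : ∀ b → σ ((if b then 1 else 0) + c) ≡ (if b then -1ℤ else 1ℤ) ⊗ σ c
    split true  = sym (ℤ.-1*i≡-i (σ c))
    split false = sym (ℤ.*-identityˡ (σ c))

signℤ-σ : ∀ k → signℤ k ≡ σ k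
signℤ-σ zero          = refl
signℤ-σ (suc zero)    = refl
signℤ-σ (suc (suc k)) = trans (signℤ-σ k) (sym (ℤ.neg-involutive (σ k)))

invSign-insert : ∀ xs p ys → invSign (xs ++ p ∷ ys) ≡ invSign (xs ++ ys) ⊗ (∏L (λ x → inv x p) xs ⊗ ∏L (inv p) ys)
invSign-insert []       p ys = ring (∏L (inv p) ys) (invSign ys)
  where
  ring : ∀ a b → a ⊗ b ≡ b ⊗ (1ℤ ⊗ a)
  ring = solve-∀
invSign-insert (x ∷ xs) p ys = begin
  ∏L (inv x) (xs ++ p ∷ ys) ⊗ invSign (xs ++ p ∷ ys)
    ≡⟨ cong₂ _⊗_ (trans (∏L-++ (inv x) xs (p ∷ ys)) refl) (invSign-insert xs p ys) ⟩
  (∏L (inv x) xs ⊗ (inv x p ⊗ ∏L (inv x) ys)) ⊗ (invSign (xs ++ ys) ⊗ (∏L (λ x → inv x p) xs ⊗ ∏L (inv p) ys))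
    ≡⟨ ring (∏L (inv x) xs) (inv x p) (∏L (inv x) ys) (invSign (xs ++ ys)) (∏L (λ x → inv x p) xs) (∏L (inv p) ys) ⟩
  ((∏L (inv x) xs ⊗ ∏L (inv x) ys) ⊗ invSign (xs ++ ys)) ⊗ ((inv x p ⊗ ∏L (λ x → inv x p) xs) ⊗ ∏L (inv p) ys)
    ≡⟨ cong (λ c → (c ⊗ invSign (xs ++ ys)) ⊗ ((inv x p ⊗ ∏L (λ x → inv x p) xs) ⊗ ∏L (inv p) ys)) (sym (∏L-++ (inv x) xs ys)) ⟩
  (∏L (inv x) (xs ++ ys) ⊗ invSign (xs ++ ys)) ⊗ ((inv x p ⊗ ∏L (λ x → inv x p) xs) ⊗ ∏L (inv p) ys) ∎
  where
  ring : ∀ a b c d e f → (a ⊗ (b ⊗ c)) ⊗ (d ⊗ (e ⊗ f)) ≡ ((a ⊗ c) ⊗ d) ⊗ ((b ⊗ e) ⊗ f)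
  ring = solve-∀

-- The number of adjacent swaps leading from `as ++ bs` to `pairUp as bs`, in terms of the two
-- lengths: the first entry of `bs` passes all of `as`, the second all but one, and so on until one
-- list is exhausted.
pairs : ℕ → ℕ → ℕ
pairs (suc a) (suc b) = suc a + pairs a b
pairs zero    _       = 0
pairs (suc a) zero    = 0

pairUp-[] : ∀ bs → pairUp [] bs ≡ bs
pairUp-[] []      = refl
pairUp-[] (_ ∷ _) = refl

∏L-pairUp : ∀ f as bs → ∏L f (pairUp as bs) ≡ ∏L f as ⊗ ∏L f bs
∏L-pairUp f []       []       = refl
∏L-pairUp f []       (b ∷ bs) = sym (ℤ.*-identityˡ _)
∏L-pairUp f (a ∷ as) []       = sym (ℤ.*-identityʳ _)
∏L-pairUp f (a ∷ as) (b ∷ bs) = trans (cong (λ x → f b ⊗ (f a ⊗ x)) (∏L-pairUp f as bs)) (ring (f a) (f b) (∏L f as) (∏L f bs))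
  where
  ring : ∀ a b c d → b ⊗ (a ⊗ (c ⊗ d)) ≡ (a ⊗ c) ⊗ (b ⊗ d)
  ring = solve-∀

∏L-flip : ∀ {b} as → All (λ a → b ≡ a → ⊥) as → ∏L (inv b) as ≡ σ (length as) ⊗ ∏L (λ a → inv a b) as
∏L-flip     []       []         = refl
∏L-flip {b} (a ∷ as) (ne ∷ nes) = trans (cong₂ _⊗_ (inv-flip ne) (∏L-flip as nes))
  (ring (inv a b) (σ (length as)) (∏L (λ a → inv a b) as))
  where
  ring : ∀ x s y → - x ⊗ (s ⊗ y) ≡ - s ⊗ (x ⊗ y)
  ring = solve-∀

-- Each entry of `bs` is moved in front of the entries of `as` still left. Every entry passed flips
-- one factor, which requires the two positions to be distinct.
invSign-pairUp : ∀ as bs → All (λ b → All (λ a → b ≡ a → ⊥) as) bs →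
  invSign (pairUp as bs) ≡ σ (pairs (length as) (length bs)) ⊗ invSign (as ++ bs)
invSign-pairUp []       bs       _ = trans (cong invSign (pairUp-[] bs)) (sym (ℤ.*-identityˡ _))
invSign-pairUp (a ∷ as) []       _ = trans (cong invSign (sym (L.++-identityʳ (a ∷ as)))) (sym (ℤ.*-identityˡ _))
invSign-pairUp (a ∷ as) (b ∷ bs) ((ne ∷ nes) ∷ al) = begin
  (inv b a ⊗ ∏L (inv b) P) ⊗ (∏L (inv a) P ⊗ invSign P)
    ≡⟨ cong₂ (λ x y → (inv b a ⊗ x) ⊗ y) (trans (∏L-pairUp (inv b) as bs) (cong (_⊗ ∏L (inv b) bs) (∏L-flip as nes)))
         (cong₂ _⊗_ (∏L-pairUp (inv a) as bs) (invSign-pairUp as bs (drop al))) ⟩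
  (inv b a ⊗ ((s ⊗ q) ⊗ ∏L (inv b) bs)) ⊗ ((∏L (inv a) as ⊗ ∏L (inv a) bs) ⊗ (c ⊗ invSign (as ++ bs)))
    ≡⟨ cong (λ x → (x ⊗ ((s ⊗ q) ⊗ ∏L (inv b) bs)) ⊗ ((∏L (inv a) as ⊗ ∏L (inv a) bs) ⊗ (c ⊗ invSign (as ++ bs)))) (inv-flip ne) ⟩
  (- inv a b ⊗ ((s ⊗ q) ⊗ ∏L (inv b) bs)) ⊗ ((∏L (inv a) as ⊗ ∏L (inv a) bs) ⊗ (c ⊗ invSign (as ++ bs)))
    ≡⟨ ring (inv a b) s q (∏L (inv b) bs) (∏L (inv a) as) (∏L (inv a) bs) c (invSign (as ++ bs)) ⟩
  (- s ⊗ c) ⊗ ((∏L (inv a) as ⊗ (inv a b ⊗ ∏L (inv a) bs)) ⊗ (invSign (as ++ bs) ⊗ (q ⊗ ∏L (inv b) bs)))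
    ≡⟨ cong₂ _⊗_ (sym (σ-+ (suc (length as)) (pairs (length as) (length bs))))
         (cong₂ _⊗_ (sym (∏L-++ (inv a) as (b ∷ bs))) (sym (invSign-insert as b bs))) ⟩
  σ (suc (length as) + pairs (length as) (length bs)) ⊗ (∏L (inv a) (as ++ b ∷ bs) ⊗ invSign (as ++ b ∷ bs)) ∎
  where
  P = pairUp as bs
  s = σ (length as)
  c = σ (pairs (length as) (length bs))
  q = ∏L (λ a → inv a b) as
  drop : ∀ {a as bs} → All (λ b → All (λ a → b ≡ a → ⊥) (a ∷ as)) bs → All (λ b → All (λ a → b ≡ a → ⊥) as) bs
  drop []              = []
  drop ((_ ∷ p) ∷ ps) = p ∷ drop ps
  ring : ∀ x s q t u v c w → (- x ⊗ ((s ⊗ q) ⊗ t)) ⊗ ((u ⊗ v) ⊗ (c ⊗ w)) ≡ (- s ⊗ c) ⊗ ((u ⊗ (x ⊗ v)) ⊗ (w ⊗ (q ⊗ t)))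
  ring = solve-∀

runner₁ runner₂ : List Bool → List ℕ
runner₁ []           = []
runner₁ (true ∷ bs)  = runner₁ bs
runner₁ (false ∷ bs) = runner₁ bs ++ (3 * length bs + 1) ∷ []
runner₂ []           = []
runner₂ (true ∷ bs)  = runner₂ bs ++ suc (3 * length bs + 1) ∷ []
runner₂ (false ∷ bs) = runner₂ bs

runner-∷ : ∀ k p ps → runner k (p ∷ ps) ≡ runner k ps ++ (if p % 3 ≡ᵇ k then p ∷ [] else [])
runner-∷ k p ps = trans (cong (L.filterᵇ _) (L.unfold-reverse p ps))
  (trans (L.filter-++ _ (reverse ps) (p ∷ [])) (cong (runner k ps ++_) (filter-∷ (λ p → p % 3 ≡ᵇ k) p [])))

runner-true : ∀ r bs → runner r (parts (true ∷ bs)) ≡ runner r (parts bs) ++ (if 2 ≡ᵇ r then suc (3 * length bs + 1) ∷ [] else [])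
runner-true r bs = trans (runner-∷ r (suc (3 * length bs + 1)) (parts bs))
  (cong (λ i → runner r (parts bs) ++ (if i ≡ᵇ r then suc (3 * length bs + 1) ∷ [] else [])) (residue₂ (length bs)))

runner-false : ∀ r bs → runner r (parts (false ∷ bs)) ≡ runner r (parts bs) ++ (if 1 ≡ᵇ r then (3 * length bs + 1) ∷ [] else [])
runner-false r bs = trans (runner-∷ r (3 * length bs + 1) (parts bs))
  (cong (λ i → runner r (parts bs) ++ (if i ≡ᵇ r then (3 * length bs + 1) ∷ [] else [])) (residue₁ (length bs)))

runner-0 : ∀ bs → runner 0 (parts bs) ≡ []
runner-0 []           = refl
runner-0 (true ∷ bs)  = trans (runner-true 0 bs) (trans (L.++-identityʳ _) (runner-0 bs))
runner-0 (false ∷ bs) = trans (runner-false 0 bs) (trans (L.++-identityʳ _) (runner-0 bs))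

runner-1 : ∀ bs → runner 1 (parts bs) ≡ runner₁ bs
runner-1 []           = refl
runner-1 (true ∷ bs)  = trans (runner-true 1 bs) (trans (L.++-identityʳ _) (runner-1 bs))
runner-1 (false ∷ bs) = trans (runner-false 1 bs) (cong (_++ (3 * length bs + 1) ∷ []) (runner-1 bs))

runner-2 : ∀ bs → runner 2 (parts bs) ≡ runner₂ bs
runner-2 []           = refl
runner-2 (true ∷ bs)  = trans (runner-true 2 bs) (cong (_++ suc (3 * length bs + 1) ∷ []) (runner-2 bs))
runner-2 (false ∷ bs) = trans (runner-false 2 bs) (trans (L.++-identityʳ _) (runner-2 bs))

length-runner₁ : ∀ bs → length (runner₁ bs) ≡ falses bs
length-runner₁ []           = refl
length-runner₁ (true ∷ bs)  = length-runner₁ bs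
length-runner₁ (false ∷ bs) = trans (length-∷ʳ (runner₁ bs) _) (cong suc (length-runner₁ bs))

length-runner₂ : ∀ bs → length (runner₂ bs) ≡ trues bs
length-runner₂ []           = refl
length-runner₂ (true ∷ bs)  = trans (length-∷ʳ (runner₂ bs) _) (cong suc (length-runner₂ bs))
length-runner₂ (false ∷ bs) = length-runner₂ bs

residues₁ : ∀ bs → All (λ a → a % 3 ≡ 1) (runner₁ bs)
residues₁ []           = []
residues₁ (true ∷ bs)  = residues₁ bs
residues₁ (false ∷ bs) = All-++ (residues₁ bs) (residue₁ (length bs) ∷ [])

residues₂ : ∀ bs → All (λ a → a % 3 ≡ 2) (runner₂ bs)
residues₂ []           = []
residues₂ (true ∷ bs)  = All-++ (residues₂ bs) (residue₂ (length bs) ∷ [])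
residues₂ (false ∷ bs) = residues₂ bs

disjoint : ∀ {as bs} → All (λ a → a % 3 ≡ 1) as → All (λ b → b % 3 ≡ 2) bs → All (λ b → All (λ a → b ≡ a → ⊥) as) bs
disjoint r₁ r₂ = All.map (λ e₂ → All.map (λ e₁ e → 1≢2 (trans (sym e₁) (trans (cong (_% 3) (sym e)) e₂))) r₁) r₂
  where
  1≢2 : 1 ≡ 2 → ⊥
  1≢2 ()

widen : ∀ (bs : List Bool) {xs} → All (_≤ 3 * length bs) xs → All (_≤ 3 * suc (length bs)) xs
widen bs = All.map (λ p → ℕ.≤-trans p (ℕ.*-monoʳ-≤ 3 (ℕ.n≤1+n (length bs))))

bound₁ : ∀ bs → All (_≤ 3 * length bs) (runner₁ bs)
bound₁ []           = []
bound₁ (true ∷ bs)  = widen bs (bound₁ bs)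
bound₁ (false ∷ bs) = All-++ (widen bs (bound₁ bs)) (parts-bound (false ∷ bs) ∷ [])

bound₂ : ∀ bs → All (_≤ 3 * length bs) (runner₂ bs)
bound₂ []           = []
bound₂ (true ∷ bs)  = All-++ (widen bs (bound₂ bs)) (parts-bound (true ∷ bs) ∷ [])
bound₂ (false ∷ bs) = widen bs (bound₂ bs)

∏L-small : ∀ {p} xs → All (_< p) xs → ∏L (inv p) xs ≡ σ (length xs)
∏L-small []       []       = refl
∏L-small (x ∷ xs) (l ∷ ls) = trans (cong₂ _⊗_ (inv-> l) (∏L-small xs ls)) (ℤ.-1*i≡-i _)

-- Only a runner-1 bead placed before a smaller runner-2 bead gives an inversion. The unchanged row
-- with index j thus contributes j minus the number of unchanged rows below it, in total Σ j -
-- C(n,2), and modulo 2 the minus sign is immaterial.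
invSign-runners : ∀ bs → invSign (runner₁ bs ++ runner₂ bs) ≡ σ (tri (falses bs)) ⊗ σ (sum (js bs))
invSign-runners [] = refl
invSign-runners (true ∷ bs) = begin
  invSign (runner₁ bs ++ runner₂ bs ++ p ∷ [])
    ≡⟨ cong invSign (sym (L.++-assoc (runner₁ bs) (runner₂ bs) (p ∷ []))) ⟩
  invSign ((runner₁ bs ++ runner₂ bs) ++ p ∷ [])
    ≡⟨ invSign-insert (runner₁ bs ++ runner₂ bs) p [] ⟩
  invSign ((runner₁ bs ++ runner₂ bs) ++ []) ⊗ (∏L (λ x → inv x p) (runner₁ bs ++ runner₂ bs) ⊗ 1ℤ)
    ≡⟨ cong₂ (λ xs c → invSign xs ⊗ (c ⊗ 1ℤ)) (L.++-identityʳ (runner₁ bs ++ runner₂ bs))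
         (∏L-1 (All.map (λ q → inv-≤ (ℕ.≤-trans q below)) (All-++ (bound₁ bs) (bound₂ bs)))) ⟩
  invSign (runner₁ bs ++ runner₂ bs) ⊗ 1ℤ
    ≡⟨ trans (ℤ.*-identityʳ _) (invSign-runners bs) ⟩
  σ (tri (falses bs)) ⊗ σ (sum (js bs)) ∎
  where
  p = suc (3 * length bs + 1)
  below : 3 * length bs ≤ p
  below = ℕ.m≤n⇒m≤1+n (ℕ.m≤m+n (3 * length bs) 1)
invSign-runners (false ∷ bs) = begin
  invSign ((runner₁ bs ++ p ∷ []) ++ runner₂ bs)
    ≡⟨ cong invSign (L.++-assoc (runner₁ bs) (p ∷ []) (runner₂ bs)) ⟩
  invSign (runner₁ bs ++ p ∷ runner₂ bs)
    ≡⟨ invSign-insert (runner₁ bs) p (runner₂ bs) ⟩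
  invSign (runner₁ bs ++ runner₂ bs) ⊗ (∏L (λ x → inv x p) (runner₁ bs) ⊗ ∏L (inv p) (runner₂ bs))
    ≡⟨ cong₂ _⊗_ (invSign-runners bs) (cong₂ _⊗_
         (∏L-1 (All.map (λ q → inv-≤ (ℕ.≤-trans q (ℕ.m≤m+n (3 * length bs) 1))) (bound₁ bs)))
         (trans (∏L-small (runner₂ bs) (All.map (λ {x} q → subst (x <_) (ℕ.+-comm 1 (3 * length bs)) (s≤s q)) (bound₂ bs)))
           (cong σ (length-runner₂ bs)))) ⟩
  (σ (tri n) ⊗ σ (sum (js bs))) ⊗ (1ℤ ⊗ σ t)
    ≡⟨ ring (σ (tri n)) (σ (sum (js bs))) (σ t) ⟩
  1ℤ ⊗ (σ (tri n) ⊗ (σ t ⊗ σ (sum (js bs))))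
    -- The t changed rows below number `length bs` - n; inserting the square of (-1)^n splits their
    -- sign into a step of `tri` and the index of this row.
    ≡⟨ cong (_⊗ (σ (tri n) ⊗ (σ t ⊗ σ (sum (js bs))))) (sym (σ-square n)) ⟩
  (σ n ⊗ σ n) ⊗ (σ (tri n) ⊗ (σ t ⊗ σ (sum (js bs))))
    ≡⟨ ring' (σ n) (σ (tri n)) (σ t) (σ (sum (js bs))) ⟩
  (σ n ⊗ σ (tri n)) ⊗ ((σ t ⊗ σ n) ⊗ σ (sum (js bs)))
    ≡⟨ cong₂ _⊗_ (sym (σ-+ n (tri n))) (trans (cong (_⊗ σ (sum (js bs))) (trans (sym (σ-+ t n)) (cong σ (trues+falses bs))))
         (sym (σ-+ (length bs) (sum (js bs))))) ⟩
  σ (n + tri n) ⊗ σ (length bs + sum (js bs)) ∎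
  where
  p = 3 * length bs + 1
  n = falses bs
  t = trues bs
  ring : ∀ a b c → (a ⊗ b) ⊗ (1ℤ ⊗ c) ≡ 1ℤ ⊗ (a ⊗ (c ⊗ b))
  ring = solve-∀
  ring' : ∀ s a t b → (s ⊗ s) ⊗ (a ⊗ (t ⊗ b)) ≡ (s ⊗ a) ⊗ ((t ⊗ s) ⊗ b)
  ring' = solve-∀

barSign-parts : ∀ bs → barSign (parts bs) ≡ σ (pairs (falses bs) (trues bs)) ⊗ (σ (tri (falses bs)) ⊗ σ (sum (js bs)))
barSign-parts bs = begin
  barSign (parts bs)
    ≡⟨ trans (signℤ-σ (inversions (barOrder (parts bs)))) (σ-inversions (barOrder (parts bs))) ⟩
  invSign (runner 0 (parts bs) ++ pairUp (runner 1 (parts bs)) (runner 2 (parts bs)))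
    ≡⟨ cong invSign (cong₂ _++_ (runner-0 bs) (cong₂ pairUp (runner-1 bs) (runner-2 bs))) ⟩
  invSign (pairUp (runner₁ bs) (runner₂ bs))
    ≡⟨ invSign-pairUp (runner₁ bs) (runner₂ bs) (disjoint (residues₁ bs) (residues₂ bs)) ⟩
  σ (pairs (length (runner₁ bs)) (length (runner₂ bs))) ⊗ invSign (runner₁ bs ++ runner₂ bs)
    ≡⟨ cong₂ (λ n x → σ n ⊗ x) (cong₂ pairs (length-runner₁ bs) (length-runner₂ bs)) (invSign-runners bs) ⟩
  σ (pairs (falses bs) (trues bs)) ⊗ (σ (tri (falses bs)) ⊗ σ (sum (js bs))) ∎

-- Choices of rows and the sign ε

choose-few : ∀ n k → n < k → choose n k ≡ []
choose-few zero    (suc k) _       = refl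
choose-few (suc n) (suc k) (s≤s h) = cong₂ (λ xs ys → L.map (false ∷_) xs ++ L.map (true ∷_) ys)
  (choose-few n (suc k) (ℕ.m<n⇒m<1+n h)) (choose-few n k h)

-- A choice of m rows is turned into the decreasing list of indices of the n others. The family g
-- covers all lengths because `falses bs` is n only up to a proof.
∑L-choose : ∀ ℓ n m → ℓ ≡ n + m → (G : List Bool → ℤ) (g : ∀ k → Vec ℕ k → ℤ) →
  (∀ bs → length bs ≡ ℓ → trues bs ≡ m → G bs ≡ g (falses bs) (js bs)) → ∑L (choose ℓ m) G ≡ ∑D n ℓ (g n)
∑L-choose zero    zero    zero    e G g h = trans (ℤ.+-identityʳ (G [])) (h [] refl refl)
∑L-choose (suc ℓ) zero    (suc m) e G g h = begin
  ∑L (L.map (false ∷_) (choose ℓ (suc m)) ++ L.map (true ∷_) (choose ℓ m)) G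
    ≡⟨ cong (λ xs → ∑L (L.map (false ∷_) xs ++ L.map (true ∷_) (choose ℓ m)) G) (choose-few ℓ (suc m) (ℕ.≤-reflexive e)) ⟩
  ∑L (L.map (true ∷_) (choose ℓ m)) G
    ≡⟨ trans (∑L-map (true ∷_) (choose ℓ m) G) (∑L-choose ℓ zero m (ℕ.suc-injective e) (G ∘ (true ∷_)) g
         (λ bs l t → h (true ∷ bs) (cong suc l) (cong suc t))) ⟩
  g 0 [] ∎
∑L-choose (suc ℓ) (suc n) zero    e G g h = begin
  ∑L (L.map (false ∷_) (choose ℓ 0)) G
    ≡⟨ trans (∑L-map (false ∷_) (choose ℓ 0) G) (∑L-choose ℓ n zero (ℕ.suc-injective e) (G ∘ (false ∷_)) (λ k v → g (suc k) (ℓ ∷ v))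
         (λ bs l t → trans (h (false ∷ bs) (cong suc l) t) (cong (λ x → g (suc (falses bs)) (x ∷ js bs)) l))) ⟩
  ∑D n ℓ (λ v → g (suc n) (ℓ ∷ v))
    ≡⟨ trans (sym (ℤ.+-identityˡ _)) (cong (_⊕ ∑D n ℓ (λ v → g (suc n) (ℓ ∷ v)))
         (sym (∑D-few (suc n) ℓ (ℕ.≤-reflexive (trans e (ℕ.+-identityʳ (suc n))))))) ⟩
  ∑D (suc n) (suc ℓ) (g (suc n)) ∎
∑L-choose (suc ℓ) (suc n) (suc m) e G g h = begin
  ∑L (L.map (false ∷_) (choose ℓ (suc m)) ++ L.map (true ∷_) (choose ℓ m)) G
    ≡⟨ ∑L-++ (L.map (false ∷_) (choose ℓ (suc m))) _ G ⟩
  ∑L (L.map (false ∷_) (choose ℓ (suc m))) G ⊕ ∑L (L.map (true ∷_) (choose ℓ m)) G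
    ≡⟨ cong₂ _⊕_
         (trans (∑L-map (false ∷_) (choose ℓ (suc m)) G) (∑L-choose ℓ n (suc m) (ℕ.suc-injective e) (G ∘ (false ∷_)) (λ k v → g (suc k) (ℓ ∷ v))
           (λ bs l t → trans (h (false ∷ bs) (cong suc l) t) (cong (λ x → g (suc (falses bs)) (x ∷ js bs)) l))))
         (trans (∑L-map (true ∷_) (choose ℓ m) G) (∑L-choose ℓ (suc n) m (trans (ℕ.suc-injective e) (ℕ.+-suc n m)) (G ∘ (true ∷_)) g
           (λ bs l t → h (true ∷ bs) (cong suc l) (cong suc t)))) ⟩
  ∑D n ℓ (λ v → g (suc n) (ℓ ∷ v)) ⊕ ∑D (suc n) ℓ (g (suc n))
    ≡⟨ ℤ.+-comm _ (∑D (suc n) ℓ (g (suc n))) ⟩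
  ∑D (suc n) (suc ℓ) (g (suc n)) ∎

C2≡tri : ∀ n → n C 2 ≡ tri n
C2≡tri zero    = refl
C2≡tri (suc n) = trans (sym (nCk+nC[k+1]≡[n+1]C[k+1] n 1)) (cong₂ _+_ (nC1≡n n) (C2≡tri n))

pairs-≥ : ∀ n m → m ≤ n → pairs n m + tri m ≡ n * m
pairs-≥ zero    zero    _       = refl
pairs-≥ (suc n) zero    _       = sym (ℕ.*-zeroʳ n)
pairs-≥ (suc n) (suc m) (s≤s h) = begin
  suc n + pairs n m + (m + tri m)   ≡⟨ +-swap (suc n) (pairs n m) m (tri m) ⟩
  suc n + m + (pairs n m + tri m)   ≡⟨ cong₂ _+_ (cong suc (ℕ.+-comm n m)) (pairs-≥ n m h) ⟩
  suc m + n + n * m                 ≡⟨ ℕ.+-assoc (suc m) n (n * m) ⟩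
  suc m + (n + n * m)               ≡⟨ cong (suc m +_) (sym (ℕ.*-suc n m)) ⟩
  suc m + n * suc m                 ∎

pairs-≤ : ∀ n m → n ≤ m → pairs n m ≡ tri (suc n)
pairs-≤ zero    m       _       = refl
pairs-≤ (suc n) (suc m) (s≤s h) = cong (suc n +_) (pairs-≤ n m h)

-- The two cases of ε come from the two ways the pairing can end. If m ≤ n, then `pairs` is n + (n -
-- 1) + ... with m terms, that is nm - C(m,2); if n ≤ m, it runs down to 1 and is C(n+1,2).
ε-pairs : ∀ n m → ε (n + m) m ≡ σ (pairs n m) ⊗ σ (n * m)
ε-pairs n m = trans (cong (λ x → if 2 * m ≤ᵇ n + m then signℤ (m C 2) else signℤ (((x + 1) C 2) + x * m)) (ℕ.m+n∸n≡m n m))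
  (go (ℕ.≤-total m n))
  where
  small : 2 * m ≤ n + m → (if 2 * m ≤ᵇ n + m then signℤ (m C 2) else signℤ (((n + 1) C 2) + n * m)) ≡ signℤ (m C 2)
  small p = cong (λ b → if b then signℤ (m C 2) else signℤ (((n + 1) C 2) + n * m)) (≤⇒≤ᵇ≡ p)
  at≥ : m ≤ n → signℤ (m C 2) ≡ σ (pairs n m) ⊗ σ (n * m)
  at≥ m≤n = begin
    signℤ (m C 2)
      ≡⟨ trans (signℤ-σ (m C 2)) (cong σ (C2≡tri m)) ⟩
    σ (tri m)
      ≡⟨ trans (sym (ℤ.*-identityˡ _)) (cong (_⊗ σ (tri m)) (sym (σ-square (pairs n m)))) ⟩
    (σ (pairs n m) ⊗ σ (pairs n m)) ⊗ σ (tri m)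
      ≡⟨ trans (ℤ.*-assoc (σ (pairs n m)) _ _) (cong (σ (pairs n m) ⊗_) (sym (σ-+ (pairs n m) (tri m)))) ⟩
    σ (pairs n m) ⊗ σ (pairs n m + tri m)
      ≡⟨ cong (λ x → σ (pairs n m) ⊗ σ x) (pairs-≥ n m m≤n) ⟩
    σ (pairs n m) ⊗ σ (n * m) ∎
  go : m ≤ n ⊎ n ≤ m → (if 2 * m ≤ᵇ n + m then signℤ (m C 2) else signℤ (((n + 1) C 2) + n * m)) ≡ σ (pairs n m) ⊗ σ (n * m)
  go (inj₁ m≤n) = trans (small (subst (_≤ n + m) (cong (m +_) (sym (ℕ.+-identityʳ m))) (ℕ.+-monoˡ-≤ m m≤n))) (at≥ m≤n)
  go (inj₂ n≤m) with ℕ.m≤n⇒m<n∨m≡n n≤m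
  -- For n = m the definition of ε takes its first case, so equality has to be sent to the other
  -- branch.
  ... | inj₂ refl = go (inj₁ ℕ.≤-refl)
  ... | inj₁ n<m  = begin
    (if 2 * m ≤ᵇ n + m then signℤ (m C 2) else signℤ (((n + 1) C 2) + n * m))
      ≡⟨ cong (λ b → if b then signℤ (m C 2) else signℤ (((n + 1) C 2) + n * m))
           (>⇒≤ᵇ≡ (subst (n + m <_) (cong (m +_) (sym (ℕ.+-identityʳ m))) (ℕ.+-monoˡ-< m n<m))) ⟩
    signℤ (((n + 1) C 2) + n * m)
      ≡⟨ trans (signℤ-σ (((n + 1) C 2) + n * m)) (σ-+ ((n + 1) C 2) (n * m)) ⟩
    σ ((n + 1) C 2) ⊗ σ (n * m)
      ≡⟨ cong (λ x → σ x ⊗ σ (n * m)) (trans (cong (_C 2) (ℕ.+-comm n 1)) (trans (C2≡tri (suc n)) (sym (pairs-≤ n m n≤m)))) ⟩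
    σ (pairs n m) ⊗ σ (n * m) ∎

σ-n² : ∀ n → σ (n * n) ≡ σ n
σ-n² zero    = refl
σ-n² (suc n) = begin
  - σ (n + n * suc n)                  ≡⟨ cong -_ (trans (cong (λ x → σ (n + x)) (ℕ.*-suc n n)) (trans (σ-+ n (n + n * n)) (cong (σ n ⊗_) (σ-+ n (n * n))))) ⟩
  - (σ n ⊗ (σ n ⊗ σ (n * n)))          ≡⟨ cong -_ (trans (sym (ℤ.*-assoc (σ n) (σ n) _)) (cong₂ _⊗_ (σ-square n) (σ-n² n))) ⟩
  - (1ℤ ⊗ σ n)                         ≡⟨ cong -_ (ℤ.*-identityˡ (σ n)) ⟩
  - σ n                                ∎

σ-n*[n+m] : ∀ n m → σ (n * (n + m)) ⊗ σ n ≡ σ (n * m)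
σ-n*[n+m] n m = begin
  σ (n * (n + m)) ⊗ σ n               ≡⟨ cong (_⊗ σ n) (trans (cong σ (ℕ.*-distribˡ-+ n n m)) (trans (σ-+ (n * n) (n * m)) (cong (_⊗ σ (n * m)) (σ-n² n)))) ⟩
  (σ n ⊗ σ (n * m)) ⊗ σ n             ≡⟨ ring (σ n) (σ (n * m)) ⟩
  (σ n ⊗ σ n) ⊗ σ (n * m)             ≡⟨ trans (cong (_⊗ σ (n * m)) (σ-square n)) (ℤ.*-identityˡ _) ⟩
  σ (n * m)                           ∎
  where
  ring : ∀ a b → (a ⊗ b) ⊗ a ≡ (a ⊗ a) ⊗ b
  ring = solve-∀

and-reverse : ∀ bs → and (reverse bs) ≡ and bs
and-reverse []       = refl
and-reverse (b ∷ bs) = begin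
  and (reverse (b ∷ bs))          ≡⟨ cong and (L.unfold-reverse b bs) ⟩
  and (reverse bs ++ b ∷ [])      ≡⟨ and-++ (reverse bs) (b ∷ []) ⟩
  and (reverse bs) ∧ (b ∧ true)   ≡⟨ cong₂ _∧_ (and-reverse bs) (∧-identityʳ b) ⟩
  and bs ∧ b                      ≡⟨ ∧-comm (and bs) b ⟩
  b ∧ and bs                      ∎

p2-schur : ∀ n m α → guard (and (L.map even (reverse α))) (schur (replicate n m) (reverse (L.map (_/ 2) (reverse α))))
  ≡ pos (p2∘ (schurCoeff (rect n m)) α)
p2-schur n m α = trans
  (cong₂ (λ b β → guard b (schur (replicate n m) β))
    (trans (cong and (L.reverse-map even α)) (and-reverse (L.map even α)))
    (trans (cong reverse (L.reverse-map (_/ 2) α)) (L.reverse-involutive (L.map (_/ 2) α))))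
  (pull (and (L.map even α)))
  where
  toList-replicate : ∀ n → toList (replicate n m) ≡ rect n m
  toList-replicate zero    = refl
  toList-replicate (suc n) = cong (m ∷_) (toList-replicate n)
  pull : ∀ b → guard b (schur (replicate n m) (L.map (_/ 2) α)) ≡ pos (if b then schurCoeff (rect n m) (L.map (_/ 2) α) else 0)
  pull true  = trans (sym (schurCoeff-schur (replicate n m) (L.map (_/ 2) α)))
    (cong (λ λs → pos (schurCoeff λs (L.map (_/ 2) α))) (toList-replicate n))
  pull false = refl

lhs≡rhs : ∀ n m L → suc L ≡ n + m → ∀ α → lhsCoeff (suc L) m α ≡ ε (suc L) m ⊗ pos (p2∘ (schurCoeff (rect n m)) α)
lhs≡rhs n m L e α = begin
  ∑L (F1 m ℓ) (λ μ → barSign μ ⊗ pos (schurCoeff (barQuot1 μ) α))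
    ≡⟨ ∑L-map (addNodes (Λ ℓ)) (choose ℓ m) _ ⟩
  ∑L (choose ℓ m) (λ bs → term (addNodes (Λ ℓ) bs))
    ≡⟨ ∑L-choose ℓ n m e _ g termwise ⟩
  ∑D n ℓ (g n)
    ≡⟨ scale (lin-∑D n ℓ) (c n) _ ⟩
  c n ⊗ ∑D n ℓ (λ v → σ (sum v) ⊗ D (base (dbl n)) κ (il (vmap (ℓ +_) v) (vmap (L ∸_) v)))
    ≡⟨ cong (c n ⊗_) (∑D-beads n m L (trans e (ℕ.+-comm n m)) κ) ⟩
  c n ⊗ (σ (n * ℓ) ⊗ guard ev (σ (tri n) ⊗ (σ n ⊗ S)))
    -- The two signs of C(n,2) cancel here: one comes from the runners, the other from reversing the
    -- beads of the rectangle.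
    ≡⟨ collect ev ⟩
  (σ (pairs n m) ⊗ (σ (n * ℓ) ⊗ σ n)) ⊗ guard ev S
    ≡⟨ cong₂ _⊗_ sign (p2-schur n m α) ⟩
  ε ℓ m ⊗ pos (p2∘ (schurCoeff (rect n m)) α) ∎
  where
  ℓ = suc L
  κ = reverse α
  ev = and (L.map even κ)
  S = schur (replicate n m) (reverse (L.map (_/ 2) κ))
  term : List ℕ → ℤ
  term μ = barSign μ ⊗ pos (schurCoeff (barQuot1 μ) α)
  c : ℕ → ℤ
  c k = σ (pairs k m) ⊗ σ (tri k)
  g : ∀ k → Vec ℕ k → ℤ
  g k v = c k ⊗ (σ (sum v) ⊗ D (base (dbl k)) κ (il (vmap (ℓ +_) v) (vmap (L ∸_) v)))
  termwise : ∀ bs → length bs ≡ ℓ → trues bs ≡ m → term (addNodes (Λ ℓ) bs) ≡ g (falses bs) (js bs)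
  termwise bs l refl = begin
    term (addNodes (Λ ℓ) bs)
      ≡⟨ cong term (trans (cong (λ k → addNodes (Λ k) bs) (sym l)) (addNodes-parts bs)) ⟩
    barSign (parts bs) ⊗ pos (schurCoeff (barQuot1 (parts bs)) α)
      ≡⟨ cong₂ _⊗_ (barSign-parts bs) (schur-beads bs ℓ (sym l) α) ⟩
    (σ (pairs (falses bs) m) ⊗ (σ (tri (falses bs)) ⊗ σ (sum (js bs)))) ⊗ B
      ≡⟨ ring (σ (pairs (falses bs) m)) (σ (tri (falses bs))) (σ (sum (js bs))) B ⟩
    g (falses bs) (js bs) ∎
    where
    B = D (base (dbl (falses bs))) κ (il (vmap (ℓ +_) (js bs)) (vmap (L ∸_) (js bs)))
    ring : ∀ a b c d → (a ⊗ (b ⊗ c)) ⊗ d ≡ (a ⊗ b) ⊗ (c ⊗ d)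
    ring = solve-∀
  collect : ∀ b → c n ⊗ (σ (n * ℓ) ⊗ guard b (σ (tri n) ⊗ (σ n ⊗ S))) ≡ (σ (pairs n m) ⊗ (σ (n * ℓ) ⊗ σ n)) ⊗ guard b S
  collect true  = trans (ring (σ (pairs n m)) (σ (tri n)) (σ (n * ℓ)) (σ n) S)
    (trans (cong (_⊗ ((σ (pairs n m) ⊗ (σ (n * ℓ) ⊗ σ n)) ⊗ S)) (σ-square (tri n))) (ℤ.*-identityˡ _))
    where
    ring : ∀ a t b s x → (a ⊗ t) ⊗ (b ⊗ (t ⊗ (s ⊗ x))) ≡ (t ⊗ t) ⊗ ((a ⊗ (b ⊗ s)) ⊗ x)
    ring = solve-∀
  collect false = trans (trans (cong (c n ⊗_) (ℤ.*-zeroʳ (σ (n * ℓ)))) (ℤ.*-zeroʳ (c n)))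
    (sym (ℤ.*-zeroʳ (σ (pairs n m) ⊗ (σ (n * ℓ) ⊗ σ n))))
  sign : σ (pairs n m) ⊗ (σ (n * ℓ) ⊗ σ n) ≡ ε ℓ m
  sign = trans (cong (σ (pairs n m) ⊗_) (trans (cong (λ x → σ (n * x) ⊗ σ n) e) (σ-n*[n+m] n m)))
    (trans (sym (ε-pairs n m)) (cong (λ x → ε x m) (sym e)))

theorem6p1 : (ℓ m : ℕ) → 1 ≤ ℓ → m ≤ ℓ →
    (α : List ℕ) → lhsCoeff ℓ m α ≡ rhsCoeff ℓ m α
theorem6p1 (suc L) m _ m≤ℓ α = lhs≡rhs (suc L ∸ m) m L (sym (ℕ.m∸n+n≡m m≤ℓ)) α
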